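{- (i) Any 3-connected cubic graph of path-width 3 and girth 4 can be obtained from a $K_{3,3}$ by a finite number of the construction steps $C_1$ and $C_2$. (ii) Any cubic graph of path-width 3 and girth 4 can be constructed from a $K_{3,3}$ by applying a finite number of the construction steps $C_1, C_2, C_3, C_4, C_5, C_6$. Here $C_1,\dots,C_6$ are the local replacement operations on simple cubic graphs defined in the context, and a finite number of steps may be zero.
   Context: All graphs are non-empty, finite and simple. A graph is cubic if all its vertices have degree 3. $K_{r,s}$ is the complete bipartite graph with parts of sizes $r$ and $s$. The girth is the minimum length of a cycle. A path-decomposition of a graph $G$ is a sequence $V_1,\dots,V_{n'}$ of subsets (bags) of $V(G)$ such that every vertex lies in some bag, both ends of every edge lie together in some bag, and for each vertex $v$ the set $\{i : v\in V_i\}$ is an interval of consecutive integers. Its width is $\max_i |V_i|-1$; the path-width of $G$ is the minimum width of a path-decomposition of $G$. Construction steps. Each step is applied to a simple cubic graph $G'$ containing the indicated configuration of pairwise distinct named vertices and edges as a (not necessarily induced) subgraph, and yields a new cubic graph. $C_1$: Configuration: a $K_{2,3}$ with parts $\{u,v\}$ and $\{x_1,x_2,x_3\}$. Let $s_i$ be the third neighbour of $x_i$, lying outside this $K_{2,3}$ (the $s_i$ need not be distinct). Delete the edges $x_is_i$; add new vertices $y_1,y_2,y_3,z$ and the edges $x_iy_i,\ y_iz,\ y_is_i$ for $i=1,2,3$. $C_2$: Configuration: distinct vertices $u,v,x_1,y_1,y_2,y_3$ with each of $u,v$ adjacent to each of $x_1,y_2,y_3$, and $x_1y_1$ an edge.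 Delete the edges $uy_2,uy_3,vy_2,vy_3$; add new vertices $x_2,x_3$ and the edges $ux_2,vx_2,ux_3,vx_3,x_2y_2,x_3y_3,y_2y_3$. $C_3$: Configuration: a $K_{2,3}$ with parts $\{u,v\}$ and $\{x_1,x_2,x_3\}$, with $s_i$ the third neighbour of $x_i$, lying outside this $K_{2,3}$ (the $s_i$ need not be distinct). Delete the edges $x_is_i$; add new vertices $y_1,y_2,w_1,w_2,w_3,z$ and the edges $x_1y_1,\ x_2y_2,\ x_3y_2,\ y_1w_1,\ y_1w_2,\ y_2w_3,\ zw_1,\ zw_2,\ zw_3,\ w_1s_1,\ w_2s_2,\ w_3s_3$. $C_4$: Configuration: distinct vertices $u,v,x_1,w_1,w_2,w_3$ with each of $u,v$ adjacent to each of $x_1,w_2,w_3$, and $x_1w_1$ an edge. Delete the edges $x_1w_1,uw_2,uw_3,vw_2,vw_3$; add new vertices $x_2,x_3,y_1,y_2$ and the edges $ux_2,vx_2,ux_3,vx_3,\ x_2y_2,\ x_3y_2,\ x_1y_1,\ y_1w_1,\ y_1w_2,\ y_2w_3,\ w_2w_3$. $C_5$: Configuration: distinct vertices $u,v,x_1,x_2,x_3,y,s,t$ with each of $u,v$ adjacent to each of $x_1,x_2,x_3$, and edges $x_2y,\ x_3y,\ x_1s,\ yt$. Delete the edges $x_1s$ and $yt$; add new vertices $p,q$ and the edges $x_1p,\ ps,\ yq,\ qt,\ pq$. $C_6$: Configuration: the same as for $C_5$. Delete the edges $x_1s$ and $yt$; add new vertices $p,q$ and the edges $x_1p,\ yp,\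 pq,\ qs,\ qt$.
   Formalization: In part (ii) the graph is additionally assumed connected; without this the claim fails, since two disjoint copies of K_{3,3} form a cubic graph of path-width 3 and girth 4, while all construction steps preserve connectedness. -}

module Defs where

open import Data.Fin.Base using (Fin) renaming (_≤_ to _≤ᶠ_)
open import Data.Fin.Patterns using (0F; 1F; 2F; 3F; 4F; 5F)
open import Data.Fin.Subset using (Subset; ∣_∣; _∈_; _∉_)
open import Data.List.Base using (List; []; _∷_; _++_; _∷ʳ_; length)
import Data.List.Membership.Propositional as List
open import Data.List.Relation.Unary.All using (All)
open import Data.List.Relation.Unary.Linked using (Linked)
open import Data.List.Relation.Unary.Unique.Propositional using (Unique)
open import Data.Nat.Base using (ℕ; NonZero; _≤_; _<_; _⊔_; _∸_)
open import Data.Product.Base using (_×_; _,_; Σ-syntax; ∃-syntax; uncurry)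
open import Data.Sum.Base using (_⊎_; inj₁; inj₂)
open import Data.Vec.Base using (tabulate)
import Data.Vec.Functional as Vector
open import Function.Bundles using (_↔_; _⇔_; module Inverse)
open import Level using (0ℓ; suc)
open import Relation.Binary.Core using (Rel)
open import Relation.Binary.Construct.Closure.ReflexiveTransitive using (Star)
open import Relation.Binary.Construct.Union using (_∪_)
open import Relation.Binary.Definitions using (Decidable; Irreflexive; Symmetric)
open import Relation.Binary.PropositionalEquality.Core using (_≡_)
open import Relation.Nullary.Decidable.Core using (does)
open import Relation.Nullary.Negation.Core using (¬_)

record Graph : Set (suc 0ℓ) where
  field
    order     : ℕ
    .nonEmpty : NonZero order
    Adj       : Rel (Fin order) 0ℓ
    adj?      : Decidable Adj
    sym       : Symmetric Adj
    irrefl    : Irreflexive _≡_ Adj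

  Vertex : Set
  Vertex = Fin order

  neighbours : Vertex → Subset order
  neighbours x = tabulate λ y → does (adj? x y)

  degree : Vertex → ℕ
  degree x = ∣ neighbours x ∣

open Graph using (order; Adj; Vertex; degree)

Cubic : Graph → Set
Cubic G = ∀ x → degree G x ≡ 3

-- Walks in G that avoid X.
_∖_⊢_⇝_ : (G : Graph) → Subset (order G) → Rel (Vertex G) 0ℓ
G ∖ X ⊢ x ⇝ y = Star (λ a b → Adj G a b × a ∉ X × b ∉ X) x y

_-Connected : ℕ → Graph → Set
(k -Connected) G =
  k < order G ×
  (∀ X → ∣ X ∣ < k → ∀ x y → x ∉ X → y ∉ X → G ∖ X ⊢ x ⇝ y)

Connected : Graph → Set
Connected G = ∀ x y → Star (Adj G) x y

record Cycle (G : Graph) (ℓ : ℕ) : Set where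
  field
    start    : Vertex G
    rest     : List (Vertex G)
    distinct : Unique (start ∷ rest)
    closed   : Linked (Adj G) (start ∷ rest ∷ʳ start)
    length≡ℓ : length (start ∷ rest) ≡ ℓ
    3≤ℓ      : 3 ≤ ℓ

HasGirth : Graph → ℕ → Set
HasGirth G g = Cycle G g × (∀ ℓ → Cycle G ℓ → g ≤ ℓ)

record PathDecomposition (G : Graph) : Set where
  field
    #bags    : ℕ
    bag      : Fin #bags → Subset (order G)
    vertices : ∀ x → ∃[ i ] x ∈ bag i
    edges    : ∀ x y → Adj G x y → ∃[ i ] (x ∈ bag i × y ∈ bag i)
    interval : ∀ x i j k → i ≤ᶠ j → j ≤ᶠ k → x ∈ bag i → x ∈ bag k → x ∈ bag j

  -- Truncated subtraction is harmless: as G is non-empty, so is some bag.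
  width : ℕ
  width = Vector.foldr _⊔_ 0 (λ i → ∣ bag i ∣) ∸ 1

open PathDecomposition using (width)

HasPathWidth : Graph → ℕ → Set
HasPathWidth G w =
  (Σ[ P ∈ PathDecomposition G ] width P ≡ w) ×
  (∀ (P : PathDecomposition G) → w ≤ width P)

infix 4 _≅_
_≅_ : {A B : Set} → Rel A 0ℓ → Rel B 0ℓ → Set
_≅_ {A} {B} R S =
  Σ[ f ∈ A ↔ B ] (∀ x y → R x y ⇔ S (Inverse.to f x) (Inverse.to f y))

data K (r s : ℕ) : Rel (Fin r ⊎ Fin s) 0ℓ where
  left-right : ∀ {i j} → K r s (inj₁ i) (inj₂ j)
  right-left : ∀ {i j} → K r s (inj₂ j) (inj₁ i)

Edge : Set → Set
Edge A = A × A

infix 6 _—_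
pattern _—_ x y = x , y

Joins : {A : Set} → List (Edge A) → Rel A 0ℓ
Joins es x y = (x — y) List.∈ es ⊎ (y — x) List.∈ es

Edges : (G : Graph) → List (Edge (Vertex G)) → Set
Edges G = All (uncurry (Adj G))

pattern old x = inj₁ x
pattern new i = inj₂ i

-- The adjacency obtained from G by deleting the edges in del, adding n new
-- vertices and adding the edges in add.
module _ (G : Graph) (n : ℕ)
         (del : List (Edge (Vertex G))) (add : List (Edge (Vertex G ⊎ Fin n)))
         where

  data Kept : Rel (Vertex G ⊎ Fin n) 0ℓ where
    kept : ∀ {x y} → Adj G x y → ¬ Joins del x y → Kept (old x) (old y)

  Rewired : Rel (Vertex G ⊎ Fin n) 0ℓ
  Rewired = Kept ∪ Joins add

-- Cubicity of H excludes rewirings in which an added edge duplicates an edge of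
-- G, as y₂ — y₃ in C₂ or w₂ — w₃ in C₄ might: H being simple, the ends of the
-- duplicated edge would have degree 2.
record Replace (G : Graph) (n : ℕ) (del : List (Edge (Vertex G)))
               (add : List (Edge (Vertex G ⊎ Fin n))) (H : Graph) : Set where
  field
    cubic-before : Cubic G
    cubic-after  : Cubic H
    result       : Rewired G n del add ≅ Adj H

k₂,₃ : {A : Set} → A → A → A → A → A → List (Edge A)
k₂,₃ u v x₁ x₂ x₃ =
  u — x₁ ∷ u — x₂ ∷ u — x₃ ∷ v — x₁ ∷ v — x₂ ∷ v — x₃ ∷ []

record Config₁₃ (G : Graph) (u v x₁ x₂ x₃ s₁ s₂ s₃ : Vertex G) : Set where
  field
    distinct : Unique (u ∷ v ∷ x₁ ∷ x₂ ∷ x₃ ∷ [])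
    edges    : Edges G (k₂,₃ u v x₁ x₂ x₃ ++ x₁ — s₁ ∷ x₂ — s₂ ∷ x₃ — s₃ ∷ [])
    outside  : All (List._∉ (u ∷ v ∷ x₁ ∷ x₂ ∷ x₃ ∷ [])) (s₁ ∷ s₂ ∷ s₃ ∷ [])

record Config₂₄ (G : Graph) (u v a b₁ b₂ b₃ : Vertex G) : Set where
  field
    distinct : Unique (u ∷ v ∷ a ∷ b₁ ∷ b₂ ∷ b₃ ∷ [])
    edges    : Edges G (k₂,₃ u v a b₂ b₃ ++ a — b₁ ∷ [])

record Config₅₆ (G : Graph) (u v x₁ x₂ x₃ y s t : Vertex G) : Set where
  field
    distinct : Unique (u ∷ v ∷ x₁ ∷ x₂ ∷ x₃ ∷ y ∷ s ∷ t ∷ [])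
    edges    : Edges G (k₂,₃ u v x₁ x₂ x₃ ++ x₂ — y ∷ x₃ — y ∷ x₁ — s ∷ y — t ∷ [])

data C₁ (G H : Graph) : Set where
  step : ∀ u v x₁ x₂ x₃ s₁ s₂ s₃ → Config₁₃ G u v x₁ x₂ x₃ s₁ s₂ s₃ →
    (let y₁ = new 0F ; y₂ = new 1F ; y₃ = new 2F ; z = new 3F) →
    Replace G 4
      (x₁ — s₁ ∷ x₂ — s₂ ∷ x₃ — s₃ ∷ [])
      ( old x₁ — y₁ ∷ old x₂ — y₂ ∷ old x₃ — y₃
      ∷ y₁ — z ∷ y₂ — z ∷ y₃ — z
      ∷ y₁ — old s₁ ∷ y₂ — old s₂ ∷ y₃ — old s₃ ∷ [])
      H →
    C₁ G H

data C₂ (G H : Graph) : Set where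
  step : ∀ u v x₁ y₁ y₂ y₃ → Config₂₄ G u v x₁ y₁ y₂ y₃ →
    (let x₂ = new 0F ; x₃ = new 1F) →
    Replace G 2
      (u — y₂ ∷ u — y₃ ∷ v — y₂ ∷ v — y₃ ∷ [])
      ( old u — x₂ ∷ old v — x₂ ∷ old u — x₃ ∷ old v — x₃
      ∷ x₂ — old y₂ ∷ x₃ — old y₃ ∷ old y₂ — old y₃ ∷ [])
      H →
    C₂ G H

data C₃ (G H : Graph) : Set where
  step : ∀ u v x₁ x₂ x₃ s₁ s₂ s₃ → Config₁₃ G u v x₁ x₂ x₃ s₁ s₂ s₃ →
    (let y₁ = new 0F ; y₂ = new 1F
         w₁ = new 2F ; w₂ = new 3F ; w₃ = new 4F ; z = new 5F) →
    Replace G 6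
      (x₁ — s₁ ∷ x₂ — s₂ ∷ x₃ — s₃ ∷ [])
      ( old x₁ — y₁ ∷ old x₂ — y₂ ∷ old x₃ — y₂
      ∷ y₁ — w₁ ∷ y₁ — w₂ ∷ y₂ — w₃
      ∷ z — w₁ ∷ z — w₂ ∷ z — w₃
      ∷ w₁ — old s₁ ∷ w₂ — old s₂ ∷ w₃ — old s₃ ∷ [])
      H →
    C₃ G H

data C₄ (G H : Graph) : Set where
  step : ∀ u v x₁ w₁ w₂ w₃ → Config₂₄ G u v x₁ w₁ w₂ w₃ →
    (let x₂ = new 0F ; x₃ = new 1F ; y₁ = new 2F ; y₂ = new 3F) →
    Replace G 4
      (x₁ — w₁ ∷ u — w₂ ∷ u — w₃ ∷ v — w₂ ∷ v — w₃ ∷ [])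
      ( old u — x₂ ∷ old v — x₂ ∷ old u — x₃ ∷ old v — x₃
      ∷ x₂ — y₂ ∷ x₃ — y₂ ∷ old x₁ — y₁
      ∷ y₁ — old w₁ ∷ y₁ — old w₂ ∷ y₂ — old w₃ ∷ old w₂ — old w₃ ∷ [])
      H →
    C₄ G H

data C₅ (G H : Graph) : Set where
  step : ∀ u v x₁ x₂ x₃ y s t → Config₅₆ G u v x₁ x₂ x₃ y s t →
    (let p = new 0F ; q = new 1F) →
    Replace G 2
      (x₁ — s ∷ y — t ∷ [])
      (old x₁ — p ∷ p — old s ∷ old y — q ∷ q — old t ∷ p — q ∷ [])
      H →
    C₅ G H

data C₆ (G H : Graph) : Set where
  step : ∀ u v x₁ x₂ x₃ y s t → Config₅₆ G u v x₁ x₂ x₃ y s t →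
    (let p = new 0F ; q = new 1F) →
    Replace G 2
      (x₁ — s ∷ y — t ∷ [])
      (old x₁ — p ∷ old y — p ∷ p — q ∷ q — old s ∷ q — old t ∷ [])
      H →
    C₆ G H

ConstructibleFromK₃,₃By : Rel Graph 0ℓ → Graph → Set (suc 0ℓ)
ConstructibleFromK₃,₃By Step G = ∃[ G₀ ] (K 3 3 ≅ Adj G₀ × Star Step G₀ G)

{-# OPTIONS --safe #-}
module Submission where

-- Visit the vertices of G in the order in which they first occur in the bags.
-- At every moment the boundary, the set of visited vertices with an unvisited
-- neighbour, has at most three elements, and visits can be postponed until they
-- are attached to a visited vertex.  In a triangle-free cubic graph this forces
-- the first five vertices to span a K₂,₃, with three edges xᵢ — sᵢ leaving it.
--
-- In general let U be the set of unvisited vertices.  If three edges pᵢ — sᵢ with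
-- distinct pᵢ enter U, replace everything outside U by a K₂,₃ with xᵢ joined to
-- sᵢ; if only two edges p — s and p′ — t enter U, replace it by K₃,₃ minus an
-- edge.  The bound on the boundary dictates the next few visits so strictly that
-- the graph so obtained from U arises by one step from the one obtained after
-- these visits.  With three edges: if s₁ = s₂ = s₃ it is K₃,₃; if the sᵢ are
-- distinct, C₂ or C₁ applies according to whether two of them are adjacent; if
-- s₂ = s₃ ≠ s₁, then visiting s₂ leaves two edges, and p₁, s₂ separate G, which
-- 3-connectedness forbids.  With two edges: C₆ if s = t, C₅ if s, t are adjacent,
-- C₄ if they have a common neighbour, C₃ otherwise.  All these graphs are glued
-- from pieces of the fixed graph G, so that neither the order of visits nor
-- 3-connectedness has to be transferred from one to the next.

open import Data.Empty using (⊥; ⊥-elim)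
open import Data.Fin.Base as Fin using (Fin; zero; suc; toℕ; join; splitAt; _↑ˡ_; _↑ʳ_)
open import Data.Fin.Patterns
open import Data.Fin.Properties
  using (_≟_; all?; any?; splitAt-↑ˡ; splitAt-↑ʳ; splitAt-join; join-splitAt)
open import Data.Fin.Subset as Subset
  using (Subset; inside; outside; ∣_∣; _∈_; _∉_; _-_; ⁅_⁆; ⊤) renaming (_∪_ to _∪ˢ_)
open import Data.Fin.Subset.Properties
  using ( _∈?_; nonempty?; p─⊥≡p; p─q⊆p; p─x─y≡p─y─x; x∈p∧x≢y⇒x∈p-y; Empty-unique
        ; ∈⊤; ∉⊥; ∣⊤∣≡n; ∣⊥∣≡0; x∈p∪q⁺; x∈p∪q⁻; x∈⁅x⁆; x∈⁅y⁆⇒x≡y )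
open import Data.List.Base as List using (List; []; _∷_; _++_; length; filter; foldl)
import Data.List.Membership.DecPropositional as DecMembership
import Data.List.Membership.Propositional as L
open import Data.List.Membership.Propositional.Properties
  using ( ∈-map⁺; ∈-map⁻; ∈-++⁺ˡ; ∈-++⁺ʳ; ∈-++⁻; ∈-tabulate⁺; ∈-tabulate⁻; ∈-filter⁺; ∈-filter⁻ )
open import Data.List.Relation.Unary.All as All using (All; []; _∷_)
import Data.List.Relation.Unary.All.Properties as All
open import Data.List.Relation.Unary.AllPairs as AllPairs using (AllPairs; []; _∷_; allPairs?)
import Data.List.Relation.Unary.AllPairs.Properties as AllPairs
open import Data.List.Relation.Unary.Any as Any using (here; there)
open import Data.List.Relation.Unary.Linked using ([-]; _∷_)
open import Data.List.Relation.Unary.Unique.Propositional using (Unique)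
open import Data.Nat.Base using (ℕ; zero; suc; pred; _+_; _∸_; _≤_; _<_; _⊔_; z≤n; s≤s)
open import Data.Nat.Properties
  using (≤-refl; ≤-reflexive; ≤-trans; ≤-total; <-trans; <⇒≤; n≤1+n; m<n⇒m<1+n; m≤m⊔n; m≤n⊔m)
open import Data.Product.Base as Product using (_×_; _,_; proj₁; proj₂; ∃-syntax; uncurry)
open import Data.Product.Properties using () renaming (≡-dec to ×-≡-dec)
open import Data.Sum.Base as Sum using (_⊎_; inj₁; inj₂; [_,_]′)
open import Data.Sum.Properties using (inj₁-injective; inj₂-injective) renaming (≡-dec to ⊎-≡-dec)
open import Data.Vec.Base using (Vec; []; _∷_; here; there; lookup; tabulate)
import Data.Vec.Functional as Vector
open import Data.Vec.Properties using ([]=⇒lookup; lookup⇒[]=; lookup∘tabulate)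
open import Function.Base using (_∘_; id; case_of_)
open import Function.Bundles using (_↔_; mk↔ₛ′; mk⇔)
open import Level using (0ℓ)
open import Relation.Binary.Core using (Rel)
open import Relation.Binary.Construct.Closure.ReflexiveTransitive as Star using (Star; ε; _◅_; _◅◅_)
open import Relation.Binary.Construct.Union using (_∪_)
open import Relation.Binary.Definitions using (DecidableEquality; Decidable; Symmetric)
open import Relation.Binary.PropositionalEquality hiding ([_])
open import Relation.Nullary using (¬_; Dec; yes; no; does; contradiction)
open import Relation.Nullary.Decidable
  using (_×-dec_; _⊎-dec_; _→-dec_; ¬?; True; toWitness; dec-true; decidable-stable)
open import Relation.Unary using () renaming (Decidable to Decidable₁)
open import Defs

-- An induction on the constructed graphs themselves would need an order of visits for each smaller
-- graph. With G fixed, each smaller graph is instead a new object whose isomorphisms have to be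
-- supplied. Two devices keep this manageable. Blobs, steps and their outcomes are edge lists over
-- finitely many symbols, so whatever does not depend on G is decided by evaluation. And the result
-- `H` of a step is known to be cubic: once three different expected neighbours of a vertex are
-- present there is no room for another, so the absence of edges around a blob is never verified.
--
-- The blob for two edges is K₃,₃ minus an edge because a vertex joined to two of the xᵢ completes
-- K₂,₃ to exactly this graph; passing from three edges to two therefore changes no graph at all. C₅
-- and C₆ keep two edges, whereas C₃ and C₄ lead back to three, so part (ii) is one joint induction
-- on the number of unvisited vertices.

private variable
  n : ℕ
  A B C X Y : Set

pattern at₁ e = Any.there (Any.here e)
pattern at₂ e = Any.there (at₁ e)
pattern at₃ e = Any.there (at₂ e)
pattern at₄ e = Any.there (at₃ e)


-- Finite subsets, and vertices with exactly three neighbours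

x∉p-x : ∀ {p : Subset n} {x} → x ∉ p - x
x∉p-x {p = _ ∷ _} {zero} ()
x∉p-x {p = _ ∷ _} {suc x} (there x∈) = x∉p-x x∈

∈-remove⁻ : ∀ {p : Subset n} {x y} → x ∈ p - y → x ∈ p × x ≢ y
∈-remove⁻ {p = p} x∈ = p─q⊆p p _ x∈ , λ { refl → x∉p-x {p = p} x∈ }

∉-remove⁻ : ∀ {p : Subset n} {x y} → x ∉ p - y → x ∉ p ⊎ x ≡ y
∉-remove⁻ {x = x} {y} x∉ with x ≟ y
... | yes x≡y = inj₂ x≡y
... | no  x≢y = inj₁ λ x∈p → x∉ (x∈p∧x≢y⇒x∈p-y x∈p x≢y)

∉⇒∉- : ∀ {p : Subset n} {x y} → x ∉ p → x ∉ p - y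
∉⇒∉- x∉ = x∉ ∘ proj₁ ∘ ∈-remove⁻

∣p∣≡1+∣p-x∣ : ∀ {p : Subset n} {x} → x ∈ p → ∣ p ∣ ≡ suc ∣ p - x ∣
∣p∣≡1+∣p-x∣ {p = inside ∷ p} here = cong (suc ∘ ∣_∣) (sym (p─⊥≡p p))
∣p∣≡1+∣p-x∣ {p = inside ∷ p} (there x∈) = cong suc (∣p∣≡1+∣p-x∣ x∈)
∣p∣≡1+∣p-x∣ {p = outside ∷ p} (there x∈) = ∣p∣≡1+∣p-x∣ x∈

∣p∣≡0⇒x∉p : ∀ {p : Subset n} {x} → ∣ p ∣ ≡ 0 → x ∉ p
∣p∣≡0⇒x∉p eq x∈ with () ← trans (sym eq) (∣p∣≡1+∣p-x∣ x∈)

empty⇒∣p∣≡0 : ∀ {p : Subset n} → (∀ x → x ∉ p) → ∣ p ∣ ≡ 0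
empty⇒∣p∣≡0 {n} h = trans (cong ∣_∣ (Empty-unique λ (x , x∈) → h x x∈)) (∣⊥∣≡0 n)

∣p∣≡1+k⇒∃ : ∀ {p : Subset n} {k} → ∣ p ∣ ≡ suc k → ∃[ x ] (x ∈ p × ∣ p - x ∣ ≡ k)
∣p∣≡1+k⇒∃ {p = p} eq with nonempty? p
... | yes (x , x∈) with refl ← trans (sym (∣p∣≡1+∣p-x∣ x∈)) eq = x , x∈ , refl
... | no ¬ne with () ← trans (sym eq) (empty⇒∣p∣≡0 λ x x∈ → ¬ne (x , x∈))

-- The order of the three is immaterial: the lemmas below bring known elements to the front and
-- supply names for the unknown rest.
record IsTriple (P : A → Set) (a b c : A) : Set where
  constructor triple
  field
    a≢b  : a ≢ b
    a≢c  : a ≢ c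
    b≢c  : b ≢ c
    Pa   : P a
    Pb   : P b
    Pc   : P c
    only : ∀ {y} → P y → y ≡ a ⊎ y ≡ b ⊎ y ≡ c

module _ {P : A → Set} where
  open IsTriple

  rotate : ∀ {a b c} → IsTriple P a b c → IsTriple P b c a
  rotate t = triple (b≢c t) (a≢b t ∘ sym) (a≢c t ∘ sym) (Pb t) (Pc t) (Pa t) λ Py →
    [ inj₂ ∘ inj₂ , [ inj₁ , inj₂ ∘ inj₁ ]′ ]′ (only t Py)

  swap₂₃ : ∀ {a b c} → IsTriple P a b c → IsTriple P a c b
  swap₂₃ t = triple (a≢c t) (a≢b t) (b≢c t ∘ sym) (Pa t) (Pc t) (Pb t) λ Py →
    [ inj₁ , [ inj₂ ∘ inj₂ , inj₂ ∘ inj₁ ]′ ]′ (only t Py)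

  with-first : ∀ {a b c x} → IsTriple P a b c → P x → ∃[ y ] ∃[ z ] IsTriple P x y z
  with-first t Px with only t Px
  ... | inj₁ refl        = _ , _ , t
  ... | inj₂ (inj₁ refl) = _ , _ , rotate t
  ... | inj₂ (inj₂ refl) = _ , _ , rotate (rotate t)

  with-second : ∀ {a b c y} → IsTriple P a b c → P y → y ≢ a → ∃[ z ] IsTriple P a y z
  with-second t Py y≢a with only t Py
  ... | inj₁ y≡a         = contradiction y≡a y≢a
  ... | inj₂ (inj₁ refl) = _ , t
  ... | inj₂ (inj₂ refl) = _ , swap₂₃ t

  with-third : ∀ {a b c z} → IsTriple P a b c → P z → z ≢ a → z ≢ b → z ≡ c
  with-third t Pz z≢a z≢b with only t Pz
  ... | inj₁ z≡a        = contradiction z≡a z≢a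
  ... | inj₂ (inj₁ z≡b) = contradiction z≡b z≢b
  ... | inj₂ (inj₂ z≡c) = z≡c

module _ (G : Graph) where
  open Graph G hiding (sym)

  ∈-neighbours⁻ : ∀ {x y} → y ∈ neighbours x → Adj x y
  ∈-neighbours⁻ {x} {y} y∈ with adj? x y in eq
  ... | yes xy = xy
  ... | no  _  with () ← trans (sym (trans (lookup∘tabulate _ y) (cong does eq))) ([]=⇒lookup y∈)

  ∈-neighbours⁺ : ∀ {x y} → Adj x y → y ∈ neighbours x
  ∈-neighbours⁺ {x} {y} xy = lookup⇒[]= y _ (trans (lookup∘tabulate _ y) (dec-true (adj? x y) xy))

  abstract
    degree-triple : ∀ {x} → degree x ≡ 3 → ∃[ a ] ∃[ b ] ∃[ c ] IsTriple (Adj x) a b c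
    degree-triple {x} d
      with a , a∈ , d₁ ← ∣p∣≡1+k⇒∃ d
      with b , b∈ , d₂ ← ∣p∣≡1+k⇒∃ d₁
      with c , c∈ , d₃ ← ∣p∣≡1+k⇒∃ d₂
      with b∈′ , b≢a ← ∈-remove⁻ b∈
      with c∈″ , c≢b ← ∈-remove⁻ c∈
      with c∈′ , c≢a ← ∈-remove⁻ c∈″
      = a , b , c ,
        triple (b≢a ∘ sym) (c≢a ∘ sym) (c≢b ∘ sym)
          (∈-neighbours⁻ a∈) (∈-neighbours⁻ b∈′) (∈-neighbours⁻ c∈′)
          (λ xy → only (∈-neighbours⁺ xy))
      where
      only : ∀ {y} → y ∈ neighbours x → y ≡ a ⊎ y ≡ b ⊎ y ≡ c
      only {y} y∈ with y ≟ a | y ≟ b | y ≟ c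
      ... | yes y≡a | _ | _ = inj₁ y≡a
      ... | no _ | yes y≡b | _ = inj₂ (inj₁ y≡b)
      ... | no _ | no _ | yes y≡c = inj₂ (inj₂ y≡c)
      ... | no y≢a | no y≢b | no y≢c = contradiction
        (x∈p∧x≢y⇒x∈p-y (x∈p∧x≢y⇒x∈p-y (x∈p∧x≢y⇒x∈p-y y∈ y≢a) y≢b) y≢c)
        (∣p∣≡0⇒x∉p d₃)

  triple-degree : ∀ {x a b c} → IsTriple (Adj x) a b c → degree x ≡ 3
  triple-degree {x} {a} {b} {c} t = begin
    ∣ N ∣                 ≡⟨ ∣p∣≡1+∣p-x∣ (∈-neighbours⁺ Pa) ⟩
    suc ∣ N - a ∣         ≡⟨ cong suc (∣p∣≡1+∣p-x∣ b∈) ⟩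
    2 + ∣ N - a - b ∣      ≡⟨ cong (2 +_) (∣p∣≡1+∣p-x∣ c∈) ⟩
    3 + ∣ N - a - b - c ∣  ≡⟨ cong (3 +_) (empty⇒∣p∣≡0 none) ⟩
    3                     ∎
    where
    open ≡-Reasoning
    open IsTriple t
    N = neighbours x
    b∈ : b ∈ N - a
    b∈ = x∈p∧x≢y⇒x∈p-y (∈-neighbours⁺ Pb) (a≢b ∘ sym)
    c∈ : c ∈ N - a - b
    c∈ = x∈p∧x≢y⇒x∈p-y (x∈p∧x≢y⇒x∈p-y (∈-neighbours⁺ Pc) (a≢c ∘ sym)) (b≢c ∘ sym)
    none : ∀ y → y ∉ N - a - b - c
    none y y∈ with y∈₁ , y≢c ← ∈-remove⁻ y∈ with y∈₂ , y≢b ← ∈-remove⁻ y∈₁ with y∈₃ , y≢a ← ∈-remove⁻ y∈₂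
      = y≢c (with-third t (∈-neighbours⁻ y∈₃) y≢a y≢b)

open Graph using (Adj; degree)

-- Vertex sets split into a labelled part and a tail

-- Writes X as the disjoint union of B and U; the values of ψ outside U are junk.
record Cover (X B : Set) {n} (U : Subset n) : Set where
  field
    φ        : B → X
    ψ        : Fin n → X
    φ-inj    : ∀ {b b′} → φ b ≡ φ b′ → b ≡ b′
    ψ-inj    : ∀ {r r′} → r ∈ U → r′ ∈ U → ψ r ≡ ψ r′ → r ≡ r′
    disjoint : ∀ {b r} → r ∈ U → φ b ≢ ψ r
    cover    : ∀ x → (∃[ b ] φ b ≡ x) ⊎ (∃[ r ] (r ∈ U × ψ r ≡ x))

module _ {U : Subset n} where
  open Cover

  match : Cover X B U → Cover Y B U → X → Y
  match c d x = [ (λ (b , _) → φ d b) , (λ (r , _) → ψ d r) ]′ (cover c x)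

  match-φ : (c : Cover X B U) (d : Cover Y B U) → ∀ b → match c d (φ c b) ≡ φ d b
  match-φ c d b with cover c (φ c b)
  ... | inj₁ (b′ , eq)      = cong (φ d) (φ-inj c eq)
  ... | inj₂ (r , r∈ , eq) = contradiction (sym eq) (disjoint c r∈)

  match-ψ : (c : Cover X B U) (d : Cover Y B U) → ∀ {r} → r ∈ U → match c d (ψ c r) ≡ ψ d r
  match-ψ c d {r} r∈ with cover c (ψ c r)
  ... | inj₁ (b′ , eq)       = contradiction eq (disjoint c r∈)
  ... | inj₂ (r′ , r′∈ , eq) = cong (ψ d) (ψ-inj c r′∈ r∈ eq)

  match-match : (c : Cover X B U) (d : Cover Y B U) → ∀ x → match d c (match c d x) ≡ x
  match-match c d x with cover c x
  ... | inj₁ (b , eq)      = trans (match-φ d c b) eq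
  ... | inj₂ (r , r∈ , eq) = trans (match-ψ d c r∈) eq

  -- Source of the vertex bijections behind every isomorphism: two vertex sets that split into the
  -- same `B` and `U` are matched piece by piece.
  match-↔ : Cover X B U → Cover Y B U → X ↔ Y
  match-↔ c d = mk↔ₛ′ (match c d) (match d c) (match-match d c) (match-match c d)

  relabel : (π : C → B) → (∀ {x y} → π x ≡ π y → x ≡ y) → (∀ b → ∃[ x ] π x ≡ b) →
            Cover X B U → Cover X C U
  relabel π π-inj π-surj c = record
    { φ        = φ c ∘ π
    ; ψ        = ψ c
    ; φ-inj    = π-inj ∘ φ-inj c
    ; ψ-inj    = ψ-inj c
    ; disjoint = disjoint c
    ; cover    = λ x → Sum.map₁ (λ (b , eq) → let y , πy≡b = π-surj b in y , trans (cong (φ c) πy≡b) eq)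
                         (cover c x)
    }

  permute : ∀ {k} (π π⁻¹ : Vec (Fin k) k) → (∀ i → lookup π⁻¹ (lookup π i) ≡ i) →
            (∀ i → lookup π (lookup π⁻¹ i) ≡ i) → Cover X (Fin k) U → Cover X (Fin k) U
  permute π π⁻¹ left right = relabel (lookup π)
    (λ {x} {y} eq → trans (sym (left x)) (trans (cong (lookup π⁻¹) eq) (left y)))
    (λ i → lookup π⁻¹ i , right i)

  transpose : ∀ {k} (π : Vec (Fin k) k) → (∀ i → lookup π (lookup π i) ≡ i) →
              Cover X (Fin k) U → Cover X (Fin k) U
  transpose π involutive = permute π π involutive involutive

  adjoin : Cover X B U → Cover (X ⊎ C) (B ⊎ C) U
  adjoin c .φ = Sum.map₁ (φ c)
  adjoin c .ψ = inj₁ ∘ ψ c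
  adjoin c .φ-inj {inj₁ b} {inj₁ b′} eq = cong inj₁ (φ-inj c (inj₁-injective eq))
  adjoin c .φ-inj {inj₂ i} {inj₂ .i} refl = refl
  adjoin c .ψ-inj r∈ r′∈ eq = ψ-inj c r∈ r′∈ (inj₁-injective eq)
  adjoin c .disjoint {inj₁ b} r∈ eq = disjoint c r∈ (inj₁-injective eq)
  adjoin c .cover (inj₁ x) = Sum.map (λ (b , eq) → inj₁ b , cong inj₁ eq)
                                     (λ (r , r∈ , eq) → r , r∈ , cong inj₁ eq) (cover c x)
  adjoin c .cover (inj₂ i) = inj₁ (inj₂ i , refl)

  -- A visit moves `v` from the tail to the labelled part while the vertex set stays fixed, so that
  -- one graph can be read over ever smaller `U`. The newest vertex gets the label 0.
  absorb : ∀ {k v} → v ∈ U → Cover X (Fin k) U → Cover X (Fin (suc k)) (U - v)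
  absorb {v = v} v∈ c .φ zero = ψ c v
  absorb v∈ c .φ (suc b) = φ c b
  absorb v∈ c .ψ = ψ c
  absorb v∈ c .φ-inj {zero} {zero} eq = refl
  absorb v∈ c .φ-inj {zero} {suc b} eq = contradiction (sym eq) (disjoint c v∈)
  absorb v∈ c .φ-inj {suc b} {zero} eq = contradiction eq (disjoint c v∈)
  absorb v∈ c .φ-inj {suc b} {suc b′} eq = cong suc (φ-inj c eq)
  absorb v∈ c .ψ-inj r∈ r′∈ = ψ-inj c (proj₁ (∈-remove⁻ r∈)) (proj₁ (∈-remove⁻ r′∈))
  absorb v∈ c .disjoint {zero} r∈ eq with r∈′ , r≢v ← ∈-remove⁻ r∈ = r≢v (sym (ψ-inj c v∈ r∈′ eq))
  absorb v∈ c .disjoint {suc b} r∈ = disjoint c (proj₁ (∈-remove⁻ r∈))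
  absorb {v = v} v∈ c .cover x with cover c x
  ... | inj₁ (b , eq) = inj₁ (suc b , eq)
  ... | inj₂ (r , r∈ , eq) with r ≟ v
  ...   | yes refl = inj₁ (zero , eq)
  ...   | no  r≢v  = inj₂ (r , x∈p∧x≢y⇒x∈p-y r∈ r≢v , eq)

-- Edge lists over symbols

map-edges : (A → B) → List (Edge A) → List (Edge B)
map-edges f = List.map (Product.map f f)

Joins-map⁺ : ∀ (f : A → B) {es x y} → Joins es x y → Joins (map-edges f es) (f x) (f y)
Joins-map⁺ f = Sum.map (∈-map⁺ _) (∈-map⁺ _)

Joins-map⁻ : ∀ (f : A → B) {es x y} → Joins (map-edges f es) x y →
             ∃[ a ] ∃[ b ] (Joins es a b × f a ≡ x × f b ≡ y)
Joins-map⁻ f (inj₁ e∈) with _ , e∈′ , refl ← ∈-map⁻ _ e∈ = _ , _ , inj₁ e∈′ , refl , refl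
Joins-map⁻ f (inj₂ e∈) with _ , e∈′ , refl ← ∈-map⁻ _ e∈ = _ , _ , inj₂ e∈′ , refl , refl

Joins-All : ∀ {R : A → A → Set} {es} → Symmetric R → All (uncurry R) es →
            ∀ {x y} → Joins es x y → R x y
Joins-All R-sym all (inj₁ e∈) = All.lookup all e∈
Joins-All R-sym all (inj₂ e∈) = R-sym (All.lookup all e∈)

module _ (_≟A_ : DecidableEquality A) where
  open DecMembership (×-≡-dec _≟A_ _≟A_) using () renaming (_∈?_ to _∈ᴸ?_)

  joins? : ∀ es → Decidable (Joins {A} es)
  joins? es x y = ((x — y) ∈ᴸ? es) ⊎-dec ((y — x) ∈ᴸ? es)

  partners : A → List (Edge A) → List A
  partners a [] = []
  partners a ((x — y) ∷ es) with x ≟A a | y ≟A a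
  ... | yes _ | _     = y ∷ partners a es
  ... | no  _ | yes _ = x ∷ partners a es
  ... | no  _ | no  _ = partners a es

  partners⁻ : ∀ {a z} es → z L.∈ partners a es → Joins es a z
  partners⁻ {a} ((x — y) ∷ es) z∈ with x ≟A a | y ≟A a
  partners⁻ ((x — y) ∷ es) (here refl) | yes refl | _ = inj₁ (here refl)
  partners⁻ ((x — y) ∷ es) (there z∈) | yes refl | _ = Sum.map there there (partners⁻ es z∈)
  partners⁻ ((x — y) ∷ es) (here refl) | no _ | yes refl = inj₂ (here refl)
  partners⁻ ((x — y) ∷ es) (there z∈) | no _ | yes refl = Sum.map there there (partners⁻ es z∈)
  partners⁻ ((x — y) ∷ es) z∈ | no _ | no _ = Sum.map there there (partners⁻ es z∈)

  partners⁺ : ∀ {a z} es → Joins es a z → z L.∈ partners a es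
  partners⁺ [] (inj₁ ())
  partners⁺ [] (inj₂ ())
  partners⁺ {a} ((x — y) ∷ es) j with x ≟A a | y ≟A a
  partners⁺ ((x — y) ∷ es) (inj₁ (here refl)) | yes refl | _ = here refl
  partners⁺ ((x — y) ∷ es) (inj₂ (here refl)) | yes refl | _ = here refl
  partners⁺ ((x — y) ∷ es) (inj₁ (there j)) | yes refl | _ = there (partners⁺ es (inj₁ j))
  partners⁺ ((x — y) ∷ es) (inj₂ (there j)) | yes refl | _ = there (partners⁺ es (inj₂ j))
  partners⁺ ((x — y) ∷ es) (inj₁ (here refl)) | no x≢a | _ = contradiction refl x≢a
  partners⁺ ((x — y) ∷ es) (inj₂ (here refl)) | no x≢a | yes refl = here refl
  partners⁺ ((x — y) ∷ es) (inj₂ (here refl)) | no x≢a | no y≢a = contradiction refl y≢a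
  partners⁺ ((x — y) ∷ es) (inj₁ (there j)) | no _ | yes refl = there (partners⁺ es (inj₁ j))
  partners⁺ ((x — y) ∷ es) (inj₂ (there j)) | no _ | yes refl = there (partners⁺ es (inj₂ j))
  partners⁺ ((x — y) ∷ es) (inj₁ (there j)) | no _ | no _ = partners⁺ es (inj₁ j)
  partners⁺ ((x — y) ∷ es) (inj₂ (there j)) | no _ | no _ = partners⁺ es (inj₂ j)

-- In the uses on symbols `f` sends each symbol to its key. Equal interpretations force equal keys,
-- so three different keys are three different vertices under every admissible interpretation.
data Distinct₃ (f : A → B) : List A → Set where
  distinct₃ : ∀ {a b c} → f a ≢ f b → f a ≢ f c → f b ≢ f c → Distinct₃ f (a ∷ b ∷ c ∷ [])

distinct₃? : DecidableEquality B → (f : A → B) → ∀ xs → Dec (Distinct₃ f xs)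
distinct₃? _≟B_ f [] = no λ ()
distinct₃? _≟B_ f (_ ∷ []) = no λ ()
distinct₃? _≟B_ f (_ ∷ _ ∷ []) = no λ ()
distinct₃? _≟B_ f (_ ∷ _ ∷ _ ∷ _ ∷ _) = no λ ()
distinct₃? _≟B_ f (a ∷ b ∷ c ∷ [])
  with ¬? (f a ≟B f b) ×-dec ¬? (f a ≟B f c) ×-dec ¬? (f b ≟B f c)
... | yes (p , q , r) = yes (distinct₃ p q r)
... | no ¬pqr = no λ { (distinct₃ p q r) → ¬pqr (p , q , r) }

Distinct₃-coarsen : ∀ {f : A → B} {g : A → X} → (∀ {a b} → g a ≡ g b → f a ≡ f b) →
                    ∀ {xs} → Distinct₃ f xs → Distinct₃ g xs
Distinct₃-coarsen h (distinct₃ p q r) = distinct₃ (p ∘ h) (q ∘ h) (r ∘ h)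

Distinct₃⇒triple : ∀ {P : X → Set} {f : A → X} {xs} → Distinct₃ f xs →
  (∀ {a} → a L.∈ xs → P (f a)) → (∀ {y} → P y → ∃[ a ] (a L.∈ xs × f a ≡ y)) →
  ∃[ x ] ∃[ y ] ∃[ z ] IsTriple P x y z
Distinct₃⇒triple (distinct₃ p q r) h only = _ , _ , _ ,
  triple p q r (h (here refl)) (h (at₁ refl)) (h (at₂ refl)) λ Py →
    case-∈ (only Py)
  where
  case-∈ : ∀ {f : _ → _} {a b c y} → ∃[ d ] (d L.∈ (a ∷ b ∷ c ∷ []) × f d ≡ y) → y ≡ f a ⊎ y ≡ f b ⊎ y ≡ f c
  case-∈ (_ , here refl , refl) = inj₁ refl
  case-∈ (_ , at₁ refl , refl) = inj₂ (inj₁ refl)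
  case-∈ (_ , at₂ refl , refl) = inj₂ (inj₂ refl)

abstract
  -- Three different elements of a three-element set exhaust it. This is how cubicity excludes
  -- unexpected edges.
  triple-exhausted : ∀ {P : X → Set} {a b c} {f : A → X} {xs} → IsTriple P a b c → Distinct₃ f xs →
    (∀ {a} → a L.∈ xs → P (f a)) → ∀ {y} → P y → ∃[ a ] (a L.∈ xs × f a ≡ y)
  triple-exhausted t (distinct₃ p q r) h Py
    with _ , _ , t₁ ← with-first t (h (here refl))
    with _ , t₂ ← with-second t₁ (h (at₁ refl)) (p ∘ sym)
    with refl ← with-third t₂ (h (at₂ refl)) (q ∘ sym) (r ∘ sym)
    with IsTriple.only t₂ Py
  ... | inj₁ refl = _ , here refl , refl
  ... | inj₂ (inj₁ refl) = _ , at₁ refl , refl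
  ... | inj₂ (inj₂ refl) = _ , at₂ refl , refl

-- Numbering a subset and gluing further vertices to it

enum : (U : Subset n) → Fin ∣ U ∣ → Fin n
enum (inside  ∷ U) zero    = zero
enum (inside  ∷ U) (suc i) = suc (enum U i)
enum (outside ∷ U) i       = suc (enum U i)

enum∈ : (U : Subset n) → ∀ i → enum U i ∈ U
enum∈ (inside  ∷ U) zero    = here
enum∈ (inside  ∷ U) (suc i) = there (enum∈ U i)
enum∈ (outside ∷ U) i       = there (enum∈ U i)

rank : ∀ {U : Subset n} {x} → x ∈ U → Fin ∣ U ∣
rank here = zero
rank {U = inside  ∷ U} (there x∈) = suc (rank x∈)
rank {U = outside ∷ U} (there x∈) = rank x∈

enum-rank : ∀ {U : Subset n} {x} (x∈ : x ∈ U) → enum U (rank x∈) ≡ x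
enum-rank here = refl
enum-rank {U = inside  ∷ U} (there x∈) = cong suc (enum-rank x∈)
enum-rank {U = outside ∷ U} (there x∈) = cong suc (enum-rank x∈)

rank-enum : ∀ (U : Subset n) i (x∈ : enum U i ∈ U) → rank x∈ ≡ i
rank-enum (inside  ∷ U) zero here = refl
rank-enum (inside  ∷ U) (suc i) (there x∈) = cong suc (rank-enum U i x∈)
rank-enum (outside ∷ U) i (there x∈) = rank-enum U i x∈

module _ (k′ : ℕ) (U : Subset n) where
  private k = suc k′

  decode : Fin (k + ∣ U ∣) → Fin k ⊎ Fin n
  decode x = Sum.map₂ (enum U) (splitAt k x)

  ψ-glue : Fin n → Fin (k + ∣ U ∣)
  ψ-glue r with r ∈? U
  ... | yes r∈ = k ↑ʳ rank r∈
  -- An arbitrary value, available because the labelled part is non-empty; hence the successor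
  -- `suc k′`.
  ... | no  _  = zero

  decode-φ : ∀ b → decode (b ↑ˡ ∣ U ∣) ≡ inj₁ b
  decode-φ b = cong (Sum.map₂ (enum U)) (splitAt-↑ˡ k b ∣ U ∣)

  decode-ψ : ∀ {r} → r ∈ U → decode (ψ-glue r) ≡ inj₂ r
  decode-ψ {r} r∈ with r ∈? U
  ... | no r∉   = contradiction r∈ r∉
  ... | yes r∈′ = trans (cong (Sum.map₂ (enum U)) (splitAt-↑ʳ k ∣ U ∣ (rank r∈′)))
                        (cong inj₂ (enum-rank r∈′))

  glue : Cover (Fin (k + ∣ U ∣)) (Fin k) U
  glue .Cover.φ b = b ↑ˡ ∣ U ∣
  glue .Cover.ψ = ψ-glue
  glue .Cover.φ-inj {b} {b′} eq =
    inj₁-injective (trans (sym (decode-φ b)) (trans (cong decode eq) (decode-φ b′)))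
  glue .Cover.ψ-inj r∈ r′∈ eq =
    inj₂-injective (trans (sym (decode-ψ r∈)) (trans (cong decode eq) (decode-ψ r′∈)))
  glue .Cover.disjoint {b} r∈ eq with () ←
    trans (sym (decode-φ b)) (trans (cong decode eq) (decode-ψ r∈))
  glue .Cover.cover x with splitAt k x | join-splitAt k ∣ U ∣ x
  ... | inj₁ b | eq = inj₁ (b , eq)
  ... | inj₂ i | eq = inj₂ (enum U i , enum∈ U i , trans ψ-enum eq)
    where
    ψ-enum : ψ-glue (enum U i) ≡ k ↑ʳ i
    ψ-enum with enum U i ∈? U
    ... | yes r∈ = cong (k ↑ʳ_) (rank-enum U i r∈)
    ... | no r∉  = contradiction (enum∈ U i) r∉

-- Blobs and grafts

-- A fixed graph on k vertices with c dangling edges, the j-th one at β j.  Its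
-- edges are listed over Fin k ⊎ Fin c, where inj₂ j is the unknown far end of
-- the j-th dangling edge.  Ports with different κ will have different far ends.
record Blob : Set where
  field
    k′ c  : ℕ
    inner : List (Edge (Fin (suc k′)))
    β     : Fin c → Fin (suc k′)
    κ     : Fin c → Fin c

  k : ℕ
  k = suc k′

  Symbol : Set
  Symbol = Fin k ⊎ Fin c

  _≟ˢ_ : DecidableEquality Symbol
  _≟ˢ_ = ⊎-≡-dec _≟_ _≟_

  key : Symbol → Symbol
  key = Sum.map₂ κ

  edges : List (Edge Symbol)
  edges = map-edges inj₁ inner ++ List.tabulate (λ j → inj₁ (β j) — inj₂ j)

  field
    loopless : All (uncurry _≢_) inner
    β-inj    : ∀ i j → β i ≡ β j → i ≡ j
    cubic    : ∀ b → Distinct₃ key (partners _≟ˢ_ (inj₁ b) edges)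

module _ (G : Graph) where
  open Graph G using () renaming (Vertex to V; Adj to _~_)

  -- The edges leaving the complement of U are the p j — s j.
  record Frontier {c} (U : Subset (Graph.order G)) (p s : Fin c → V) : Set where
    field
      p∉       : ∀ j → p j ∉ U
      s∈       : ∀ j → s j ∈ U
      p~s      : ∀ j → p j ~ s j
      crossing : ∀ {x y} → x ∉ U → y ∈ U → x ~ y → ∃[ j ] (x ≡ p j × y ≡ s j)
      distinct : ∀ {i j} → p i ≡ p j → s i ≡ s j → i ≡ j

  module Graft (G-cubic : Cubic G) (bl : Blob) {U} {p s : Fin (Blob.c bl) → V} (fr : Frontier U p s)
               (s-κ : ∀ {i j} → s i ≡ s j → Blob.κ bl i ≡ Blob.κ bl j) where
    open Blob bl
    open Frontier fr

    Node : Set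
    Node = Fin k ⊎ V

    -- Defined over all of `V` rather than `U`, so that the tail case is adjacency in `G` itself.
    -- The vertices of the graft decode only to nodes with `Valid`, which recovers the restriction
    -- to `U`.
    data Near : Node → Node → Set where
      blob : ∀ {b b′} → Joins inner b b′ → Near (inj₁ b) (inj₁ b′)
      port : ∀ j → Near (inj₁ (β j)) (inj₂ (s j))
      trop : ∀ j → Near (inj₂ (s j)) (inj₁ (β j))
      tail : ∀ {r r′} → r ~ r′ → Near (inj₂ r) (inj₂ r′)

    near? : Decidable Near
    near? (inj₁ b) (inj₁ b′) with joins? _≟_ inner b b′
    ... | yes j = yes (blob j)
    ... | no ¬j = no λ { (blob j) → ¬j j }
    near? (inj₁ b) (inj₂ r) with any? (λ j → (β j ≟ b) ×-dec (s j ≟ r))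
    ... | yes (j , refl , refl) = yes (port j)
    ... | no ¬e = no λ { (port j) → ¬e (j , refl , refl) }
    near? (inj₂ r) (inj₁ b) with any? (λ j → (β j ≟ b) ×-dec (s j ≟ r))
    ... | yes (j , refl , refl) = yes (trop j)
    ... | no ¬e = no λ { (trop j) → ¬e (j , refl , refl) }
    near? (inj₂ r) (inj₂ r′) with Graph.adj? G r r′
    ... | yes e = yes (tail e)
    ... | no ¬e = no λ { (tail e) → ¬e e }

    near-sym : Symmetric Near
    near-sym (blob j) = blob (Sum.swap j)
    near-sym (port j) = trop j
    near-sym (trop j) = port j
    near-sym (tail e) = tail (Graph.sym G e)

    near-irrefl : ∀ {x} → ¬ Near x x
    near-irrefl (blob (inj₁ e∈)) = All.lookup loopless e∈ refl
    near-irrefl (blob (inj₂ e∈)) = All.lookup loopless e∈ refl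
    near-irrefl (tail e) = Graph.irrefl G refl e

    toNode : Symbol → Node
    toNode = Sum.map₂ s

    edge⇒near : ∀ {a b} → (a — b) L.∈ edges → Near (toNode a) (toNode b)
    edge⇒near e∈ with ∈-++⁻ (map-edges inj₁ inner) e∈
    ... | inj₁ e∈′ with _ , e∈″ , refl ← ∈-map⁻ _ e∈′ = blob (inj₁ e∈″)
    ... | inj₂ e∈′ with j , refl ← ∈-tabulate⁻ e∈′ = port j

    joins⇒near : ∀ {a b} → Joins edges a b → Near (toNode a) (toNode b)
    joins⇒near (inj₁ e∈) = edge⇒near e∈
    joins⇒near (inj₂ e∈) = near-sym (edge⇒near e∈)

    port∈edges : ∀ j → (inj₁ (β j) — inj₂ j) L.∈ edges
    port∈edges j = ∈-++⁺ʳ (map-edges inj₁ inner) (∈-tabulate⁺ j)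

    data Near⁻ : Node → Node → Set where
      symbols : ∀ {a b} → Joins edges a b → Near⁻ (toNode a) (toNode b)
      tails   : ∀ {r r′} → r ~ r′ → Near⁻ (inj₂ r) (inj₂ r′)

    near⁻ : ∀ {x y} → Near x y → Near⁻ x y
    near⁻ (blob j) = symbols (Sum.map (∈-++⁺ˡ ∘ ∈-map⁺ _) (∈-++⁺ˡ ∘ ∈-map⁺ _) j)
    near⁻ (port j) = symbols (inj₁ (port∈edges j))
    near⁻ (trop j) = symbols (inj₂ (port∈edges j))
    near⁻ (tail e) = tails e

    toNode-key : ∀ {a b} → toNode a ≡ toNode b → key a ≡ key b
    toNode-key {inj₁ _} {inj₁ _} eq = cong inj₁ (inj₁-injective eq)
    toNode-key {inj₂ _} {inj₂ _} eq = cong inj₂ (s-κ (inj₂-injective eq))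

    from-blob : ∀ {b y} → Near (inj₁ b) y → ∃[ a ] (a L.∈ partners _≟ˢ_ (inj₁ b) edges × toNode a ≡ y)
    from-blob {b} e with inj₁ b in eq | near⁻ e
    from-blob e | _ | symbols {inj₁ _} {z} j with refl ← eq = z , partners⁺ _≟ˢ_ edges j , refl

    blob-triple : ∀ b → ∃[ x ] ∃[ y ] ∃[ z ] IsTriple (Near (inj₁ b)) x y z
    blob-triple b = Distinct₃⇒triple (Distinct₃-coarsen (λ {a} {a′} → toNode-key {a} {a′}) (cubic b))
      (λ a∈ → joins⇒near (partners⁻ _≟ˢ_ edges a∈)) from-blob

    -- The neighbour of r in the graft standing for its neighbour x in G.
    data Image (r : V) : V → Node → Set where
      within  : ∀ {x} → x ∈ U → Image r x (inj₂ x)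
      across : ∀ {j} → r ≡ s j → Image r (p j) (inj₁ (β j))

    image : ∀ {r x} → r ∈ U → r ~ x → ∃[ y ] Image r x y
    image {x = x} r∈ e with x ∈? U
    ... | yes x∈ = _ , within x∈
    ... | no  x∉ with j , refl , eq ← crossing x∉ r∈ (Graph.sym G e) = _ , across eq

    image-near : ∀ {r x y} → r ~ x → Image r x y → Near (inj₂ r) y
    image-near e (within _) = tail e
    image-near e (across refl) = trop _

    image-injective : ∀ {r x x′ y} → Image r x y → Image r x′ y → x ≡ x′
    image-injective (within _) (within _) = refl
    image-injective {r} {x} {x′} i o = go i o refl
      where
      go : ∀ {x x′ y y′} → Image r x y → Image r x′ y′ → y ≡ y′ → x ≡ x′
      go (within _) (within _) refl = refl
      go (across {i} _) (across {j} _) eq = cong p (β-inj i j (inj₁-injective eq))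

    image-functional : ∀ {r x y y′} → Image r x y → Image r x y′ → y ≡ y′
    image-functional i o = go i o refl
      where
      go : ∀ {r x x′ y y′} → Image r x y → Image r x′ y′ → x ≡ x′ → y ≡ y′
      go (within _) (within _) refl = refl
      go (within x∈) (across _) refl = contradiction x∈ (p∉ _)
      go (across _) (within x∈) refl = contradiction x∈ (p∉ _)
      go (across eq) (across eq′) p≡ = cong (inj₁ ∘ β) (distinct p≡ (trans (sym eq) eq′))

    preimage : ∀ {r y} → Near (inj₂ r) y → (∀ {x} → y ≡ inj₂ x → x ∈ U) → ∃[ x ] (r ~ x × Image r x y)
    preimage (trop j) _ = p j , Graph.sym G (p~s j) , across refl
    preimage (tail e) valid = _ , e , within (valid refl)

    Valid : Node → Set
    Valid y = ∀ {x} → y ≡ inj₂ x → x ∈ U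

    near-valid : ∀ {b y} → Near (inj₁ b) y → Valid y
    near-valid (port j) refl = s∈ j

    image-valid : ∀ {r x y} → Image r x y → Valid y
    image-valid (within x∈) refl = x∈

    -- Degrees in the tail survive because neighbours are exchanged one for one: a neighbour outside
    -- `U` is some `p j`, replaced by `β j`. Different neighbours have different images as `β` is
    -- injective, and the image is unique as the crossing edges are distinct.
    tail-triple : ∀ {r} → r ∈ U →
      ∃[ x ] ∃[ y ] ∃[ z ] IsTriple (λ y → Near (inj₂ r) y × Valid y) x y z
    tail-triple {r} r∈
      with a , b , c , t ← degree-triple G (G-cubic r)
      with a′ , ia ← image r∈ (IsTriple.Pa t)
         | b′ , ib ← image r∈ (IsTriple.Pb t)
         | c′ , ic ← image r∈ (IsTriple.Pc t)
      = a′ , b′ , c′ , triple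
          (λ { refl → a≢b (image-injective ia ib) })
          (λ { refl → a≢c (image-injective ia ic) })
          (λ { refl → b≢c (image-injective ib ic) })
          (image-near Pa ia , image-valid ia)
          (image-near Pb ib , image-valid ib)
          (image-near Pc ic , image-valid ic)
          λ (e , valid) → let x , r~x , i = preimage e valid in
            Sum.map (λ { refl → image-functional i ia })
              (Sum.map (λ { refl → image-functional i ib }) (λ { refl → image-functional i ic }))
              (only r~x)
      where open IsTriple t

    cover : Cover (Fin (k + ∣ U ∣)) (Fin k) U
    cover = glue k′ U

    open Cover cover using (φ; ψ) public

    δ : Fin (k + ∣ U ∣) → Node
    δ = decode k′ U

    δφ : ∀ b → δ (φ b) ≡ inj₁ b
    δφ = decode-φ k′ U

    δψ : ∀ {r} → r ∈ U → δ (ψ r) ≡ inj₂ r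
    δψ = decode-ψ k′ U

    encode : Node → Fin (k + ∣ U ∣)
    encode = [ φ , ψ ]′

    encode-δ : ∀ x → encode (δ x) ≡ x
    encode-δ x with Cover.cover cover x
    ... | inj₁ (b , refl) = cong encode (δφ b)
    ... | inj₂ (r , r∈ , refl) = cong encode (δψ r∈)

    graft : Graph
    graft = record
      { order = k + ∣ U ∣
      ; nonEmpty = _
      ; Adj = λ x y → Near (δ x) (δ y)
      ; adj? = λ x y → near? (δ x) (δ y)
      ; sym = near-sym
      ; irrefl = λ { refl → near-irrefl }
      }

    graft-degree : ∀ x → ∃[ a ] ∃[ b ] ∃[ c ] IsTriple (λ y → Near (δ x) y × Valid y) a b c →
                   degree graft x ≡ 3
    graft-degree x (a , b , c , t) = triple-degree graft {x = x} (triple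
        (a≢b ∘ encode-injective Pa Pb) (a≢c ∘ encode-injective Pa Pc) (b≢c ∘ encode-injective Pb Pc)
        (good Pa) (good Pb) (good Pc)
        λ {y} e → Sum.map (back y) (Sum.map (back y) (back y)) (only (e , valid y)))
      where
      open IsTriple {P = λ y → Near (δ x) y × Valid y} t
      δ-encode : ∀ {y} → Valid y → δ (encode y) ≡ y
      δ-encode {inj₁ b} _ = δφ b
      δ-encode {inj₂ r} v = δψ (v refl)
      encode-injective : ∀ {y z} → Near (δ x) y × Valid y → Near (δ x) z × Valid z →
                         encode y ≡ encode z → y ≡ z
      encode-injective (_ , vy) (_ , vz) eq = trans (sym (δ-encode vy)) (trans (cong δ eq) (δ-encode vz))
      good : ∀ {y} → Near (δ x) y × Valid y → Near (δ x) (δ (encode y))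
      good (e , v) = subst (Near (δ x)) (sym (δ-encode v)) e
      back : ∀ y {z} → δ y ≡ z → y ≡ encode z
      back y refl = sym (encode-δ y)
      valid : ∀ y → Valid (δ y)
      valid y eq with Cover.cover cover y
      ... | inj₁ (b , refl) with () ← trans (sym eq) (δφ b)
      ... | inj₂ (r , r∈ , refl) with refl ← trans (sym eq) (δψ r∈) = r∈

    graft-cubic : Cubic graft
    graft-cubic x = graft-degree x (go (Cover.cover cover x))
      where
      Near′ : Node → Node → Set
      Near′ x y = Near x y × Valid y
      go : _ → ∃[ a ] ∃[ b ] ∃[ c ] IsTriple (Near′ (δ x)) a b c
      go (inj₁ (b , refl)) with a₁ , a₂ , a₃ , t ← blob-triple b =
        a₁ , a₂ , a₃ , subst (λ x → IsTriple (Near′ x) a₁ a₂ a₃) (sym (δφ b))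
          (triple a≢b a≢c b≢c (Pa , near-valid Pa) (Pb , near-valid Pb) (Pc , near-valid Pc) (only ∘ proj₁))
        where open IsTriple t
      go (inj₂ (r , r∈ , refl)) with a₁ , a₂ , a₃ , t ← tail-triple r∈ =
        a₁ , a₂ , a₃ , subst (λ x → IsTriple (Near′ x) a₁ a₂ a₃) (sym (δψ r∈)) t

    ⟦_⟧ : Symbol → Fin (k + ∣ U ∣)
    ⟦_⟧ = [ φ , ψ ∘ s ]′

    δ⟦⟧ : ∀ a → δ ⟦ a ⟧ ≡ toNode a
    δ⟦⟧ (inj₁ b) = δφ b
    δ⟦⟧ (inj₂ j) = δψ (s∈ j)

    ⟦⟧-key : ∀ {a b} → ⟦ a ⟧ ≡ ⟦ b ⟧ → key a ≡ key b
    ⟦⟧-key {a} {b} eq = toNode-key {a} {b} (trans (sym (δ⟦⟧ a)) (trans (cong δ eq) (δ⟦⟧ b)))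

    graft-symbols : ∀ {a b} → Joins edges a b → Adj graft ⟦ a ⟧ ⟦ b ⟧
    graft-symbols {a} {b} j = subst₂ Near (sym (δ⟦⟧ a)) (sym (δ⟦⟧ b)) (joins⇒near j)

    graft-tails : ∀ {r r′} → r ∈ U → r′ ∈ U → r ~ r′ → Graph.Adj graft (ψ r) (ψ r′)
    graft-tails r∈ r′∈ e = subst₂ Near (sym (δψ r∈)) (sym (δψ r′∈)) (tail e)

    graft-tails⁻ : ∀ {r r′} → r ∈ U → r′ ∈ U → Graph.Adj graft (ψ r) (ψ r′) → r ~ r′
    graft-tails⁻ r∈ r′∈ e with tail e′ ← subst₂ Near (δψ r∈) (δψ r′∈) e = e′

    data Graft⁻ : Fin (k + ∣ U ∣) → Fin (k + ∣ U ∣) → Set where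
      symbols : ∀ {a b} → Joins edges a b → Graft⁻ ⟦ a ⟧ ⟦ b ⟧
      tails   : ∀ {r r′} → r ∈ U → r′ ∈ U → r ~ r′ → Graft⁻ (ψ r) (ψ r′)

    graft⁻ : ∀ {x y} → Adj graft x y → Graft⁻ x y
    graft⁻ {x} {y} e = go (near⁻ e) refl refl
      where
      ⟦⟧≡ : ∀ {a x} → toNode a ≡ δ x → ⟦ a ⟧ ≡ x
      ⟦⟧≡ {inj₁ b} {x} eq = trans (cong encode eq) (encode-δ x)
      ⟦⟧≡ {inj₂ j} {x} eq = trans (cong encode eq) (encode-δ x)
      ψ≡ : ∀ {r x} → inj₂ r ≡ δ x → r ∈ U × ψ r ≡ x
      ψ≡ {x = x} eq with Cover.cover cover x
      ... | inj₁ (b , refl) with () ← trans eq (δφ b)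
      ... | inj₂ (r , r∈ , refl) with refl ← trans eq (δψ r∈) = r∈ , refl
      go : ∀ {m m′} → Near⁻ m m′ → m ≡ δ x → m′ ≡ δ y → Graft⁻ x y
      go (symbols {a} {b} j) eq eq′ with refl ← ⟦⟧≡ {a} {x} eq | refl ← ⟦⟧≡ {b} {y} eq′ = symbols j
      go (tails e) eq eq′ with r∈ , refl ← ψ≡ {x = x} eq | r′∈ , refl ← ψ≡ {x = y} eq′ = tails r∈ r′∈ e

-- Rewirings and their symbolic verification

-- A rewiring of a blob, in the symbols of the blob and its nn new vertices.
record Rewiring (bl : Blob) : Set where
  open Blob bl
  field
    nn  : ℕ
    del : List (Edge Symbol)
    add : List (Edge (Symbol ⊎ Fin nn))

  Symbol⁺ : Set
  Symbol⁺ = Symbol ⊎ Fin nn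

  Core : Set
  Core = Fin k ⊎ Fin nn

  symbol : Core → Symbol⁺
  symbol = Sum.map₁ inj₁

  _≟⁺_ : DecidableEquality Symbol⁺
  _≟⁺_ = ⊎-≡-dec _≟ˢ_ _≟_

  key⁺ : Symbol⁺ → Symbol⁺
  key⁺ = Sum.map₁ key

  -- Compared by keys, since different symbols with equal keys may denote the same vertex: an edge
  -- counts as deleted as soon as some interpretation might identify it with a deleted one.
  Deleted : Edge Symbol → Set
  Deleted (a — b) = Joins (map-edges key del) (key a) (key b)

  deleted? : ∀ e → Dec (Deleted e)
  deleted? (a — b) = joins? _≟ˢ_ (map-edges key del) (key a) (key b)

  remaining : List (Edge Symbol)
  remaining = filter (¬? ∘ deleted?) edges

  rewired : List (Edge Symbol⁺)
  rewired = map-edges inj₁ remaining ++ add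

  IsCore : Symbol → Set
  IsCore a = ∃[ b ] a ≡ inj₁ b

-- The conditions that can be evaluated once and for all: the cautious test `Deleted` catches no
-- edge that should stay; every deleted edge starts in the blob, so the tail is untouched; and each
-- vertex of the blob and each new vertex ends up with three certainly different neighbours.
record Valid {bl} (rw : Rewiring bl) : Set where
  open Blob bl
  open Rewiring rw
  field
    del-exact : All (λ e → Deleted e → uncurry (Joins del) e) edges
    del-core  : All (IsCore ∘ proj₁) del
    saturated : ∀ b → Distinct₃ key⁺ (partners _≟⁺_ (symbol b) rewired)

module _ {bl} (rw : Rewiring bl) where
  open Blob bl
  open Rewiring rw

  isCore? : ∀ a → Dec (IsCore a)
  isCore? (inj₁ b) = yes (b , refl)
  isCore? (inj₂ j) = no λ ()

  saturated? : ∀ b → Dec (Distinct₃ key⁺ (partners _≟⁺_ (symbol b) rewired))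
  saturated? b = distinct₃? _≟⁺_ key⁺ (partners _≟⁺_ (symbol b) rewired)

  private
    checks = All.all? (λ e → deleted? e →-dec uncurry (joins? _≟ˢ_ del) e) edges
      ×-dec All.all? (isCore? ∘ proj₁) del
      ×-dec all? (saturated? ∘ inj₁)
      ×-dec all? (saturated? ∘ inj₂)

  valid : True checks → Valid rw
  valid t with del-exact , del-core , old-saturated , new-saturated ← toWitness {a? = checks} t = record
    { del-exact = del-exact
    ; del-core  = del-core
    ; saturated = λ { (inj₁ b) → old-saturated b ; (inj₂ i) → new-saturated i }
    }

module _ (G : Graph) where
  open Graph G using () renaming (Vertex to V; Adj to _~_)

  interp : ∀ {X B : Set} {U : Subset (Graph.order G)} {c} → Cover X B U → (Fin c → V) → B ⊎ Fin c → X
  interp cov s = [ Cover.φ cov , Cover.ψ cov ∘ s ]′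

  -- Only the presence of the listed edges is demanded. Nothing is said about missing edges at
  -- labelled vertices, since cubicity of `H` will rule out any others; inside the tail, where no
  -- such count is made, both directions are required.
  record Realises {B : Set} {c} (es : List (Edge (B ⊎ Fin c))) (s : Fin c → V) U (H : Graph) : Set where
    field
      cov    : Cover (Graph.Vertex H) B U
    open Cover cov public
    field
      joined : All (λ (a , b) → Adj H (interp cov s a) (interp cov s b)) es
      tail⁺  : ∀ {r r′} → r ∈ U → r′ ∈ U → r ~ r′ → Adj H (ψ r) (ψ r′)
      tail⁻  : ∀ {r r′} → r ∈ U → r′ ∈ U → Adj H (ψ r) (ψ r′) → r ~ r′

  module Surgery (G-cubic : Cubic G) (bl : Blob) (rw : Rewiring bl) (rw-valid : Valid rw)
                 {U} {p s : Fin (Blob.c bl) → V} (fr : Frontier G U p s)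
                 (s-κ : ∀ {i j} → s i ≡ s j → Blob.κ bl i ≡ Blob.κ bl j) where
    open Blob bl
    open Rewiring rw
    open Valid rw-valid
    open Frontier fr
    open Graft G G-cubic bl fr s-κ public

    interp⁺ : ∀ {X} → Cover X Core U → Symbol⁺ → X
    interp⁺ c (inj₁ (inj₁ b)) = Cover.φ c (inj₁ b)
    interp⁺ c (inj₁ (inj₂ j)) = Cover.ψ c (s j)
    interp⁺ c (inj₂ i)        = Cover.φ c (inj₂ i)

    ⟦_⟧⁺ : Symbol⁺ → Graph.Vertex graft ⊎ Fin nn
    ⟦_⟧⁺ = Sum.map₁ ⟦_⟧

    module _ {H : Graph} (H-cubic : Cubic H) (cov : Cover (Graph.Vertex H) Core U)
             (joined : All (λ (a , b) → Adj H (interp⁺ cov a) (interp⁺ cov b)) rewired)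
             (tail⁺ : ∀ {r r′} → r ∈ U → r′ ∈ U → r ~ r′ → Adj H (Cover.ψ cov r) (Cover.ψ cov r′))
             (tail⁻ : ∀ {r r′} → r ∈ U → r′ ∈ U → Adj H (Cover.ψ cov r) (Cover.ψ cov r′) → r ~ r′)
             where
      private
        H⟦_⟧ : Symbol⁺ → Graph.Vertex H
        H⟦_⟧ = interp⁺ cov

        cov′ : Cover (Graph.Vertex graft ⊎ Fin nn) Core U
        cov′ = adjoin cover

        f : Graph.Vertex graft ⊎ Fin nn → Graph.Vertex H
        f = match cov′ cov

        f⟦⟧ : ∀ a → f ⟦ a ⟧⁺ ≡ H⟦ a ⟧
        f⟦⟧ (inj₁ (inj₁ b)) = match-φ cov′ cov (inj₁ b)
        f⟦⟧ (inj₁ (inj₂ j)) = match-ψ cov′ cov (s∈ j)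
        f⟦⟧ (inj₂ i)        = match-φ cov′ cov (inj₂ i)

        f-injective : ∀ {x y} → f x ≡ f y → x ≡ y
        f-injective {x} {y} eq =
          trans (sym (match-match cov′ cov x)) (trans (cong (match cov cov′) eq) (match-match cov′ cov y))

        ⟦⟧⁺-key : ∀ {a b} → ⟦ a ⟧⁺ ≡ ⟦ b ⟧⁺ → key⁺ a ≡ key⁺ b
        ⟦⟧⁺-key {inj₁ a} {inj₁ b} eq = cong inj₁ (⟦⟧-key {a} {b} (inj₁-injective eq))
        ⟦⟧⁺-key {inj₂ _} {inj₂ _} eq = cong inj₂ (inj₂-injective eq)

        H⟦⟧-key : ∀ {a b} → H⟦ a ⟧ ≡ H⟦ b ⟧ → key⁺ a ≡ key⁺ b
        H⟦⟧-key {a} {b} eq = ⟦⟧⁺-key {a} {b} (f-injective (trans (f⟦⟧ a) (trans eq (sym (f⟦⟧ b)))))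

        R : Graph.Vertex graft ⊎ Fin nn → Graph.Vertex graft ⊎ Fin nn → Set
        R = Rewired graft nn (map-edges ⟦_⟧ del) (map-edges ⟦_⟧⁺ add)

        R-sym : Symmetric R
        R-sym (inj₁ (kept {x} {y} e ¬j)) = inj₁ (kept (Graph.sym graft {x} {y} e) (¬j ∘ Sum.swap))
        R-sym (inj₂ j) = inj₂ (Sum.swap j)

        ¬deleted⇒¬joins : ∀ {a b} → ¬ Deleted (a — b) → ¬ Joins (map-edges ⟦_⟧ del) ⟦ a ⟧ ⟦ b ⟧
        ¬deleted⇒¬joins {a} {b} ¬d j with a′ , b′ , j′ , eq , eq′ ← Joins-map⁻ ⟦_⟧ j =
          ¬d (subst₂ (Joins _) (⟦⟧-key {a′} {a} eq) (⟦⟧-key {b′} {b} eq′) (Joins-map⁺ key j′))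

        edge⇒R : ∀ {a b} → (a — b) L.∈ rewired → R ⟦ a ⟧⁺ ⟦ b ⟧⁺
        edge⇒R e∈ with ∈-++⁻ (map-edges inj₁ remaining) e∈
        ... | inj₂ e∈add = inj₂ (Joins-map⁺ ⟦_⟧⁺ (inj₁ e∈add))
        ... | inj₁ e∈′ with (a , b) , e∈rem , refl ← ∈-map⁻ _ e∈′
                       with e∈edges , ¬d ← ∈-filter⁻ (¬? ∘ deleted?) {xs = edges} e∈rem
          = inj₁ (kept (graft-symbols {a} {b} (inj₁ e∈edges)) (¬deleted⇒¬joins {a} {b} ¬d))

        joins⇒R : ∀ {a b} → Joins rewired a b → R ⟦ a ⟧⁺ ⟦ b ⟧⁺
        joins⇒R (inj₁ e∈) = edge⇒R e∈
        joins⇒R (inj₂ e∈) = R-sym (edge⇒R e∈)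

        joins⇒H : ∀ {a b} → Joins rewired a b → Adj H H⟦ a ⟧ H⟦ b ⟧
        joins⇒H {a} {b} = Joins-All {R = λ a b → Adj H H⟦ a ⟧ H⟦ b ⟧} (Graph.sym H) joined {a} {b}

        joins⇒Hf : ∀ {a b} → Joins rewired a b → Adj H (f ⟦ a ⟧⁺) (f ⟦ b ⟧⁺)
        joins⇒Hf {a} {b} j = subst₂ (Adj H) (sym (f⟦⟧ a)) (sym (f⟦⟧ b)) (joins⇒H {a} {b} j)

        kept-edge : ∀ {a b} → (a — b) L.∈ edges → ¬ Joins (map-edges ⟦_⟧ del) ⟦ a ⟧ ⟦ b ⟧ →
                    (inj₁ a — inj₁ b) L.∈ rewired
        kept-edge {a} {b} e∈ ¬j = ∈-++⁺ˡ (∈-map⁺ _ (∈-filter⁺ (¬? ∘ deleted?) e∈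
          λ d → ¬j (Joins-map⁺ ⟦_⟧ (All.lookup del-exact e∈ d))))

        R⇒H : ∀ {x y} → R x y → Adj H (f x) (f y)
        R⇒H (inj₂ j) with a , b , j′ , refl , refl ← Joins-map⁻ ⟦_⟧⁺ j =
          joins⇒Hf {a} {b} (Sum.map (∈-++⁺ʳ _) (∈-++⁺ʳ _) j′)
        R⇒H (inj₁ (kept e ¬j)) = go (graft⁻ e) ¬j
          where
          go : ∀ {x y} → Graft⁻ x y → ¬ Joins (map-edges ⟦_⟧ del) x y → Adj H (f (inj₁ x)) (f (inj₁ y))
          go (symbols {a} {b} (inj₁ e∈)) ¬j = joins⇒Hf {inj₁ a} {inj₁ b} (inj₁ (kept-edge e∈ ¬j))
          go (symbols {a} {b} (inj₂ e∈)) ¬j = joins⇒Hf {inj₁ a} {inj₁ b} (inj₂ (kept-edge e∈ (¬j ∘ Sum.swap)))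
          go (tails r∈ r′∈ e) _ = subst₂ (Adj H) (sym (match-ψ cov′ cov r∈)) (sym (match-ψ cov′ cov r′∈))
            (tail⁺ r∈ r′∈ e)

        core-symbol : ∀ b → H⟦ symbol b ⟧ ≡ Cover.φ cov b
        core-symbol (inj₁ _) = refl
        core-symbol (inj₂ _) = refl

        core-symbol′ : ∀ b → ⟦ symbol b ⟧⁺ ≡ Cover.φ cov′ b
        core-symbol′ (inj₁ _) = refl
        core-symbol′ (inj₂ _) = refl

        -- The three neighbours listed for a core vertex have different keys and are neighbours in
        -- `H`. As `H` is cubic, an arbitrary edge at this vertex leads to one of them and thus
        -- comes from the rewiring.
        core⇒R : ∀ {b y} → Adj H (f (Cover.φ cov′ b)) (f y) → R (Cover.φ cov′ b) y
        core⇒R {b} {y} e =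
          let _ , _ , _ , t = degree-triple H (H-cubic (f (Cover.φ cov′ b)))
              a , a∈ , eq = triple-exhausted {f = H⟦_⟧} t
                 (Distinct₃-coarsen (λ {a} {a′} → H⟦⟧-key {a} {a′}) (saturated b))
                 (λ {a} a∈ → subst (λ x → Adj H x H⟦ a ⟧)
                   (trans (core-symbol b) (sym (match-φ cov′ cov b)))
                   (joins⇒H {symbol b} {a} (partners⁻ _≟⁺_ rewired a∈)))
                 e
          in subst₂ R (core-symbol′ b) (f-injective {⟦ a ⟧⁺} {y} (trans (f⟦⟧ a) eq))
               (joins⇒R {symbol b} {a} (partners⁻ _≟⁺_ rewired a∈))

        tail-not-deleted : ∀ {r r′} → r ∈ U → r′ ∈ U → ¬ Joins (map-edges ⟦_⟧ del) (ψ r) (ψ r′)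
        tail-not-deleted r∈ r′∈ j with a , b , j′ , eq , eq′ ← Joins-map⁻ ⟦_⟧ j with j′
        ... | inj₁ e∈ with _ , refl ← All.lookup del-core e∈ = Cover.disjoint cover r∈ eq
        ... | inj₂ e∈ with _ , refl ← All.lookup del-core e∈ = Cover.disjoint cover r′∈ eq′

        H⇒R : ∀ x y → Adj H (f x) (f y) → R x y
        H⇒R x y e = go (Cover.cover cov′ x) (Cover.cover cov′ y) e
          where
          Covered : Graph.Vertex graft ⊎ Fin nn → Set
          Covered x = (∃[ b ] Cover.φ cov′ b ≡ x) ⊎ (∃[ r ] (r ∈ U × Cover.ψ cov′ r ≡ x))
          go : ∀ {x y} → Covered x → Covered y → Adj H (f x) (f y) → R x y
          go (inj₁ (b , refl)) _ e = core⇒R {b} e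
          go (inj₂ _) (inj₁ (b , refl)) e = R-sym (core⇒R {b} (Graph.sym H e))
          go (inj₂ (r , r∈ , refl)) (inj₂ (r′ , r′∈ , refl)) e = inj₁ (kept
            (graft-tails r∈ r′∈ (tail⁻ r∈ r′∈ (subst₂ (Adj H) (match-ψ cov′ cov r∈) (match-ψ cov′ cov r′∈) e)))
            (tail-not-deleted r∈ r′∈))

      replace : Replace graft nn (map-edges ⟦_⟧ del) (map-edges ⟦_⟧⁺ add) H
      replace = record
        { cubic-before = graft-cubic
        ; cubic-after  = H-cubic
        ; result       = match-↔ cov′ cov , λ x y → mk⇔ R⇒H (H⇒R x y)
        }

-- The six construction steps as rewirings and drawings

pattern ● b = inj₁ (inj₁ b)
pattern ◇ j = inj₁ (inj₂ j)
pattern ★ i = inj₂ i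

-- The far ends of the three dangling edges may coincide, hence the constant `κ`: no check may rely
-- on their being different.
K₂,₃ : Blob
K₂,₃ = record
  { k′ = 4 ; c = 3
  ; inner = k₂,₃ 0F 1F 2F 3F 4F
  ; β = λ j → suc (suc j)
  ; κ = λ _ → 0F
  ; loopless = toWitness {a? = All.all? (λ e → ¬? (proj₁ e ≟ proj₂ e)) _} _
  ; β-inj = λ { _ _ refl → refl }
  ; cubic = toWitness {a? = all? λ b → distinct₃? (⊎-≡-dec _≟_ _≟_) _ _} _
  }
  where open import Data.Sum.Properties using () renaming (≡-dec to ⊎-≡-dec)

-- K₃,₃ with parts 0F, 1F, 5F and 2F, 3F, 4F and without its edge 2F — 5F.
K₃,₃⁻ : Blob
K₃,₃⁻ = record
  { k′ = 5 ; c = 2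
  ; inner = k₂,₃ 0F 1F 2F 3F 4F ++ 3F — 5F ∷ 4F — 5F ∷ []
  ; β = λ { 0F → 2F ; 1F → 5F }
  -- `Config₅₆` wants s and t to be different, so this blob is only ever grafted with different far
  -- ends.
  ; κ = id
  ; loopless = toWitness {a? = All.all? (λ e → ¬? (proj₁ e ≟ proj₂ e)) _} _
  ; β-inj = λ { 0F 0F _ → refl ; 0F 1F () ; 1F 0F () ; 1F 1F _ → refl }
  ; cubic = toWitness {a? = all? λ b → distinct₃? (⊎-≡-dec _≟_ _≟_) _ _} _
  }
  where open import Data.Sum.Properties using () renaming (≡-dec to ⊎-≡-dec)

-- Here 0F and 1F are u and v. In `c₁` and `c₃`, 2F, 3F, 4F are the xᵢ and the far ends are the sᵢ.
-- In `c₂` and `c₄`, 2F is x₁, its far end is y₁ or w₁, and 3F, 4F are y₂, y₃ or w₂, w₃.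
c₁ c₂ c₃ c₄ : Rewiring K₂,₃
c₁ = record
  { nn = 4
  ; del = inj₁ 2F — inj₂ 0F ∷ inj₁ 3F — inj₂ 1F ∷ inj₁ 4F — inj₂ 2F ∷ []
  ; add = ● 2F — ★ 0F ∷ ● 3F — ★ 1F ∷ ● 4F — ★ 2F
        ∷ ★ 0F — ★ 3F ∷ ★ 1F — ★ 3F ∷ ★ 2F — ★ 3F
        ∷ ★ 0F — ◇ 0F ∷ ★ 1F — ◇ 1F ∷ ★ 2F — ◇ 2F ∷ []
  }
c₂ = record
  { nn = 2
  ; del = inj₁ 0F — inj₁ 3F ∷ inj₁ 0F — inj₁ 4F ∷ inj₁ 1F — inj₁ 3F ∷ inj₁ 1F — inj₁ 4F ∷ []
  ; add = ● 0F — ★ 0F ∷ ● 1F — ★ 0F ∷ ● 0F — ★ 1F ∷ ● 1F — ★ 1F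
        ∷ ★ 0F — ● 3F ∷ ★ 1F — ● 4F ∷ ● 3F — ● 4F ∷ []
  }
c₃ = record
  { nn = 6
  ; del = inj₁ 2F — inj₂ 0F ∷ inj₁ 3F — inj₂ 1F ∷ inj₁ 4F — inj₂ 2F ∷ []
  ; add = ● 2F — ★ 0F ∷ ● 3F — ★ 1F ∷ ● 4F — ★ 1F
        ∷ ★ 0F — ★ 2F ∷ ★ 0F — ★ 3F ∷ ★ 1F — ★ 4F
        ∷ ★ 5F — ★ 2F ∷ ★ 5F — ★ 3F ∷ ★ 5F — ★ 4F
        ∷ ★ 2F — ◇ 0F ∷ ★ 3F — ◇ 1F ∷ ★ 4F — ◇ 2F ∷ []
  }
c₄ = record
  { nn = 4
  ; del = inj₁ 2F — inj₂ 0F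
        ∷ inj₁ 0F — inj₁ 3F ∷ inj₁ 0F — inj₁ 4F ∷ inj₁ 1F — inj₁ 3F ∷ inj₁ 1F — inj₁ 4F ∷ []
  ; add = ● 0F — ★ 0F ∷ ● 1F — ★ 0F ∷ ● 0F — ★ 1F ∷ ● 1F — ★ 1F
        ∷ ★ 0F — ★ 3F ∷ ★ 1F — ★ 3F ∷ ● 2F — ★ 2F
        ∷ ★ 2F — ◇ 0F ∷ ★ 2F — ● 3F ∷ ★ 3F — ● 4F ∷ ● 3F — ● 4F ∷ []
  }

c₅ c₆ : Rewiring K₃,₃⁻
c₅ = record
  { nn = 2
  ; del = inj₁ 2F — inj₂ 0F ∷ inj₁ 5F — inj₂ 1F ∷ []
  ; add = ● 2F — ★ 0F ∷ ★ 0F — ◇ 0F ∷ ● 5F — ★ 1F ∷ ★ 1F — ◇ 1F ∷ ★ 0F — ★ 1F ∷ []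
  }
c₆ = record
  { nn = 2
  ; del = inj₁ 2F — inj₂ 0F ∷ inj₁ 5F — inj₂ 1F ∷ []
  ; add = ● 2F — ★ 0F ∷ ● 5F — ★ 0F ∷ ★ 0F — ★ 1F ∷ ★ 1F — ◇ 0F ∷ ★ 1F — ◇ 1F ∷ []
  }

-- A drawing of the result of a rewiring: m labelled vertices, the position π of
-- each vertex of the blob and of each new vertex, and a list of edges.  In the
-- layouts below the vertices are numbered as by absorb, the last one being 0F.
record Layout {bl} (rw : Rewiring bl) : Set where
  open Blob bl
  open Rewiring rw
  field
    m : ℕ
    π : Vec (Fin m) (k + nn)
    E : List (Edge (Fin m ⊎ Fin c))

  place : Core → Fin m
  place = lookup π ∘ join k nn

  place⁺ : Symbol⁺ → Fin m ⊎ Fin c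
  place⁺ (● b) = inj₁ (place (inj₁ b))
  place⁺ (◇ j) = inj₂ j
  place⁺ (★ i) = inj₁ (place (inj₂ i))

record Faithful {bl} {rw : Rewiring bl} (lay : Layout rw) : Set where
  open Rewiring rw
  open Layout lay
  field
    place-injective  : ∀ {a b} → place a ≡ place b → a ≡ b
    place-surjective : ∀ b → ∃[ a ] place a ≡ b
    drawn            : All (λ (a , b) → Joins E (place⁺ a) (place⁺ b)) rewired

module _ {bl} {rw : Rewiring bl} (lay : Layout rw) where
  open Blob bl
  open Rewiring rw
  open Layout lay

  private
    checks = all? (λ i → all? λ j → lookup π i ≟ lookup π j →-dec i ≟ j)
      ×-dec all? (λ b → any? λ i → lookup π i ≟ b)
      ×-dec All.all? (λ (a , b) → joins? (⊎-≡-dec _≟_ _≟_) E (place⁺ a) (place⁺ b)) rewired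

  faithful : True checks → Faithful lay
  faithful t with inj , surj , drawn ← toWitness {a? = checks} t = record
    { place-injective = λ {a} {b} eq →
        trans (sym (splitAt-join k nn a)) (trans (cong (splitAt k) (inj _ _ eq)) (splitAt-join k nn b))
    ; place-surjective = λ b → let i , eq = surj b in
        splitAt k i , trans (cong (lookup π) (join-splitAt k nn i)) eq
    ; drawn = drawn
    }

layout₁ : Layout c₁
layout₁ = record
  { m = 9
  ; π = 4F ∷ 5F ∷ 6F ∷ 7F ∷ 8F ∷ 3F ∷ 2F ∷ 1F ∷ 0F ∷ []
  ; E = map-edges inj₁
      (k₂,₃ 4F 5F 6F 7F 8F ++ 6F — 3F ∷ 7F — 2F ∷ 8F — 1F ∷ 3F — 0F ∷ 2F — 0F ∷ 1F — 0F ∷ [])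
      ++ inj₁ 3F — inj₂ 0F ∷ inj₁ 2F — inj₂ 1F ∷ inj₁ 1F — inj₂ 2F ∷ []
  }

-- The larger graph has the new vertices as its x₂ and x₃, while the x₂ and x₃ of the smaller graph
-- take the places of the two visited vertices 1F and 0F.
layout₂ : Layout c₂
layout₂ = record
  { m = 7
  ; π = 2F ∷ 3F ∷ 4F ∷ 1F ∷ 0F ∷ 5F ∷ 6F ∷ []
  ; E = map-edges inj₁ (k₂,₃ 2F 3F 4F 5F 6F ++ 5F — 1F ∷ 6F — 0F ∷ 1F — 0F ∷ [])
      ++ inj₁ 4F — inj₂ 0F ∷ inj₁ 1F — inj₂ 1F ∷ inj₁ 0F — inj₂ 2F ∷ []
  }

-- Drawn as K₃,₃ minus an edge with s, t, w₁, w₂, z visited after it. Its vertex 5F, here `#10`, is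
-- the y₂ of the step; s is y₁ and t is w₃.
layout₃ : Layout c₃
layout₃ = record
  { m = 11
  ; π = 5F ∷ 6F ∷ 7F ∷ 8F ∷ 9F ∷ 4F ∷ #10 ∷ 2F ∷ 1F ∷ 3F ∷ 0F ∷ []
  ; E = map-edges inj₁
      ( k₂,₃ 5F 6F 7F 8F 9F ++ 8F — #10 ∷ 9F — #10 ∷ 7F — 4F ∷ #10 — 3F
      ∷ 4F — 2F ∷ 4F — 1F ∷ 2F — 0F ∷ 1F — 0F ∷ 3F — 0F ∷ [])
      ++ inj₁ 2F — inj₂ 0F ∷ inj₁ 1F — inj₂ 1F ∷ inj₁ 3F — inj₂ 2F ∷ []
  }
  where
  #10 : Fin 11
  #10 = suc 9F

-- Drawn as K₃,₃ minus an edge with s, t, w visited after it. Its vertex 5F, here 8F, is the y₂ of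
-- the step, s is y₁, and w, t are w₂, w₃.
layout₄ : Layout c₄
layout₄ = record
  { m = 9
  ; π = 3F ∷ 4F ∷ 5F ∷ 0F ∷ 1F ∷ 6F ∷ 7F ∷ 2F ∷ 8F ∷ []
  ; E = map-edges inj₁
      ( k₂,₃ 3F 4F 5F 6F 7F ++ 6F — 8F ∷ 7F — 8F ∷ 5F — 2F ∷ 8F — 1F ∷ 2F — 0F ∷ 1F — 0F ∷ [])
      ++ inj₁ 2F — inj₂ 0F ∷ inj₁ 0F — inj₂ 1F ∷ inj₁ 1F — inj₂ 2F ∷ []
  }

layout₅ : Layout c₅
layout₅ = record
  { m = 8
  ; π = 2F ∷ 3F ∷ 4F ∷ 5F ∷ 6F ∷ 7F ∷ 1F ∷ 0F ∷ []
  ; E = map-edges inj₁ (k₂,₃ 2F 3F 4F 5F 6F ++ 5F — 7F ∷ 6F — 7F ∷ 4F — 1F ∷ 7F — 0F ∷ 1F — 0F ∷ [])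
      ++ inj₁ 1F — inj₂ 0F ∷ inj₁ 0F — inj₂ 1F ∷ []
  }

layout₆ : Layout c₆
layout₆ = record
  { m = 8
  ; π = 2F ∷ 3F ∷ 4F ∷ 5F ∷ 6F ∷ 7F ∷ 1F ∷ 0F ∷ []
  ; E = map-edges inj₁ (k₂,₃ 2F 3F 4F 5F 6F ++ 5F — 7F ∷ 6F — 7F ∷ 4F — 1F ∷ 7F — 1F ∷ 1F — 0F ∷ [])
      ++ inj₁ 0F — inj₂ 0F ∷ inj₁ 0F — inj₂ 1F ∷ []
  }

-- Grafts as inputs of the steps

module Step (G : Graph) (G-cubic : Cubic G) (bl : Blob)
            {U} {p s : Fin (Blob.c bl) → Graph.Vertex G} (fr : Frontier G U p s)
            (s-κ : ∀ {i j} → s i ≡ s j → Blob.κ bl i ≡ Blob.κ bl j) where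
  open Blob bl
  open Graft G G-cubic bl fr s-κ public using (graft; graft-cubic; φ; ψ; ⟦_⟧)
  open Graft G G-cubic bl fr s-κ using (cover; graft-symbols; graft-tails; graft-tails⁻; ⟦⟧-key)

  graft-realises : Realises G {Fin k} edges s U graft
  graft-realises = record
    { cov    = cover
    ; joined = All.tabulate λ {e} e∈ → graft-symbols {proj₁ e} {proj₂ e} (inj₁ e∈)
    ; tail⁺  = graft-tails
    ; tail⁻  = graft-tails⁻
    }

  module _ (rw : Rewiring bl) (rw-valid : Valid rw) (lay : Layout rw) (lay-faithful : Faithful lay)
           {H} (H-cubic : Cubic H) (real : Realises G (Layout.E lay) s U H) where
    open Rewiring rw
    open Layout lay
    open Faithful lay-faithful
    open Realises real
    private module S = Surgery G G-cubic bl rw rw-valid fr s-κ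

    replace : Replace graft nn (map-edges ⟦_⟧ del) (map-edges (Sum.map₁ ⟦_⟧) add) H
    replace = S.replace H-cubic (relabel place place-injective place-surjective cov)
      (All.map (λ {(a , b)} j → subst₂ (Adj H) (place-interp a) (place-interp b)
         (Joins-All {R = λ a b → Adj H (interp G cov s a) (interp G cov s b)} (Graph.sym H) joined
            {place⁺ a} {place⁺ b} j))
        drawn)
      tail⁺ tail⁻
      where
      place-interp : ∀ a → interp G cov s (place⁺ a) ≡
        S.interp⁺ (relabel place place-injective place-surjective cov) a
      place-interp (● b) = refl
      place-interp (◇ j) = refl
      place-interp (★ i) = refl

  private
    Separate : List Symbol → Set
    Separate = AllPairs (λ a b → key a ≢ key b)

    separate? : ∀ xs → Dec (Separate xs)
    separate? = allPairs? λ a b → ¬? (key a ≟ˢ key b)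

  unique : ∀ xs → True (separate? xs) → Unique (List.map ⟦_⟧ xs)
  unique xs t = AllPairs.map⁺ (AllPairs.map (λ {a} {b} k≢ eq → k≢ (⟦⟧-key {a} {b} eq)) (toWitness t))

  edges-hold : Edges graft (map-edges ⟦_⟧ edges)
  edges-hold = All.map⁺ (All.tabulate λ {e} e∈ → graft-symbols {proj₁ e} {proj₂ e} (inj₁ e∈))

  port-outside : ∀ j (bs : List (Fin k)) → ψ (s j) L.∉ List.map φ bs
  port-outside j bs s∈bs with b , _ , eq ← ∈-map⁻ φ s∈bs =
    Cover.disjoint cover (Frontier.s∈ fr j) (sym eq)

module _ {G : Graph} {G-cubic : Cubic G} {U : Subset (Graph.order G)}
         {p s : Fin 3 → Graph.Vertex G} (fr : Frontier G U p s) where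
  private
    core : List (Fin 5)
    core = 0F ∷ 1F ∷ 2F ∷ 3F ∷ 4F ∷ []

  open Step G G-cubic K₂,₃ fr (λ _ → refl)

  config₁₃ : Config₁₃ graft (φ 0F) (φ 1F) (φ 2F) (φ 3F) (φ 4F) (ψ (s 0F)) (ψ (s 1F)) (ψ (s 2F))
  config₁₃ = record
    { distinct = unique (List.map inj₁ core) _
    ; edges    = edges-hold
    ; outside  = port-outside 0F core ∷ port-outside 1F core ∷ port-outside 2F core ∷ []
    }

  config₂₄ : Config₂₄ graft (φ 0F) (φ 1F) (φ 2F) (ψ (s 0F)) (φ 3F) (φ 4F)
  config₂₄ = record
    { distinct = unique (inj₁ 0F ∷ inj₁ 1F ∷ inj₁ 2F ∷ inj₂ 0F ∷ inj₁ 3F ∷ inj₁ 4F ∷ []) _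
    ; edges    = All.++⁺ (All.++⁻ˡ (k₂,₃ _ _ _ _ _) edges-hold)
                         (All.head (All.++⁻ʳ (k₂,₃ _ _ _ _ _) edges-hold) ∷ [])
    }

  module _ {H} (H-cubic : Cubic H) where
    step₁ : Realises G (Layout.E layout₁) s U H → C₁ graft H
    step₁ real = C₁.step _ _ _ _ _ _ _ _ config₁₃
      (replace c₁ (valid c₁ _) layout₁ (faithful layout₁ _) H-cubic real)

    step₂ : Realises G (Layout.E layout₂) s U H → C₂ graft H
    step₂ real = C₂.step _ _ _ _ _ _ config₂₄
      (replace c₂ (valid c₂ _) layout₂ (faithful layout₂ _) H-cubic real)

    step₃ : Realises G (Layout.E layout₃) s U H → C₃ graft H
    step₃ real = C₃.step _ _ _ _ _ _ _ _ config₁₃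
      (replace c₃ (valid c₃ _) layout₃ (faithful layout₃ _) H-cubic real)

    step₄ : Realises G (Layout.E layout₄) s U H → C₄ graft H
    step₄ real = C₄.step _ _ _ _ _ _ config₂₄
      (replace c₄ (valid c₄ _) layout₄ (faithful layout₄ _) H-cubic real)

module _ {G : Graph} {G-cubic : Cubic G} {U : Subset (Graph.order G)}
         {p s : Fin 2 → Graph.Vertex G} (fr : Frontier G U p s)
         (s-inj : ∀ {i j} → s i ≡ s j → i ≡ j) where
  open Step G G-cubic K₃,₃⁻ fr s-inj

  config₅₆ : Config₅₆ graft (φ 0F) (φ 1F) (φ 2F) (φ 3F) (φ 4F) (φ 5F) (ψ (s 0F)) (ψ (s 1F))
  config₅₆ = record
    { distinct = unique (List.map inj₁ (0F ∷ 1F ∷ 2F ∷ 3F ∷ 4F ∷ 5F ∷ []) ++ inj₂ 0F ∷ inj₂ 1F ∷ []) _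
    ; edges    = edges-hold
    }

  module _ {H} (H-cubic : Cubic H) where
    step₅ : Realises G (Layout.E layout₅) s U H → C₅ graft H
    step₅ real = C₅.step _ _ _ _ _ _ _ _ config₅₆
      (replace c₅ (valid c₅ _) layout₅ (faithful layout₅ _) H-cubic real)

    step₆ : Realises G (Layout.E layout₆) s U H → C₆ graft H
    step₆ real = C₆.step _ _ _ _ _ _ _ _ config₅₆
      (replace c₆ (valid c₆ _) layout₆ (faithful layout₆ _) H-cubic real)

-- From path-decompositions to orders of visits

unique⇒length≤ : ∀ {p : Subset n} {xs} → Unique xs → All (_∈ p) xs → length xs ≤ ∣ p ∣
unique⇒length≤ [] [] = z≤n
unique⇒length≤ {p = p} (x∉ ∷ u) (x∈ ∷ xs∈) = subst (_ ≤_) (sym (∣p∣≡1+∣p-x∣ x∈))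
  (s≤s (unique⇒length≤ u (All.zipWith (λ (y∈ , x≢y) → x∈p∧x≢y⇒x∈p-y y∈ (x≢y ∘ sym)) (xs∈ , x∉))))

least : {P : Fin n → Set} → Decidable₁ P → ∃[ i ] P i → ∃[ i ] (P i × (∀ j → P j → i Fin.≤ j))
least {suc n} P? (i , Pi) with P? zero
... | yes P0 = zero , P0 , λ _ _ → z≤n
least {suc n} P? (zero , Pi) | no ¬P0 = contradiction Pi ¬P0
least {suc n} P? (suc i , Pi) | no ¬P0 with j , Pj , min ← least (P? ∘ suc) (i , Pi) =
  suc j , Pj , λ { zero P0 → contradiction P0 ¬P0 ; (suc k) Pk → s≤s (min k Pk) }

minimiser : ∀ k {U : Subset n} → ∣ U ∣ ≡ suc k → (f : Fin n → ℕ) →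
            ∃[ v ] (v ∈ U × (∀ {y} → y ∈ U → f v ≤ f y))
minimiser k {U} eq f with x , x∈ , eq′ ← ∣p∣≡1+k⇒∃ eq = go k eq′
  where
  only-x : ∣ U - x ∣ ≡ 0 → ∀ {y} → y ∈ U → y ≡ x
  only-x e {y} y∈ with y ≟ x
  ... | yes y≡x = y≡x
  ... | no  y≢x = contradiction (x∈p∧x≢y⇒x∈p-y y∈ y≢x) (∣p∣≡0⇒x∉p e)
  go : ∀ k → ∣ U - x ∣ ≡ k → ∃[ v ] (v ∈ U × (∀ {y} → y ∈ U → f v ≤ f y))
  go zero e = x , x∈ , λ y∈ → ≤-reflexive (cong f (sym (only-x e y∈)))
  go (suc k) e with v , v∈ , min ← minimiser k e f with ≤-total (f x) (f v)
  ... | inj₁ fx≤fv = x , x∈ , λ {y} y∈ → case y ≟ x of λ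
          { (yes refl) → ≤-refl ; (no y≢x) → ≤-trans fx≤fv (min (x∈p∧x≢y⇒x∈p-y y∈ y≢x)) }
  ... | inj₂ fv≤fx = v , proj₁ (∈-remove⁻ v∈) , λ {y} y∈ → case y ≟ x of λ
          { (yes refl) → fv≤fx ; (no y≢x) → min (x∈p∧x≢y⇒x∈p-y y∈ y≢x) }

≤-maximum : (f : Fin n → ℕ) → ∀ i → f i ≤ Vector.foldr _⊔_ 0 f
≤-maximum f zero    = m≤m⊔n _ _
≤-maximum f (suc i) = ≤-trans (≤-maximum (f ∘ suc) i) (m≤n⊔m (f zero) _)

module _ (G : Graph) where
  open Graph G using (order; adj?) renaming (Vertex to V; Adj to _~_)

  -- The vertices outside U have been visited.
  Boundary : Subset order → V → Set
  Boundary U x = x ∉ U × ∃[ y ] (y ∈ U × x ~ y)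

  -- Phrased through four explicit vertices, because each contradiction below is reached by
  -- exhibiting them.
  Narrow : Subset order → Set
  Narrow U = ∀ {a b c d} → Unique (a ∷ b ∷ c ∷ d ∷ []) → ¬ All (Boundary U) (a ∷ b ∷ c ∷ d ∷ [])

  -- No trace of the bags is kept. Since `Narrow` depends only on the set of visited vertices,
  -- visits may be reordered as soon as the intermediate sets are narrow. The index is the measure
  -- of the later inductions.
  data Sweep : ℕ → Subset order → Set where
    done  : ∀ {U} → (∀ x → x ∉ U) → Sweep 0 U
    visit : ∀ {k U v} → v ∈ U → Narrow (U - v) → Sweep k (U - v) → Sweep (suc k) U

  boundary? : ∀ U x → Dec (Boundary U x)
  boundary? U x = ¬? (x ∈? U) ×-dec any? λ y → (y ∈? U) ×-dec adj? x y

  -- Visiting the vertices in the order in which they first occur in the bags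
  -- keeps the boundary inside the first bag of the next vertex.
  module _ (P : PathDecomposition G) (width≤3 : PathDecomposition.width P ≤ 3) where
    open PathDecomposition P

    private
      bag≤4 : ∀ i → ∣ bag i ∣ ≤ 4
      bag≤4 i = go (≤-maximum (λ i → ∣ bag i ∣) i) width≤3
        where
        go : ∀ {b m} → b ≤ m → m ∸ 1 ≤ 3 → b ≤ 4
        go {m = zero}  b≤m _   = ≤-trans b≤m z≤n
        go {m = suc m} b≤m m≤3 = ≤-trans b≤m (s≤s m≤3)

      first-bag : ∀ x → ∃[ i ] (x ∈ bag i × (∀ j → x ∈ bag j → i Fin.≤ j))
      first-bag x = least (λ i → x ∈? bag i) (vertices x)

      first : V → Fin #bags
      first = proj₁ ∘ first-bag

      Initial : Subset order → Set
      Initial U = ∀ {x y} → x ∉ U → y ∈ U → first x Fin.≤ first y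

      -- Let v be the next vertex. A boundary vertex x occurs no later than v for the first time,
      -- and meets an unvisited neighbour in a bag no earlier than the first bag of v; so x is in
      -- that bag. The bag has at most four elements, and v itself, being unvisited, is one that is
      -- not on the boundary.
      initial⇒narrow : ∀ {U} → Initial U → Narrow U
      initial⇒narrow {U} initial {a} {b} {c} {d} distinct bs@((_ , y , y∈ , _) ∷ _)
        with ∣ U ∣ in eq
      ... | zero  = ∣p∣≡0⇒x∉p eq y∈
      ... | suc k with v , v∈ , min ← minimiser k eq (toℕ ∘ first) =
        case ≤-trans (unique⇒length≤ (All.map (fresh v∈) bs ∷ distinct)
                        (proj₁ (proj₂ (first-bag v)) ∷ All.map (in-bag v v∈ min) bs))
                     (bag≤4 (first v)) of λ { (s≤s (s≤s (s≤s (s≤s ())))) }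
        where
        fresh : ∀ {v x} → v ∈ U → Boundary U x → v ≢ x
        fresh v∈ (x∉ , _) refl = x∉ v∈
        in-bag : ∀ v → v ∈ U → (∀ {y} → y ∈ U → first v Fin.≤ first y) → ∀ {x} → Boundary U x → x ∈ bag (first v)
        in-bag v v∈ min {x} (x∉ , y , y∈ , x~y) with i , x∈i , y∈i ← edges x y x~y =
          interval x (first x) (first v) i (initial x∉ v∈)
            (≤-trans (min y∈) (proj₂ (proj₂ (first-bag y)) i y∈i)) (proj₁ (proj₂ (first-bag x))) x∈i

    sweep : ∀ k {U} → ∣ U ∣ ≡ k → Initial U → Sweep k U
    sweep zero eq _ = done λ x → ∣p∣≡0⇒x∉p eq
    sweep (suc k) {U} eq initial with v , v∈ , min ← minimiser k eq (toℕ ∘ first) =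
      visit v∈ (initial⇒narrow initial′) (sweep k (cong pred (trans (sym (∣p∣≡1+∣p-x∣ v∈)) eq)) initial′)
      where
      initial′ : Initial (U - v)
      initial′ x∉ y∈ = case ∉-remove⁻ x∉ of λ
        { (inj₁ x∉U) → initial x∉U (proj₁ (∈-remove⁻ y∈))
        ; (inj₂ refl) → min (proj₁ (∈-remove⁻ y∈)) }

  -- Counting visited neighbours and postponing visits

  module _ (cubic : Cubic G) where
    neighbours₃ : ∀ x → ∃[ a ] ∃[ b ] ∃[ c ] IsTriple (x ~_) a b c
    neighbours₃ x = degree-triple G (cubic x)

    ~⇒≢ : ∀ {x y} → x ~ y → x ≢ y
    ~⇒≢ x~y x≡y = Graph.irrefl G x≡y x~y

    -- Of three different neighbours at most two can be among `e₁` and `e₂`, so one is unvisited.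
    -- This is the usual source of boundary vertices; `e₁` and `e₂` may coincide.
    few-visited : ∀ {U x e₁ e₂} → x ∉ U → (∀ {y} → x ~ y → y ∉ U → y ≡ e₁ ⊎ y ≡ e₂) → Boundary U x
    few-visited {U} {x} x∉ few with a , b , c , triple a≢b a≢c b≢c x~a x~b x~c _ ← neighbours₃ x
      with a ∈? U | b ∈? U | c ∈? U
    ... | yes a∈ | _ | _ = x∉ , a , a∈ , x~a
    ... | no _ | yes b∈ | _ = x∉ , b , b∈ , x~b
    ... | no _ | no _ | yes c∈ = x∉ , c , c∈ , x~c
    ... | no a∉ | no b∉ | no c∉ with few x~a a∉ | few x~b b∉ | few x~c c∉
    ...   | inj₁ refl | inj₁ refl | _         = contradiction refl a≢b
    ...   | inj₁ refl | inj₂ refl | inj₁ refl = contradiction refl a≢c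
    ...   | inj₁ refl | inj₂ refl | inj₂ refl = contradiction refl b≢c
    ...   | inj₂ refl | inj₁ refl | inj₁ refl = contradiction refl b≢c
    ...   | inj₂ refl | inj₁ refl | inj₂ refl = contradiction refl a≢c
    ...   | inj₂ refl | inj₂ refl | _         = contradiction refl a≢b

    -- If one of `a`, `b`, `c` were not adjacent to `x`, the other two would be its only possible
    -- visited neighbours, and `few-visited` would put `x` on the boundary.
    saturates : ∀ {U x a b c} → x ∉ U → ¬ Boundary U x →
                (∀ {y} → x ~ y → y ∉ U → y ≡ a ⊎ y ≡ b ⊎ y ≡ c) → x ~ a × x ~ b × x ~ c
    saturates {x = x} {a} {b} {c} x∉ ¬bx seen = x~a , x~b , x~c
      where
      x~a : x ~ a
      x~a = decidable-stable (adj? x a) λ ≁ → ¬bx (few-visited x∉ λ e y∉ → case seen e y∉ of λ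
        { (inj₁ refl) → contradiction e ≁ ; (inj₂ (inj₁ eq)) → inj₁ eq ; (inj₂ (inj₂ eq)) → inj₂ eq })
      x~b : x ~ b
      x~b = decidable-stable (adj? x b) λ ≁ → ¬bx (few-visited x∉ λ e y∉ → case seen e y∉ of λ
        { (inj₁ eq) → inj₁ eq ; (inj₂ (inj₁ refl)) → contradiction e ≁ ; (inj₂ (inj₂ eq)) → inj₂ eq })
      x~c : x ~ c
      x~c = decidable-stable (adj? x c) λ ≁ → ¬bx (few-visited x∉ λ e y∉ → case seen e y∉ of λ
        { (inj₁ eq) → inj₁ eq ; (inj₂ (inj₁ eq)) → inj₂ eq ; (inj₂ (inj₂ refl)) → contradiction e ≁ })

    data Advance : ℕ → Subset order → Set where
      advance : ∀ {k U x v} → v ∈ U → x ∉ U → x ~ v → Narrow (U - v) → Sweep k (U - v) → Advance (suc k) U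

    private
      variable
        U : Subset order
        a b c d v v₁ v₂ v₃ : V

      avoid₃ : Unique (a ∷ b ∷ c ∷ []) → {P : V → Set} → All P (a ∷ b ∷ c ∷ []) → ∀ v →
               ∃[ x ] ∃[ y ] (x ≢ y × (P x × x ≢ v) × (P y × y ≢ v))
      avoid₃ {a} {b} {c} ((a≢b ∷ a≢c ∷ []) ∷ (b≢c ∷ []) ∷ [] ∷ []) (pa ∷ pb ∷ pc ∷ []) v
        with a ≟ v | b ≟ v
      ... | yes refl | _        = b , c , b≢c , (pb , a≢b ∘ sym) , (pc , a≢c ∘ sym)
      ... | no a≢v   | yes refl = a , c , a≢c , (pa , a≢v) , (pc , b≢c ∘ sym)
      ... | no a≢v   | no b≢v   = a , b , a≢b , (pa , a≢v) , (pb , b≢v)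

      avoid₄ : Unique (a ∷ b ∷ c ∷ d ∷ []) → {P : V → Set} → All P (a ∷ b ∷ c ∷ d ∷ []) → ∀ v →
               ∃[ x ] ∃[ y ] ∃[ z ] (Unique (x ∷ y ∷ z ∷ []) × All (λ x → P x × x ≢ v) (x ∷ y ∷ z ∷ []))
      avoid₄ {a} {b} {c} {d} ((ab ∷ ac ∷ ad ∷ []) ∷ (bc ∷ bd ∷ []) ∷ (cd ∷ []) ∷ [] ∷ [])
             (pa ∷ pb ∷ pc ∷ pd ∷ []) v
        with a ≟ v | b ≟ v | c ≟ v
      ... | yes refl | _ | _ = b , c , d , (bc ∷ bd ∷ []) ∷ (cd ∷ []) ∷ [] ∷ [] ,
              (pb , ab ∘ sym) ∷ (pc , ac ∘ sym) ∷ (pd , ad ∘ sym) ∷ []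
      ... | no a≢v | yes refl | _ = a , c , d , (ac ∷ ad ∷ []) ∷ (cd ∷ []) ∷ [] ∷ [] ,
              (pa , a≢v) ∷ (pc , bc ∘ sym) ∷ (pd , bd ∘ sym) ∷ []
      ... | no a≢v | no b≢v | yes refl = a , b , d , (ab ∷ ad ∷ []) ∷ (bd ∷ []) ∷ [] ∷ [] ,
              (pa , a≢v) ∷ (pb , b≢v) ∷ (pd , cd ∘ sym) ∷ []
      ... | no a≢v | no b≢v | no c≢v = a , b , c , (ab ∷ ac ∷ []) ∷ (bc ∷ []) ∷ [] ∷ [] ,
              (pa , a≢v) ∷ (pb , b≢v) ∷ (pc , c≢v) ∷ []

      Isolated : Subset order → V → Set
      Isolated U v = ∀ {x} → x ∉ U → ¬ (x ~ v)

      attached? : ∀ U v → (∃[ x ] (x ∉ U × x ~ v)) ⊎ Isolated U v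
      attached? U v with any? (λ x → ¬? (x ∈? U) ×-dec adj? x v)
      ... | yes att = inj₁ att
      ... | no ¬att = inj₂ λ x∉ x~v → ¬att (_ , x∉ , x~v)

      _−_ : ∀ {x} → x ∈ U → x ≢ v → x ∈ U - v
      _−_ = x∈p∧x≢y⇒x∈p-y

      keep : ¬ (a ~ v) → Boundary U a → Boundary (U - v) a
      keep a≁v (a∉ , y , y∈ , a~y) = ∉⇒∉- a∉ , y , y∈ − (λ { refl → a≁v a~y }) , a~y

      stay : Isolated U v → Boundary U a → Boundary (U - v) a
      stay iso b = keep (iso (proj₁ b)) b

      stay₂ : Isolated U v₁ → Isolated U v₂ → Boundary U a → Boundary (U - v₁ - v₂) a
      stay₂ iso₁ iso₂ b = keep (iso₂ (proj₁ b)) (stay iso₁ b)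

      nowhere-left : ∀ {U} → (∀ x → x ∉ U) → ¬ Boundary U a
      nowhere-left full (_ , y , y∈ , _) = full y y∈

      shrink : ∀ {x} → x ≢ v → Boundary (U - v) x → Boundary U x
      shrink x≢v (x∉ , y , y∈ , x~y) =
        [ id , (λ eq → contradiction eq x≢v) ]′ (∉-remove⁻ x∉) , y , proj₁ (∈-remove⁻ y∈) , x~y

      ∈≢∉ : ∀ {x} → v ∈ U → x ∉ U → v ≢ x
      ∈≢∉ v∈ x∉ refl = x∉ v∈

      -- Two isolated visits and two old boundary vertices already make four.
      crowded : Isolated U v₁ → Isolated U v₂ → v₁ ∈ U → v₂ ∈ U - v₁ → Narrow (U - v₁ - v₂) →
                ∀ {x y} → x ≢ y → Boundary U x → Boundary U y → ⊥
      crowded {U} {v₁} {v₂} iso₁ iso₂ v₁∈ v₂∈ narrow {x} {y} x≢y bx by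
        with v₂∈U , v₂≢v₁ ← ∈-remove⁻ v₂∈ =
        narrow ((v₂≢v₁ ∘ sym ∷ ∈≢∉ v₁∈ (proj₁ bx) ∷ ∈≢∉ v₁∈ (proj₁ by) ∷ [])
                ∷ (∈≢∉ v₂∈U (proj₁ bx) ∷ ∈≢∉ v₂∈U (proj₁ by) ∷ []) ∷ (x≢y ∷ []) ∷ [] ∷ [])
          ( few-visited (∉⇒∉- (x∉p-x {p = U})) (visited iso₁)
          ∷ few-visited (x∉p-x {p = U - v₁}) (visited iso₂)
          ∷ stay₂ iso₁ iso₂ bx ∷ stay₂ iso₁ iso₂ by ∷ [])
        where
        visited : ∀ {v} → Isolated U v → ∀ {y} → v ~ y → y ∉ U - v₁ - v₂ → y ≡ v₁ ⊎ y ≡ v₂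
        visited iso v~y y∉ with ∉-remove⁻ y∉
        ... | inj₂ y≡v₂ = inj₂ y≡v₂
        ... | inj₁ y∉′ with ∉-remove⁻ y∉′
        ...   | inj₂ y≡v₁ = inj₁ y≡v₁
        ...   | inj₁ y∉U = contradiction (Graph.sym G v~y) (iso y∉U)

      Sweep-swap : ∀ {k} U v w → Sweep k (U - v - w) → Sweep k (U - w - v)
      Sweep-swap U v w = subst (Sweep _) (p─x─y≡p─y─x U v w)

      Narrow-swap : ∀ U v w → Narrow (U - v - w) → Narrow (U - w - v)
      Narrow-swap U v w = subst Narrow (p─x─y≡p─y─x U v w)

      -- Each of the three can have only the other two as visited neighbours and so lies on the
      -- boundary; the old boundary vertex is adjacent to none of them and stays there as the
      -- fourth. Hence at most two unattached visits follow each other.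
      crowded₃ : Isolated U v₁ → Isolated U v₂ → Isolated U v₃ → v₁ ∈ U → v₂ ∈ U - v₁ → v₃ ∈ U - v₁ - v₂ →
                 Narrow (U - v₁ - v₂ - v₃) → ¬ Boundary U a
      crowded₃ {U} {v₁} {v₂} {v₃} iso₁ iso₂ iso₃ v₁∈ v₂∈ v₃∈ narrow ba
        with v₃∈′ , v₃≢v₂ ← ∈-remove⁻ v₃∈ with v₃∈U , v₃≢v₁ ← ∈-remove⁻ v₃∈′
        with v₂∈U , v₂≢v₁ ← ∈-remove⁻ v₂∈ =
        narrow ((v₂≢v₁ ∘ sym ∷ v₃≢v₁ ∘ sym ∷ ∈≢∉ v₁∈ (proj₁ ba) ∷ [])
               ∷ (v₃≢v₂ ∘ sym ∷ ∈≢∉ v₂∈U (proj₁ ba) ∷ []) ∷ (∈≢∉ v₃∈U (proj₁ ba) ∷ []) ∷ [] ∷ [])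
          ( few-visited (∉⇒∉- (∉⇒∉- (x∉p-x {p = U}))) (λ e y∉ → case visited iso₁ e y∉ of λ
              { (inj₁ y≡v₁) → contradiction (sym y≡v₁) (~⇒≢ e) ; (inj₂ y≡) → y≡ })
          ∷ few-visited (∉⇒∉- (x∉p-x {p = U - v₁})) (λ e y∉ → case visited iso₂ e y∉ of λ
              { (inj₁ y≡v₁) → inj₁ y≡v₁ ; (inj₂ (inj₁ y≡v₂)) → contradiction (sym y≡v₂) (~⇒≢ e)
              ; (inj₂ (inj₂ y≡v₃)) → inj₂ y≡v₃ })
          ∷ few-visited (x∉p-x {p = U - v₁ - v₂}) (λ e y∉ → case visited iso₃ e y∉ of λ
              { (inj₁ y≡v₁) → inj₁ y≡v₁ ; (inj₂ (inj₁ y≡v₂)) → inj₂ y≡v₂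
              ; (inj₂ (inj₂ y≡v₃)) → contradiction (sym y≡v₃) (~⇒≢ e) })
          ∷ keep (iso₃ (proj₁ ba)) (stay₂ iso₁ iso₂ ba) ∷ [])
        where
        visited : ∀ {v} → Isolated U v → ∀ {y} → v ~ y → y ∉ U - v₁ - v₂ - v₃ → y ≡ v₁ ⊎ y ≡ v₂ ⊎ y ≡ v₃
        visited iso v~y y∉ with ∉-remove⁻ y∉
        ... | inj₂ y≡v₃ = inj₂ (inj₂ y≡v₃)
        ... | inj₁ y∉′ with ∉-remove⁻ y∉′
        ...   | inj₂ y≡v₂ = inj₂ (inj₁ y≡v₂)
        ...   | inj₁ y∉″ with ∉-remove⁻ y∉″
        ...     | inj₂ y≡v₁ = inj₁ y≡v₁
        ...     | inj₁ y∉U = contradiction (Graph.sym G v~y) (iso y∉U)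

      -- By `crowded` the old boundary has at most one vertex. Moving the attached v₃ to the front
      -- thus gives at most two boundary vertices after v₃ and three after v₃, v₁; after all three
      -- visits the set is the same as before.
      advancing₂ : ∀ {k} → Isolated U v₁ → Isolated U v₂ → v₁ ∈ U → v₂ ∈ U - v₁ → Narrow (U - v₁ - v₂) →
                   Sweep k (U - v₁ - v₂) → Boundary U a → Advance (suc (suc k)) U
      advancing₂ iso₁ iso₂ _ _ _ (done full) ba = contradiction (stay₂ iso₁ iso₂ ba) (nowhere-left full)
      advancing₂ {U} {v₁} {v₂} iso₁ iso₂ v₁∈ v₂∈ n₂ (visit {v = v₃} v₃∈ n₃ s₃) ba with attached? U v₃
      ... | inj₂ iso₃ = contradiction ba (crowded₃ iso₁ iso₂ iso₃ v₁∈ v₂∈ v₃∈ n₃)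
      ... | inj₁ (_ , x∉ , x~v₃)
        with v₃∈′ , v₃≢v₂ ← ∈-remove⁻ v₃∈ with v₃∈U , v₃≢v₁ ← ∈-remove⁻ v₃∈′
        with v₂∈U , v₂≢v₁ ← ∈-remove⁻ v₂∈ =
        advance v₃∈U x∉ x~v₃ narrow
          (visit (v₁∈ − (v₃≢v₁ ∘ sym)) narrow′
            (visit ((v₂∈U − (v₃≢v₂ ∘ sym)) − v₂≢v₁) (subst Narrow reorder n₃) (subst (Sweep _) reorder s₃)))
        where
        reorder : U - v₁ - v₂ - v₃ ≡ U - v₃ - v₁ - v₂
        reorder = trans (p─x─y≡p─y─x (U - v₁) v₂ v₃) (cong (_- v₂) (p─x─y≡p─y─x U v₁ v₃))
        narrow : Narrow (U - v₃)
        narrow distinct bs with avoid₄ distinct bs v₃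
        ... | _ , _ , _ , (x≢y ∷ _) ∷ _ , (bx , x≢) ∷ (by , y≢) ∷ _ =
          crowded iso₁ iso₂ v₁∈ v₂∈ n₂ x≢y (shrink x≢ bx) (shrink y≢ by)
        narrow′ : Narrow (U - v₃ - v₁)
        narrow′ distinct bs with _ , _ , _ , xyz , bxyz ← avoid₄ distinct bs v₁
          with _ , _ , x≢y , ((bx , x≢v₁) , x≢v₃) , ((by , y≢v₁) , y≢v₃) ← avoid₃ xyz bxyz v₃
          = crowded iso₁ iso₂ v₁∈ v₂∈ n₂ x≢y (shrink x≢v₃ (shrink x≢v₁ bx)) (shrink y≢v₃ (shrink y≢v₁ by))

      -- Four boundary vertices after visiting v₂ alone would include three old ones. These remain
      -- on the boundary after visiting v₁ alone, being not adjacent to it, and v₁, without visited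
      -- neighbours, would be the fourth.
      advancing₁ : ∀ {k} → Isolated U v₁ → v₁ ∈ U → Narrow (U - v₁) → Sweep k (U - v₁) →
                   Boundary U a → Advance (suc k) U
      advancing₁ iso₁ _ _ (done full) ba = contradiction (stay iso₁ ba) (nowhere-left full)
      advancing₁ {U} {v₁} iso₁ v₁∈ n₁ (visit {v = v₂} v₂∈ n₂ s₂) ba with attached? U v₂
      ... | inj₂ iso₂ = advancing₂ iso₁ iso₂ v₁∈ v₂∈ n₂ s₂ ba
      ... | inj₁ (_ , x∉ , x~v₂) with v₂∈U , v₂≢v₁ ← ∈-remove⁻ v₂∈ =
        advance v₂∈U x∉ x~v₂ narrow
          (visit (v₁∈ − (v₂≢v₁ ∘ sym)) (Narrow-swap U v₁ v₂ n₂) (Sweep-swap U v₁ v₂ s₂))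
        where
        v₁-boundary : Boundary (U - v₁) v₁
        v₁-boundary = few-visited {e₁ = v₁} {e₂ = v₁} (x∉p-x {p = U}) λ v₁~y y∉ →
          [ (λ y∉U → contradiction (Graph.sym G v₁~y) (iso₁ y∉U)) , inj₁ ]′ (∉-remove⁻ y∉)
        narrow : Narrow (U - v₂)
        narrow distinct bs
          with x , y , z , xyz , bxyz ← avoid₄ distinct bs v₂
          with bs′ ← All.map (λ (b , x≢v₂) → shrink x≢v₂ b) bxyz
          = n₁ (All.map (∈≢∉ v₁∈ ∘ proj₁) bs′ ∷ xyz) (v₁-boundary ∷ All.map (stay iso₁) bs′)

    -- An unattached visit can be postponed until after the next attached one.
    advancing : ∀ {k} → Sweep k U → Boundary U a → Advance k U
    advancing (done full) ba = contradiction ba (nowhere-left full)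
    advancing {U = U} (visit {v = v} v∈ n s) ba with attached? U v
    ... | inj₁ (_ , x∉ , x~v) = advance v∈ x∉ x~v n s
    ... | inj₂ iso = advancing₁ iso v∈ n s ba

extend : ∀ {Step : Rel Graph 0ℓ} {G H} →
         Step G H → ConstructibleFromK₃,₃By Step G → ConstructibleFromK₃,₃By Step H
extend s (G₀ , iso , steps) = G₀ , iso , steps ◅◅ (s ◅ ε)

-- Three edges into the unvisited set

module ThreePorts (G : Graph) (cubic : Cubic G)
                (triangle-free : ∀ {a b c} → Adj G a b → Adj G b c → Adj G c a → ⊥) where
  open Graph G using (order; adj?) renaming (Vertex to V; Adj to _~_; sym to ~-sym)

  private variable
    k j : ℕ
    U : Subset order
    p₁ p₂ p₃ s₁ s₂ s₃ a b c v w x y : V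
    H : Graph

  abstract
    neighbours₁ : x ~ a → ∃[ b ] ∃[ c ] IsTriple (x ~_) a b c
    neighbours₁ {x} x~a with _ , _ , _ , t ← neighbours₃ G cubic x = with-first t x~a

    neighbours₂ : x ~ a → x ~ b → a ≢ b → ∃[ c ] IsTriple (x ~_) a b c
    neighbours₂ x~a x~b a≢b with _ , _ , t ← neighbours₁ x~a = with-second t x~b (a≢b ∘ sym)

    neighbours₃-are : x ~ a → x ~ b → x ~ c → a ≢ b → a ≢ c → b ≢ c → IsTriple (x ~_) a b c
    neighbours₃-are {x} {a} {b} x~a x~b x~c a≢b a≢c b≢c =
      let _ , t = neighbours₂ x~a x~b a≢b
      in subst (IsTriple (x ~_) a b) (sym (with-third t x~c (a≢c ∘ sym) (b≢c ∘ sym))) t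

  ~-irrefl : ¬ x ~ x
  ~-irrefl = Graph.irrefl G refl

  Crosses : Subset order → List (V × V) → Set
  Crosses U es = ∀ {x y} → x ∉ U → y ∈ U → x ~ y → (x , y) L.∈ es

  -- The list has to contain all crossing edges but may contain others, so a visit simply adds the
  -- three edges at `v`. Entries whose far end has been visited are removed by `prune`.
  crosses-visit : ∀ {es} → Crosses U es → IsTriple (v ~_) a b c →
                  Crosses (U - v) ((v , a) ∷ (v , b) ∷ (v , c) ∷ es)
  crosses-visit cr t x∉ y∈ x~y with ∉-remove⁻ x∉
  ... | inj₁ x∉U = there (there (there (cr x∉U (proj₁ (∈-remove⁻ y∈)) x~y)))
  ... | inj₂ refl with IsTriple.only t x~y
  ...   | inj₁ refl        = here refl
  ...   | inj₂ (inj₁ refl) = at₁ refl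
  ...   | inj₂ (inj₂ refl) = at₂ refl

  prune : ∀ {es fs} → Crosses U es → All (λ e → proj₂ e ∈ U → e L.∈ fs) es → Crosses U fs
  prune cr all x∉ y∈ x~y = All.lookup all (cr x∉ y∈ x~y) y∈

  record Cut₃ (U : Subset order) (p₁ p₂ p₃ s₁ s₂ s₃ : V) : Set where
    field
      p₁∉ : p₁ ∉ U
      p₂∉ : p₂ ∉ U
      p₃∉ : p₃ ∉ U
      s₁∈ : s₁ ∈ U
      s₂∈ : s₂ ∈ U
      s₃∈ : s₃ ∈ U
      e₁  : p₁ ~ s₁
      e₂  : p₂ ~ s₂
      e₃  : p₃ ~ s₃
      p₁≢p₂ : p₁ ≢ p₂
      p₁≢p₃ : p₁ ≢ p₃
      p₂≢p₃ : p₂ ≢ p₃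
      crosses : Crosses U ((p₁ , s₁) ∷ (p₂ , s₂) ∷ (p₃ , s₃) ∷ [])

    frontier : Frontier G U (lookup (p₁ ∷ p₂ ∷ p₃ ∷ [])) (lookup (s₁ ∷ s₂ ∷ s₃ ∷ []))
    frontier = record
      { p∉  = λ { 0F → p₁∉ ; 1F → p₂∉ ; 2F → p₃∉ }
      ; s∈  = λ { 0F → s₁∈ ; 1F → s₂∈ ; 2F → s₃∈ }
      ; p~s = λ { 0F → e₁ ; 1F → e₂ ; 2F → e₃ }
      ; crossing = λ x∉ y∈ x~y → case crosses x∉ y∈ x~y of λ
          { (here refl) → 0F , refl , refl
          ; (at₁ refl) → 1F , refl , refl
          ; (at₂ refl) → 2F , refl , refl }
      ; distinct = λ {i} {j} eq _ → index-injective i j eq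
      }
      where
      index-injective : ∀ i j → lookup (p₁ ∷ p₂ ∷ p₃ ∷ []) i ≡ lookup (p₁ ∷ p₂ ∷ p₃ ∷ []) j → i ≡ j
      index-injective 0F 0F _ = refl
      index-injective 0F 1F eq = contradiction eq p₁≢p₂
      index-injective 0F 2F eq = contradiction eq p₁≢p₃
      index-injective 1F 0F eq = contradiction (sym eq) p₁≢p₂
      index-injective 1F 1F _ = refl
      index-injective 1F 2F eq = contradiction eq p₂≢p₃
      index-injective 2F 0F eq = contradiction (sym eq) p₁≢p₃
      index-injective 2F 1F eq = contradiction (sym eq) p₂≢p₃
      index-injective 2F 2F _ = refl

  -- `H` need not be the graft at this cut: the induction starts with `G` itself in its place.
  record State₃ (U : Subset order) (p₁ p₂ p₃ s₁ s₂ s₃ : V) (H : Graph) : Set where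
    field
      cut     : Cut₃ U p₁ p₂ p₃ s₁ s₂ s₃
      H-cubic : Cubic H
      real    : Realises G (Blob.edges K₂,₃) (lookup (s₁ ∷ s₂ ∷ s₃ ∷ [])) U H
    open Cut₃ cut public
    open Realises real public

  -- Together with `swap-last` this generates all permutations of the ports, so each case is treated
  -- for one labelling only.
  swap-first : State₃ U p₁ p₂ p₃ s₁ s₂ s₃ H → State₃ U p₂ p₁ p₃ s₂ s₁ s₃ H
  swap-first st = record
    { cut = record
      { p₁∉ = p₂∉ ; p₂∉ = p₁∉ ; p₃∉ = p₃∉ ; s₁∈ = s₂∈ ; s₂∈ = s₁∈ ; s₃∈ = s₃∈
      ; e₁ = e₂ ; e₂ = e₁ ; e₃ = e₃ ; p₁≢p₂ = p₁≢p₂ ∘ sym ; p₁≢p₃ = p₂≢p₃ ; p₂≢p₃ = p₁≢p₃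
      ; crosses = prune crosses
          ((λ _ → at₁ refl) ∷ (λ _ → here refl) ∷ (λ _ → at₂ refl) ∷ [])
      }
    ; H-cubic = H-cubic
    ; real = record
      { cov = transpose (0F ∷ 1F ∷ 3F ∷ 2F ∷ 4F ∷ [])
                (λ { 0F → refl ; 1F → refl ; 2F → refl ; 3F → refl ; 4F → refl }) cov
      ; joined = case joined of λ { (ux₁ ∷ ux₂ ∷ ux₃ ∷ vx₁ ∷ vx₂ ∷ vx₃ ∷ f₁ ∷ f₂ ∷ f₃ ∷ []) →
          ux₂ ∷ ux₁ ∷ ux₃ ∷ vx₂ ∷ vx₁ ∷ vx₃ ∷ f₂ ∷ f₁ ∷ f₃ ∷ [] }
      ; tail⁺ = tail⁺ ; tail⁻ = tail⁻ }
    }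
    where open State₃ st

  swap-last : State₃ U p₁ p₂ p₃ s₁ s₂ s₃ H → State₃ U p₁ p₃ p₂ s₁ s₃ s₂ H
  swap-last st = record
    { cut = record
      { p₁∉ = p₁∉ ; p₂∉ = p₃∉ ; p₃∉ = p₂∉ ; s₁∈ = s₁∈ ; s₂∈ = s₃∈ ; s₃∈ = s₂∈
      ; e₁ = e₁ ; e₂ = e₃ ; e₃ = e₂ ; p₁≢p₂ = p₁≢p₃ ; p₁≢p₃ = p₁≢p₂ ; p₂≢p₃ = p₂≢p₃ ∘ sym
      ; crosses = prune crosses
          ((λ _ → here refl) ∷ (λ _ → at₂ refl) ∷ (λ _ → at₁ refl) ∷ [])
      }
    ; H-cubic = H-cubic
    ; real = record
      { cov = transpose (0F ∷ 1F ∷ 2F ∷ 4F ∷ 3F ∷ [])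
                (λ { 0F → refl ; 1F → refl ; 2F → refl ; 3F → refl ; 4F → refl }) cov
      ; joined = case joined of λ { (ux₁ ∷ ux₂ ∷ ux₃ ∷ vx₁ ∷ vx₂ ∷ vx₃ ∷ f₁ ∷ f₂ ∷ f₃ ∷ []) →
          ux₁ ∷ ux₃ ∷ ux₂ ∷ vx₁ ∷ vx₃ ∷ vx₂ ∷ f₁ ∷ f₃ ∷ f₂ ∷ [] }
      ; tail⁺ = tail⁺ ; tail⁻ = tail⁻ }
    }
    where open State₃ st

  _∈-_ : x ∈ U → x ≢ v → x ∈ U - v
  _∈-_ = x∈p∧x≢y⇒x∈p-y
  infixl 5 _∈-_

  module Grafted₃ {U p₁ p₂ p₃ s₁ s₂ s₃} (cut : Cut₃ U p₁ p₂ p₃ s₁ s₂ s₃) where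
    open Cut₃ cut

    graft₃ : Graph
    graft₃ = Step.graft G cubic K₂,₃ frontier (λ _ → refl)

    state₃ : State₃ U p₁ p₂ p₃ s₁ s₂ s₃ graft₃
    state₃ = record
      { cut     = cut
      ; H-cubic = Step.graft-cubic G cubic K₂,₃ frontier (λ _ → refl)
      ; real    = Step.graft-realises G cubic K₂,₃ frontier (λ _ → refl)
      }

  gone : ∀ {A : Set} → x ∉ U → x ∈ U → A
  gone x∉ x∈ = contradiction x∈ x∉

  -- The relation `R` is left open because both claims run this reduction, with different sets of
  -- permitted steps.
  module Reduction₃ (R : Rel Graph 0ℓ) (C₁⇒R : ∀ {G H} → C₁ G H → R G H) (C₂⇒R : ∀ {G H} → C₂ G H → R G H) where

    Goal : Graph → Set₁
    Goal = ConstructibleFromK₃,₃By R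

    Goal₃ : ℕ → Set₁
    Goal₃ k = ∀ {U p₁ p₂ p₃ s₁ s₂ s₃ H} → State₃ U p₁ p₂ p₃ s₁ s₂ s₃ H → Sweep G k U → Goal H

    module _ {U p₁ p₂ p₃ s₁ s₂ s₃ H} (st : State₃ U p₁ p₂ p₃ s₁ s₂ s₃ H)
             (s₁≢s₂ : s₁ ≢ s₂) (s₁≢s₃ : s₁ ≢ s₃) (s₂≢s₃ : s₂ ≢ s₃) where
      open State₃ st

      parent₁ : x ~ s₁ → x ∉ U → x ≡ p₁
      parent₁ x~s₁ x∉ with crosses x∉ s₁∈ x~s₁
      ... | here refl = refl
      ... | at₁ refl = contradiction refl s₁≢s₂
      ... | at₂ refl = contradiction refl s₁≢s₃

    module _ {U p₁ p₂ p₃ s₁ s₂ s₃ H} (st : State₃ U p₁ p₂ p₃ s₁ s₂ s₃ H)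
             (s₁≢s₂ : s₁ ≢ s₂) (s₁≢s₃ : s₁ ≢ s₃) (s₂≢s₃ : s₂ ≢ s₃) where
      open State₃ st

      private
        parent₂ : x ~ s₂ → x ∉ U → x ≡ p₂
        parent₂ = parent₁ (swap-first st) (s₁≢s₂ ∘ sym) s₂≢s₃ s₁≢s₃

        parent₃ : x ~ s₃ → x ∉ U → x ≡ p₃
        parent₃ = parent₁ (swap-first (swap-last st)) (s₁≢s₃ ∘ sym) (s₂≢s₃ ∘ sym) s₁≢s₂

        parent : x ~ s₁ → x ∉ U → x ≡ p₁
        parent = parent₁ st s₁≢s₂ s₁≢s₃ s₂≢s₃

      -- The new cut keeps p₁  -  s₁ and has s₂, s₃ as its other two sources. In its graft these are
      -- x₂ and x₃; C₂ joins them and inserts two vertices between them and u, v, which gives `H`.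
      reduce₂ : ∀ {r₂ r₃} → s₂ ~ s₃ → IsTriple (s₂ ~_) p₂ s₃ r₂ → IsTriple (s₃ ~_) p₃ s₂ r₃ →
                Sweep G j (U - s₂ - s₃) → Goal₃ j → Goal H
      reduce₂ {r₂ = r₂} {r₃} s₂~s₃ t₂ t₃ sw rec =
        extend {Step = R} (C₂⇒R (step₂ frontier′ H-cubic real′)) (rec (Grafted₃.state₃ cut′) sw)
        where
        module T₂ = IsTriple t₂
        module T₃ = IsTriple t₃
        r₂∈U : r₂ ∈ U
        r₂∈U with r₂ ∈? U
        ... | yes r∈ = r∈
        ... | no r∉ = contradiction (sym (parent₂ (~-sym T₂.Pc) r∉)) T₂.a≢c
        r₃∈U : r₃ ∈ U
        r₃∈U with r₃ ∈? U
        ... | yes r∈ = r∈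
        ... | no r∉ = contradiction (sym (parent₃ (~-sym T₃.Pc) r∉)) T₃.a≢c
        s₂∉ : s₂ ∉ U - s₂ - s₃
        s₂∉ = ∉⇒∉- x∉p-x
        s₃∉ : s₃ ∉ U - s₂ - s₃
        s₃∉ = x∉p-x
        cut′ : Cut₃ (U - s₂ - s₃) p₁ s₂ s₃ s₁ r₂ r₃
        cut′ = record
          { p₁∉ = ∉⇒∉- (∉⇒∉- p₁∉) ; p₂∉ = s₂∉ ; p₃∉ = s₃∉
          ; s₁∈ = s₁∈ ∈- s₁≢s₂ ∈- s₁≢s₃
          ; s₂∈ = r₂∈U ∈- (λ { refl → ~-irrefl T₂.Pc }) ∈- (T₂.b≢c ∘ sym)
          ; s₃∈ = r₃∈U ∈- (T₃.b≢c ∘ sym) ∈- (λ { refl → ~-irrefl T₃.Pc })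
          ; e₁ = e₁ ; e₂ = T₂.Pc ; e₃ = T₃.Pc
          ; p₁≢p₂ = λ { refl → p₁∉ s₂∈ } ; p₁≢p₃ = λ { refl → p₁∉ s₃∈ } ; p₂≢p₃ = s₂≢s₃
          ; crosses = prune (crosses-visit (crosses-visit crosses t₂) t₃)
              ( gone (∉⇒∉- (∉⇒∉- p₃∉)) ∷ gone s₂∉ ∷ (λ _ → at₂ refl)
              ∷ gone (∉⇒∉- (∉⇒∉- p₂∉)) ∷ gone s₃∉ ∷ (λ _ → at₁ refl)
              ∷ (λ _ → here refl) ∷ gone s₂∉ ∷ gone s₃∉ ∷ [])
          }
        frontier′ = Cut₃.frontier cut′
        s₃∈′ : s₃ ∈ U - s₂
        s₃∈′ = s₃∈ ∈- (s₂≢s₃ ∘ sym)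
        real′ : Realises G (Layout.E layout₂) (lookup (s₁ ∷ r₂ ∷ r₃ ∷ [])) (U - s₂ - s₃) H
        real′ = record
          { cov = absorb s₃∈′ (absorb s₂∈ cov)
          ; joined = case joined of λ { (ux₁ ∷ ux₂ ∷ ux₃ ∷ vx₁ ∷ vx₂ ∷ vx₃ ∷ f₁ ∷ f₂ ∷ f₃ ∷ []) →
              ux₁ ∷ ux₂ ∷ ux₃ ∷ vx₁ ∷ vx₂ ∷ vx₃ ∷ f₂ ∷ f₃ ∷ tail⁺ s₂∈ s₃∈ s₂~s₃
              ∷ f₁ ∷ tail⁺ s₂∈ r₂∈U T₂.Pc ∷ tail⁺ s₃∈ r₃∈U T₃.Pc ∷ [] }
          ; tail⁺ = λ r∈ r′∈ → tail⁺ (un r∈) (un r′∈)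
          ; tail⁻ = λ r∈ r′∈ → tail⁻ (un r∈) (un r′∈)
          }
          where
          un : x ∈ U - s₂ - s₃ → x ∈ U
          un = proj₁ ∘ ∈-remove⁻ ∘ proj₁ ∘ ∈-remove⁻

      by-C₂ : s₂ ~ s₃ → Sweep G j (U - s₂ - s₃) → Goal₃ j → Goal H
      by-C₂ s₂~s₃ sw rec =
        let _ , t₂ = neighbours₂ (~-sym e₂) s₂~s₃ (λ { refl → p₂∉ s₃∈ })
            _ , t₃ = neighbours₂ (~-sym e₃) (~-sym s₂~s₃) (λ { refl → p₃∉ s₂∈ })
        in reduce₂ s₂~s₃ t₂ t₃ sw rec

      reduce₁ : ¬ s₁ ~ s₂ → ¬ s₁ ~ s₃ → ¬ s₂ ~ s₃ → ∀ {z r₁ r₂ r₃} → z ∈ U - s₁ - s₂ - s₃ →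
                IsTriple (s₁ ~_) p₁ z r₁ → IsTriple (s₂ ~_) p₂ z r₂ → IsTriple (s₃ ~_) p₃ z r₃ →
                IsTriple (z ~_) s₁ s₂ s₃ → Sweep G j (U - s₁ - s₂ - s₃ - z) → Goal₃ j → Goal H
      reduce₁ s₁≁s₂ s₁≁s₃ s₂≁s₃ {z} {r₁} {r₂} {r₃} z∈₃ t₁ t₂ t₃ tz sw rec =
        extend {Step = R} (C₁⇒R (step₁ (Cut₃.frontier cut′) H-cubic real′)) (rec (Grafted₃.state₃ cut′) sw)
        where
        z∈ = proj₁ (∈-remove⁻ (proj₁ (∈-remove⁻ (proj₁ (∈-remove⁻ z∈₃)))))
        module T₁ = IsTriple t₁
        module T₂ = IsTriple t₂
        module T₃ = IsTriple t₃
        U′ = U - s₁ - s₂ - s₃ - z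
        s₁∉ : s₁ ∉ U′
        s₁∉ = ∉⇒∉- (∉⇒∉- (∉⇒∉- x∉p-x))
        s₂∉ : s₂ ∉ U′
        s₂∉ = ∉⇒∉- (∉⇒∉- x∉p-x)
        s₃∉ : s₃ ∉ U′
        s₃∉ = ∉⇒∉- x∉p-x
        z∉ : z ∉ U′
        z∉ = x∉p-x
        outer : ∀ {s p r} → (∀ {x} → x ~ s → x ∉ U → x ≡ p) → IsTriple (s ~_) p z r → r ∈ U
        outer {r = r} parent t with r ∈? U
        ... | yes r∈ = r∈
        ... | no r∉ = contradiction (sym (parent (~-sym (IsTriple.Pc t)) r∉)) (IsTriple.a≢c t)
        outer′ : ∀ {s p r} → ¬ s ~ s₁ → ¬ s ~ s₂ → ¬ s ~ s₃ → r ∈ U → IsTriple (s ~_) p z r → r ∈ U′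
        outer′ n₁ n₂ n₃ r∈ t =
          r∈ ∈- (λ { refl → n₁ Pc }) ∈- (λ { refl → n₂ Pc }) ∈- (λ { refl → n₃ Pc }) ∈- (b≢c ∘ sym)
          where open IsTriple t
        r₁∈ = outer parent t₁
        r₂∈ = outer parent₂ t₂
        r₃∈ = outer parent₃ t₃
        cut′ : Cut₃ U′ s₁ s₂ s₃ r₁ r₂ r₃
        cut′ = record
          { p₁∉ = s₁∉ ; p₂∉ = s₂∉ ; p₃∉ = s₃∉
          ; s₁∈ = outer′ ~-irrefl s₁≁s₂ s₁≁s₃ r₁∈ t₁
          ; s₂∈ = outer′ (s₁≁s₂ ∘ ~-sym) ~-irrefl s₂≁s₃ r₂∈ t₂
          ; s₃∈ = outer′ (s₁≁s₃ ∘ ~-sym) (s₂≁s₃ ∘ ~-sym) ~-irrefl r₃∈ t₃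
          ; e₁ = T₁.Pc ; e₂ = T₂.Pc ; e₃ = T₃.Pc
          ; p₁≢p₂ = s₁≢s₂ ; p₁≢p₃ = s₁≢s₃ ; p₂≢p₃ = s₂≢s₃
          ; crosses = prune (crosses-visit (crosses-visit (crosses-visit (crosses-visit crosses t₁) t₂) t₃) tz)
              ( gone s₁∉ ∷ gone s₂∉ ∷ gone s₃∉
              ∷ gone (out p₃∉) ∷ gone z∉ ∷ (λ _ → at₂ refl)
              ∷ gone (out p₂∉) ∷ gone z∉ ∷ (λ _ → at₁ refl)
              ∷ gone (out p₁∉) ∷ gone z∉ ∷ (λ _ → here refl)
              ∷ gone s₁∉ ∷ gone s₂∉ ∷ gone s₃∉ ∷ [])
          }
          where
          out : x ∉ U → x ∉ U′
          out = ∉⇒∉- ∘ ∉⇒∉- ∘ ∉⇒∉- ∘ ∉⇒∉-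
        s₂∈′ : s₂ ∈ U - s₁
        s₂∈′ = s₂∈ ∈- (s₁≢s₂ ∘ sym)
        s₃∈′ : s₃ ∈ U - s₁ - s₂
        s₃∈′ = s₃∈ ∈- (s₁≢s₃ ∘ sym) ∈- (s₂≢s₃ ∘ sym)
        real′ : Realises G (Layout.E layout₁) (lookup (r₁ ∷ r₂ ∷ r₃ ∷ [])) U′ H
        real′ = record
          { cov = absorb z∈₃ (absorb s₃∈′ (absorb s₂∈′ (absorb s₁∈ cov)))
          ; joined = case joined of λ { (ux₁ ∷ ux₂ ∷ ux₃ ∷ vx₁ ∷ vx₂ ∷ vx₃ ∷ f₁ ∷ f₂ ∷ f₃ ∷ []) →
              ux₁ ∷ ux₂ ∷ ux₃ ∷ vx₁ ∷ vx₂ ∷ vx₃ ∷ f₁ ∷ f₂ ∷ f₃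
              ∷ tail⁺ s₁∈ z∈ T₁.Pb ∷ tail⁺ s₂∈ z∈ T₂.Pb ∷ tail⁺ s₃∈ z∈ T₃.Pb
              ∷ tail⁺ s₁∈ r₁∈ T₁.Pc ∷ tail⁺ s₂∈ r₂∈ T₂.Pc ∷ tail⁺ s₃∈ r₃∈ T₃.Pc ∷ [] }
          ; tail⁺ = λ r∈ r′∈ → tail⁺ (un r∈) (un r′∈)
          ; tail⁻ = λ r∈ r′∈ → tail⁻ (un r∈) (un r′∈)
          }
          where
          un : x ∈ U′ → x ∈ U
          un = proj₁ ∘ ∈-remove⁻ ∘ proj₁ ∘ ∈-remove⁻ ∘ proj₁ ∘ ∈-remove⁻ ∘ proj₁ ∘ ∈-remove⁻

      by-C₁ : ¬ s₁ ~ s₂ → ¬ s₁ ~ s₃ → ¬ s₂ ~ s₃ → ∀ {z} → z ∈ U - s₁ - s₂ - s₃ → s₁ ~ z → s₂ ~ z → s₃ ~ z →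
              Sweep G j (U - s₁ - s₂ - s₃ - z) → Goal₃ j → Goal H
      by-C₁ s₁≁s₂ s₁≁s₃ s₂≁s₃ {z} z∈₃ s₁~z s₂~z s₃~z sw rec =
        let z∈ = proj₁ (∈-remove⁻ (proj₁ (∈-remove⁻ (proj₁ (∈-remove⁻ z∈₃)))))
            _ , t₁ = neighbours₂ (~-sym e₁) s₁~z (λ { refl → p₁∉ z∈ })
            _ , t₂ = neighbours₂ (~-sym e₂) s₂~z (λ { refl → p₂∉ z∈ })
            _ , t₃ = neighbours₂ (~-sym e₃) s₃~z (λ { refl → p₃∉ z∈ })
        in reduce₁ s₁≁s₂ s₁≁s₃ s₂≁s₃ z∈₃ t₁ t₂ t₃
             (neighbours₃-are (~-sym s₁~z) (~-sym s₂~z) (~-sym s₃~z) s₁≢s₂ s₁≢s₃ s₂≢s₃) sw rec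

      visited : ∀ {s p z} → (∀ {x} → x ~ s → x ∉ U → x ≡ p) → ¬ s ~ s₁ → ¬ s ~ s₂ → ¬ s ~ s₃ →
                s ~ y → y ∉ U - s₁ - s₂ - s₃ - z → y ≡ p ⊎ y ≡ z
      visited parent n₁ n₂ n₃ e y∉ with ∉-remove⁻ y∉
      ... | inj₂ y≡z = inj₂ y≡z
      ... | inj₁ y∉₃ with ∉-remove⁻ y∉₃
      ...   | inj₂ refl = contradiction e n₃
      ...   | inj₁ y∉₂ with ∉-remove⁻ y∉₂
      ...     | inj₂ refl = contradiction e n₂
      ...     | inj₁ y∉₁ with ∉-remove⁻ y∉₁
      ...       | inj₂ refl = contradiction e n₁
      ...       | inj₁ y∉U = inj₁ (parent (~-sym e) y∉U)

      visited-z : ∀ {z} → z ∈ U - s₁ - s₂ - s₃ → z ~ y → y ∉ U - s₁ - s₂ - s₃ - z → y ≡ s₁ ⊎ y ≡ s₂ ⊎ y ≡ s₃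
      visited-z z∈ e y∉ with ∉-remove⁻ y∉
      ... | inj₂ refl = contradiction e ~-irrefl
      ... | inj₁ y∉₃ with ∉-remove⁻ y∉₃
      ...   | inj₂ y≡s₃ = inj₂ (inj₂ y≡s₃)
      ...   | inj₁ y∉₂ with ∉-remove⁻ y∉₂
      ...     | inj₂ y≡s₂ = inj₂ (inj₁ y≡s₂)
      ...     | inj₁ y∉₁ with ∉-remove⁻ y∉₁
      ...       | inj₂ y≡s₁ = inj₁ y≡s₁
      ...       | inj₁ y∉U with z∈₂ , z≢s₃ ← ∈-remove⁻ z∈ with z∈₁ , z≢s₂ ← ∈-remove⁻ z∈₂
                           with z∈U , z≢s₁ ← ∈-remove⁻ z∈₁ with crosses y∉U z∈U (~-sym e)
      ...         | here refl = contradiction refl z≢s₁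
      ...         | at₁ refl = contradiction refl z≢s₂
      ...         | at₂ refl = contradiction refl z≢s₃

      -- Let z be the next visit. Each sᵢ has only pᵢ and z as possible visited neighbours, so all
      -- three are on the boundary and z is not. The neighbours of z are then all visited, and as no
      -- edge from an earlier vertex reaches z, they are s₁, s₂, s₃.
      independent : ¬ s₁ ~ s₂ → ¬ s₁ ~ s₃ → ¬ s₂ ~ s₃ → Sweep G j (U - s₁ - s₂ - s₃) →
                    (∀ {i} → i < j → Goal₃ i) → Goal H
      independent s₁≁s₂ s₁≁s₃ s₂≁s₃ sw rec
        with advance {v = z} z∈ _ _ narrow sw′ ← advancing G cubic sw
          -- Only p₁ can be a visited neighbour of s₁ here; `e₂` is an arbitrary filler.
          (few-visited G cubic {e₂ = s₁} (∉⇒∉- (∉⇒∉- x∉p-x))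
            λ e y∉ → visited parent ~-irrefl s₁≁s₂ s₁≁s₃ e (∉⇒∉- y∉))
        = by-C₁ s₁≁s₂ s₁≁s₃ s₂≁s₃ z∈ (~-sym (proj₁ z~)) (~-sym (proj₁ (proj₂ z~))) (~-sym (proj₂ (proj₂ z~)))
            sw′ (rec ≤-refl)
        where
        z∈₂ = proj₁ (∈-remove⁻ z∈)
        z∈₁ = proj₁ (∈-remove⁻ z∈₂)
        ¬boundary-z : ¬ Boundary G (U - s₁ - s₂ - s₃ - z) z
        ¬boundary-z bz = narrow
          ((s₁≢s₂ ∷ s₁≢s₃ ∷ (λ { refl → x∉p-x z∈₁ }) ∷ []) ∷ (s₂≢s₃ ∷ (λ { refl → x∉p-x z∈₂ }) ∷ [])
            ∷ ((λ { refl → x∉p-x z∈ }) ∷ []) ∷ [] ∷ [])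
          ( few-visited G cubic (∉⇒∉- (∉⇒∉- (∉⇒∉- x∉p-x))) (visited parent ~-irrefl s₁≁s₂ s₁≁s₃)
          ∷ few-visited G cubic (∉⇒∉- (∉⇒∉- x∉p-x)) (visited parent₂ (s₁≁s₂ ∘ ~-sym) ~-irrefl s₂≁s₃)
          ∷ few-visited G cubic (∉⇒∉- x∉p-x) (visited parent₃ (s₁≁s₃ ∘ ~-sym) (s₂≁s₃ ∘ ~-sym) ~-irrefl)
          ∷ bz ∷ [])
        z~ : z ~ s₁ × z ~ s₂ × z ~ s₃
        z~ = saturates G cubic x∉p-x ¬boundary-z (visited-z z∈)

    module _ {U p₁ p₂ p₃ s₁ s₂ s₃ H} (st : State₃ U p₁ p₂ p₃ s₁ s₂ s₃ H)
             (s₁≢s₂ : s₁ ≢ s₂) (s₁≢s₃ : s₁ ≢ s₃) (s₂≢s₃ : s₂ ≢ s₃) where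
      open State₃ st
      private
        parent′ : x ~ s₁ → x ∉ U → x ≡ p₁
        parent′ = parent₁ st s₁≢s₂ s₁≢s₃ s₂≢s₃

        parent″ : x ~ s₂ → x ∉ U → x ≡ p₂
        parent″ = parent₁ (swap-first st) (s₁≢s₂ ∘ sym) s₂≢s₃ s₁≢s₃

      -- If s₃ turns out to be adjacent to s₁ or s₂, only this pair should have been visited. The
      -- remaining vertex is then put back in front of the sweep, since the set reached after its
      -- visit is the same.
      after-three : ¬ s₁ ~ s₂ → Narrow G (U - s₁ - s₂ - s₃) → Sweep G j (U - s₁ - s₂ - s₃) →
                    (∀ {i} → i ≤ suc j → Goal₃ i) → Goal H
      after-three s₁≁s₂ narrow sw rec with adj? s₁ s₃ | adj? s₂ s₃
      ... | yes s₁~s₃ | _ = by-C₂ (swap-first st) (s₁≢s₂ ∘ sym) s₂≢s₃ s₁≢s₃ s₁~s₃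
              (visit (s₂∈ ∈- (s₁≢s₂ ∘ sym) ∈- s₂≢s₃)
                (subst (Narrow G) reorder narrow) (subst (Sweep G _) reorder sw))
              (rec ≤-refl)
        where
        reorder : U - s₁ - s₂ - s₃ ≡ U - s₁ - s₃ - s₂
        reorder = p─x─y≡p─y─x (U - s₁) s₂ s₃
      ... | no _ | yes s₂~s₃ = by-C₂ st s₁≢s₂ s₁≢s₃ s₂≢s₃ s₂~s₃
              (visit (s₁∈ ∈- s₁≢s₂ ∈- s₁≢s₃)
                (subst (Narrow G) reorder narrow) (subst (Sweep G _) reorder sw))
              (rec ≤-refl)
        where
        reorder : U - s₁ - s₂ - s₃ ≡ U - s₂ - s₃ - s₁
        reorder = trans (cong (_- s₃) (p─x─y≡p─y─x U s₁ s₂)) (p─x─y≡p─y─x (U - s₂) s₁ s₃)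
      ... | no s₁≁s₃ | no s₂≁s₃ =
        independent st s₁≢s₂ s₁≢s₃ s₂≢s₃ s₁≁s₂ s₁≁s₃ s₂≁s₃ sw (λ i<j → rec (<⇒≤ (m<n⇒m<1+n i<j)))

      -- If s₁ and s₂ are not adjacent, the next attached visit v is s₃: otherwise p₃, s₁, s₂ and v
      -- are on the boundary, v having no visited neighbours except s₁ and s₂.
      after-two : Sweep G j (U - s₁ - s₂) → (∀ {i} → i ≤ j → Goal₃ i) → Goal H
      after-two sw rec with adj? s₁ s₂
      ... | yes s₁~s₂ = by-C₂ (swap-first (swap-last st)) (s₁≢s₃ ∘ sym) (s₂≢s₃ ∘ sym) s₁≢s₂ s₁~s₂ sw (rec ≤-refl)
      ... | no s₁≁s₂
        with advancing G cubic sw (∉⇒∉- (∉⇒∉- p₃∉) , s₃ , s₃∈ ∈- (s₁≢s₃ ∘ sym) ∈- (s₂≢s₃ ∘ sym) , e₃)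
      ...   | advance {v = v} v∈ _ _ narrow sw′ with v ≟ s₃
      ...     | yes refl = after-three s₁≁s₂ narrow sw′ rec
      ...     | no v≢s₃ = ⊥-elim (narrow
        ( ((λ { refl → p₃∉ s₁∈ }) ∷ (λ { refl → p₃∉ s₂∈ }) ∷ (λ { refl → p₃∉ v∈U }) ∷ [])
        ∷ (s₁≢s₂ ∷ (v≢s₁ ∘ sym) ∷ []) ∷ ((v≢s₂ ∘ sym) ∷ []) ∷ [] ∷ [])
        ( (∉⇒∉- (∉⇒∉- (∉⇒∉- p₃∉)) , s₃ , s₃∈ ∈- (s₁≢s₃ ∘ sym) ∈- (s₂≢s₃ ∘ sym) ∈- (v≢s₃ ∘ sym) , e₃)
        ∷ few-visited G cubic (∉⇒∉- (∉⇒∉- x∉p-x)) (seen parent′ ~-irrefl s₁≁s₂)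
        ∷ few-visited G cubic (∉⇒∉- x∉p-x) (seen parent″ (s₁≁s₂ ∘ ~-sym) ~-irrefl)
        ∷ few-visited G cubic x∉p-x seen-v ∷ []))
        where
        v∈₁ = proj₁ (∈-remove⁻ v∈)
        v≢s₂ = proj₂ (∈-remove⁻ v∈)
        v∈U = proj₁ (∈-remove⁻ v∈₁)
        v≢s₁ = proj₂ (∈-remove⁻ v∈₁)
        seen : ∀ {s p} → (∀ {x} → x ~ s → x ∉ U → x ≡ p) → ¬ s ~ s₁ → ¬ s ~ s₂ →
               s ~ y → y ∉ U - s₁ - s₂ - v → y ≡ p ⊎ y ≡ v
        seen parent n₁ n₂ e y∉ with ∉-remove⁻ y∉
        ... | inj₂ y≡v = inj₂ y≡v
        ... | inj₁ y∉₂ with ∉-remove⁻ y∉₂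
        ...   | inj₂ refl = contradiction e n₂
        ...   | inj₁ y∉₁ with ∉-remove⁻ y∉₁
        ...     | inj₂ refl = contradiction e n₁
        ...     | inj₁ y∉U = inj₁ (parent (~-sym e) y∉U)
        seen-v : v ~ y → y ∉ U - s₁ - s₂ - v → y ≡ s₁ ⊎ y ≡ s₂
        seen-v e y∉ with ∉-remove⁻ y∉
        ... | inj₂ refl = contradiction e ~-irrefl
        ... | inj₁ y∉₂ with ∉-remove⁻ y∉₂
        ...   | inj₂ y≡s₂ = inj₂ y≡s₂
        ...   | inj₁ y∉₁ with ∉-remove⁻ y∉₁
        ...     | inj₂ y≡s₁ = inj₁ y≡s₁
        ...     | inj₁ y∉U with crosses y∉U v∈U (~-sym e)
        ...       | here refl = contradiction refl v≢s₁
        ...       | at₁ refl = contradiction refl v≢s₂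
        ...       | at₂ refl = contradiction refl v≢s₃

    module _ {U p₁ p₂ p₃ s₁ s₂ s₃ H} (st : State₃ U p₁ p₂ p₃ s₁ s₂ s₃ H)
             (s₁≢s₂ : s₁ ≢ s₂) (s₁≢s₃ : s₁ ≢ s₃) (s₂≢s₃ : s₂ ≢ s₃) where
      open State₃ st

      -- The next attached visit v is s₂ or s₃: otherwise p₂, p₃, s₁ and v are on the boundary.
      after-one : Sweep G j (U - s₁) → (∀ {i} → i < j → Goal₃ i) → Goal H
      after-one sw rec
        with advancing G cubic sw (∉⇒∉- p₂∉ , s₂ , s₂∈ ∈- (s₁≢s₂ ∘ sym) , e₂)
      ... | advance {v = v} v∈ _ _ narrow sw′ with v ≟ s₂ | v ≟ s₃
      ...   | yes refl | _ = after-two st s₁≢s₂ s₁≢s₃ s₂≢s₃ sw′ (rec ∘ s≤s)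
      ...   | no _ | yes refl = after-two (swap-last st) s₁≢s₃ s₁≢s₂ (s₂≢s₃ ∘ sym) sw′ (rec ∘ s≤s)
      ...   | no v≢s₂ | no v≢s₃ = ⊥-elim (narrow
        ( (p₂≢p₃ ∷ (λ { refl → p₂∉ s₁∈ }) ∷ (λ { refl → p₂∉ v∈U }) ∷ [])
        ∷ ((λ { refl → p₃∉ s₁∈ }) ∷ (λ { refl → p₃∉ v∈U }) ∷ [])
        ∷ ((v≢s₁ ∘ sym) ∷ []) ∷ [] ∷ [])
        ( (∉⇒∉- (∉⇒∉- p₂∉) , s₂ , s₂∈ ∈- (s₁≢s₂ ∘ sym) ∈- (v≢s₂ ∘ sym) , e₂)
        ∷ (∉⇒∉- (∉⇒∉- p₃∉) , s₃ , s₃∈ ∈- (s₁≢s₃ ∘ sym) ∈- (v≢s₃ ∘ sym) , e₃)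
        ∷ few-visited G cubic (∉⇒∉- x∉p-x) seen
        ∷ few-visited G cubic {e₂ = s₁} x∉p-x seen-v ∷ []))
        where
        v∈U = proj₁ (∈-remove⁻ v∈)
        v≢s₁ = proj₂ (∈-remove⁻ v∈)
        seen : s₁ ~ y → y ∉ U - s₁ - v → y ≡ p₁ ⊎ y ≡ v
        seen e y∉ with ∉-remove⁻ y∉
        ... | inj₂ y≡v = inj₂ y≡v
        ... | inj₁ y∉₁ with ∉-remove⁻ y∉₁
        ...   | inj₂ refl = contradiction e ~-irrefl
        ...   | inj₁ y∉U = inj₁ (parent₁ st s₁≢s₂ s₁≢s₃ s₂≢s₃ (~-sym e) y∉U)
        seen-v : v ~ y → y ∉ U - s₁ - v → y ≡ s₁ ⊎ y ≡ s₁
        seen-v e y∉ with ∉-remove⁻ y∉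
        ... | inj₂ refl = contradiction e ~-irrefl
        ... | inj₁ y∉₁ with ∉-remove⁻ y∉₁
        ...   | inj₂ y≡s₁ = inj₁ y≡s₁
        ...   | inj₁ y∉U with crosses y∉U v∈U (~-sym e)
        ...     | here refl = contradiction refl v≢s₁
        ...     | at₁ refl = contradiction refl v≢s₂
        ...     | at₂ refl = contradiction refl v≢s₃

    distinct-ports : State₃ U p₁ p₂ p₃ s₁ s₂ s₃ H → s₁ ≢ s₂ → s₁ ≢ s₃ → s₂ ≢ s₃ →
                     Sweep G k U → (∀ {i} → i < k → Goal₃ i) → Goal H
    distinct-ports st s₁≢s₂ s₁≢s₃ s₂≢s₃ sw rec
      with advancing G cubic sw (State₃.p₁∉ st , _ , State₃.s₁∈ st , State₃.e₁ st)
    ... | advance v∈ x∉ x~v _ sw′ with State₃.crosses st x∉ v∈ x~v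
    ...   | here refl = after-one st s₁≢s₂ s₁≢s₃ s₂≢s₃ sw′ (rec ∘ m<n⇒m<1+n)
    ...   | at₁ refl = after-one (swap-first st) (s₁≢s₂ ∘ sym) s₂≢s₃ s₁≢s₃ sw′ (rec ∘ m<n⇒m<1+n)
    ...   | at₂ refl =
      after-one (swap-first (swap-last st)) (s₁≢s₃ ∘ sym) (s₂≢s₃ ∘ sym) s₁≢s₂ sw′ (rec ∘ m<n⇒m<1+n)

∉-removals⁻ : ∀ {n} {U : Subset n} {y} vs → y ∉ foldl _-_ U vs → y ∉ U ⊎ y L.∈ vs
∉-removals⁻ [] y∉ = inj₁ y∉
∉-removals⁻ (v ∷ vs) y∉ with ∉-removals⁻ vs y∉
... | inj₂ y∈vs = inj₂ (there y∈vs)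
... | inj₁ y∉′ with ∉-remove⁻ y∉′
...   | inj₁ y∉U  = inj₁ y∉U
...   | inj₂ refl = inj₂ (here refl)

∈-removals⁻ : ∀ {n} {U : Subset n} {y} vs → y ∈ foldl _-_ U vs → y ∈ U × All (y ≢_) vs
∈-removals⁻ [] y∈ = y∈ , []
∈-removals⁻ (v ∷ vs) y∈ with y∈′ , ≢vs ← ∈-removals⁻ vs y∈ with y∈U , y≢v ← ∈-remove⁻ y∈′ = y∈U , y≢v ∷ ≢vs

∈-removals⁺ : ∀ {n} {U : Subset n} {y vs} → y ∈ U → All (y ≢_) vs → y ∈ foldl _-_ U vs
∈-removals⁺ y∈ [] = y∈
∈-removals⁺ y∈ (y≢v ∷ ≢vs) = ∈-removals⁺ (x∈p∧x≢y⇒x∈p-y y∈ y≢v) ≢vs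

∉-removals⁺ : ∀ {n} {U : Subset n} {y} vs → y ∉ U ⊎ y L.∈ vs → y ∉ foldl _-_ U vs
∉-removals⁺ vs (inj₁ y∉U) y∈ = y∉U (proj₁ (∈-removals⁻ vs y∈))
∉-removals⁺ vs (inj₂ y∈vs) y∈ = All.lookup (proj₂ (∈-removals⁻ vs y∈)) y∈vs refl

-- Two edges into the unvisited set

module TwoPorts (G : Graph) (cubic : Cubic G)
                 (triangle-free : ∀ {a b c} → Adj G a b → Adj G b c → Adj G c a → ⊥) where
  open Graph G using (order; adj?) renaming (Vertex to V; Adj to _~_; sym to ~-sym)
  open ThreePorts G cubic triangle-free

  private variable
    k j : ℕ
    U : Subset order
    p₁ p₂ s₁ s₂ a b c v w x y : V
    H : Graph

  -- Only the two edges are distinct as pairs: their sources coincide after a reduction by C₆, and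
  -- their far ends may coincide after the passage from three edges.
  record Cut₂ (U : Subset order) (p₁ p₂ s₁ s₂ : V) : Set where
    field
      p₁∉ : p₁ ∉ U
      p₂∉ : p₂ ∉ U
      s₁∈ : s₁ ∈ U
      s₂∈ : s₂ ∈ U
      e₁  : p₁ ~ s₁
      e₂  : p₂ ~ s₂
      distinct : ¬ (p₁ ≡ p₂ × s₁ ≡ s₂)
      crosses : Crosses U ((p₁ , s₁) ∷ (p₂ , s₂) ∷ [])

    frontier : Frontier G U (lookup (p₁ ∷ p₂ ∷ [])) (lookup (s₁ ∷ s₂ ∷ []))
    frontier = record
      { p∉  = λ { 0F → p₁∉ ; 1F → p₂∉ }
      ; s∈  = λ { 0F → s₁∈ ; 1F → s₂∈ }
      ; p~s = λ { 0F → e₁ ; 1F → e₂ }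
      ; crossing = λ x∉ y∈ x~y → case crosses x∉ y∈ x~y of λ
          { (here refl) → 0F , refl , refl
          ; (at₁ refl) → 1F , refl , refl }
      ; distinct = λ {i} {j} → index-injective i j
      }
      where
      index-injective : ∀ i j → lookup (p₁ ∷ p₂ ∷ []) i ≡ lookup (p₁ ∷ p₂ ∷ []) j →
                        lookup (s₁ ∷ s₂ ∷ []) i ≡ lookup (s₁ ∷ s₂ ∷ []) j → i ≡ j
      index-injective 0F 0F _ _ = refl
      index-injective 0F 1F eq eq′ = contradiction (eq , eq′) distinct
      index-injective 1F 0F eq eq′ = contradiction (sym eq , sym eq′) distinct
      index-injective 1F 1F _ _ = refl

    inner : v ∈ U → v ≢ s₁ → v ≢ s₂ → v ~ y → y ∈ U
    inner {y = y} v∈ v≢s₁ v≢s₂ v~y = decidable-stable (y ∈? U) λ y∉ → case crosses y∉ v∈ (~-sym v~y) of λ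
      { (here refl) → v≢s₁ refl ; (at₁ refl) → v≢s₂ refl }

    parent₁ : s₁ ≢ s₂ → s₁ ~ y → y ∉ U → y ≡ p₁
    parent₁ s₁≢s₂ e y∉ with crosses y∉ s₁∈ (~-sym e)
    ... | here refl = refl
    ... | at₁ refl = contradiction refl s₁≢s₂

    parent₂ : s₁ ≢ s₂ → s₂ ~ y → y ∉ U → y ≡ p₂
    parent₂ s₁≢s₂ e y∉ with crosses y∉ s₂∈ (~-sym e)
    ... | here refl = contradiction refl s₁≢s₂
    ... | at₁ refl = refl

  record State₂ (U : Subset order) (p₁ p₂ s₁ s₂ : V) (H : Graph) : Set where
    field
      cut     : Cut₂ U p₁ p₂ s₁ s₂
      H-cubic : Cubic H
      real    : Realises G (Blob.edges K₃,₃⁻) (lookup (s₁ ∷ s₂ ∷ [])) U H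
    open Cut₂ cut public
    open Realises real public

  -- An automorphism of K₃,₃ minus an edge that exchanges the ends of the missing edge exchanges the
  -- two parts as well, so every vertex moves.
  swap₂ : State₂ U p₁ p₂ s₁ s₂ H → State₂ U p₂ p₁ s₂ s₁ H
  swap₂ {H = H} st = record
    { cut = record
      { p₁∉ = p₂∉ ; p₂∉ = p₁∉ ; s₁∈ = s₂∈ ; s₂∈ = s₁∈ ; e₁ = e₂ ; e₂ = e₁
      ; distinct = λ (eq , eq′) → distinct (sym eq , sym eq′)
      ; crosses = prune crosses ((λ _ → at₁ refl) ∷ (λ _ → here refl) ∷ [])
      }
    ; H-cubic = H-cubic
    ; real = record
      { cov = transpose (3F ∷ 4F ∷ 5F ∷ 0F ∷ 1F ∷ 2F ∷ [])
                (λ { 0F → refl ; 1F → refl ; 2F → refl ; 3F → refl ; 4F → refl ; 5F → refl }) cov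
      ; joined = case joined of λ { (ux₁ ∷ ux₂ ∷ ux₃ ∷ vx₁ ∷ vx₂ ∷ vx₃ ∷ x₂y ∷ x₃y ∷ f₁ ∷ f₂ ∷ []) →
          x₂y ∷ H~ ux₂ ∷ H~ vx₂ ∷ x₃y ∷ H~ ux₃ ∷ H~ vx₃ ∷ ux₁ ∷ vx₁ ∷ f₂ ∷ f₁ ∷ [] }
      ; tail⁺ = tail⁺ ; tail⁻ = tail⁻ }
    }
    where
    open State₂ st
    H~ : ∀ {x y} → Adj H x y → Adj H y x
    H~ = Graph.sym H

  lookup₂-injective : a ≢ b → ∀ {i j} → lookup (a ∷ b ∷ []) i ≡ lookup (a ∷ b ∷ []) j → i ≡ j
  lookup₂-injective a≢b {0F} {0F} _ = refl
  lookup₂-injective a≢b {0F} {1F} eq = contradiction eq a≢b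
  lookup₂-injective a≢b {1F} {0F} eq = contradiction (sym eq) a≢b
  lookup₂-injective a≢b {1F} {1F} _ = refl

  module Grafted₂ {U p₁ p₂ s₁ s₂} (cut : Cut₂ U p₁ p₂ s₁ s₂) (s₁≢s₂ : s₁ ≢ s₂) where
    open Cut₂ cut

    graft₂ : Graph
    graft₂ = Step.graft G cubic K₃,₃⁻ frontier (lookup₂-injective s₁≢s₂)

    state₂ : State₂ U p₁ p₂ s₁ s₂ graft₂
    state₂ = record
      { cut     = cut
      ; H-cubic = Step.graft-cubic G cubic K₃,₃⁻ frontier (lookup₂-injective s₁≢s₂)
      ; real    = Step.graft-realises G cubic K₃,₃⁻ frontier (lookup₂-injective s₁≢s₂)
      }

  module Reduction₂ (R : Rel Graph 0ℓ)
                    (C₃⇒R : ∀ {G H} → C₃ G H → R G H) (C₄⇒R : ∀ {G H} → C₄ G H → R G H)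
                    (C₅⇒R : ∀ {G H} → C₅ G H → R G H) (C₆⇒R : ∀ {G H} → C₆ G H → R G H) where

    Goal : Graph → Set₁
    Goal = ConstructibleFromK₃,₃By R

    Goal₂ : ℕ → Set₁
    Goal₂ k = ∀ {U p₁ p₂ s₁ s₂ H} → State₂ U p₁ p₂ s₁ s₂ H → Sweep G k U → Goal H

    Goal₃ : ℕ → Set₁
    Goal₃ k = ∀ {U p₁ p₂ p₃ s₁ s₂ s₃ H} → State₃ U p₁ p₂ p₃ s₁ s₂ s₃ H → Sweep G k U → Goal H

    -- Once p is visited, its edge to q is the only one left, so it is a bridge of `G`. Visiting q
    -- as well restores two edges, both starting at q.
    reduce₆ : ∀ {p q} → State₂ U p₁ p₂ p p H → IsTriple (p ~_) p₁ p₂ q → IsTriple (q ~_) p a b →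
              Sweep G j (U - p - q) → Goal₂ j → Goal H
    reduce₆ {U = U} {p₁} {p₂} {H} {a} {b} {p = p} {q} st tp tq sw rec =
      extend {Step = R} (C₆⇒R (step₆ (Cut₂.frontier cut′) (lookup₂-injective Q.b≢c) H-cubic real′))
        (rec (Grafted₂.state₂ cut′ Q.b≢c) sw)
      where
      open State₂ st
      module P = IsTriple tp
      module Q = IsTriple tq
      q∈ : q ∈ U
      q∈ = decidable-stable (q ∈? U) λ q∉ → case crosses q∉ s₁∈ (~-sym P.Pc) of λ
        { (here refl) → P.a≢c refl ; (at₁ refl) → P.b≢c refl }
      q≢p : q ≢ p
      q≢p refl = ~-irrefl P.Pc
      U′ = U - p - q
      p∉ : p ∉ U′
      p∉ = ∉⇒∉- x∉p-x
      q∉ : q ∉ U′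
      q∉ = x∉p-x
      a∈ = inner q∈ q≢p q≢p Q.Pb
      b∈ = inner q∈ q≢p q≢p Q.Pc
      cut′ : Cut₂ U′ q q a b
      cut′ = record
        { p₁∉ = q∉ ; p₂∉ = q∉
        ; s₁∈ = a∈ ∈- (Q.a≢b ∘ sym) ∈- (λ { refl → ~-irrefl Q.Pb })
        ; s₂∈ = b∈ ∈- (Q.a≢c ∘ sym) ∈- (λ { refl → ~-irrefl Q.Pc })
        ; e₁ = Q.Pb ; e₂ = Q.Pc ; distinct = Q.b≢c ∘ proj₂
        ; crosses = prune (crosses-visit (crosses-visit crosses tp) tq)
            ( gone p∉ ∷ (λ _ → here refl) ∷ (λ _ → at₁ refl)
            ∷ gone (∉⇒∉- (∉⇒∉- p₁∉)) ∷ gone (∉⇒∉- (∉⇒∉- p₂∉)) ∷ gone q∉ ∷ gone p∉ ∷ gone p∉ ∷ [])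
        }
      real′ : Realises G (Layout.E layout₆) (lookup (a ∷ b ∷ [])) U′ H
      real′ = record
        { cov = absorb (q∈ ∈- q≢p) (absorb s₁∈ cov)
        ; joined = case joined of λ { (ux₁ ∷ ux₂ ∷ ux₃ ∷ vx₁ ∷ vx₂ ∷ vx₃ ∷ x₂y ∷ x₃y ∷ f₁ ∷ f₂ ∷ []) →
            ux₁ ∷ ux₂ ∷ ux₃ ∷ vx₁ ∷ vx₂ ∷ vx₃ ∷ x₂y ∷ x₃y ∷ f₁ ∷ f₂ ∷ tail⁺ s₁∈ q∈ P.Pc
            ∷ tail⁺ q∈ a∈ Q.Pb ∷ tail⁺ q∈ b∈ Q.Pc ∷ [] }
        ; tail⁺ = λ r∈ r′∈ → tail⁺ (un r∈) (un r′∈)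
        ; tail⁻ = λ r∈ r′∈ → tail⁻ (un r∈) (un r′∈)
        }
        where
        un : x ∈ U′ → x ∈ U
        un = proj₁ ∘ ∈-removals⁻ (p ∷ q ∷ [])

    after-p : ∀ {p q} → State₂ U p₁ p₂ p p H → IsTriple (p ~_) p₁ p₂ q → q ∈ U → Sweep G k (U - p) →
              (∀ {i} → i < k → Goal₂ i) → Goal H
    after-p {q = q} st tp q∈ sw rec
      with advancing G cubic sw (x∉p-x , q , q∈ ∈- (λ { refl → ~-irrefl (IsTriple.Pc tp) }) , IsTriple.Pc tp)
    ... | advance v∈ x∉ x~v _ sw′ with ∈-remove⁻ v∈ | ∉-remove⁻ x∉
    ...   | v∈U , v≢p | inj₁ x∉U = case State₂.crosses st x∉U v∈U x~v of λ
      { (here eq) → contradiction (cong proj₂ eq) v≢p ; (at₁ eq) → contradiction (cong proj₂ eq) v≢p }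
    ...   | v∈U , v≢p | inj₂ refl with IsTriple.only tp x~v
    ...     | inj₁ refl = contradiction v∈U (State₂.p₁∉ st)
    ...     | inj₂ (inj₁ refl) = contradiction v∈U (State₂.p₂∉ st)
    ...     | inj₂ (inj₂ refl) =
      let _ , _ , tq = neighbours₁ (~-sym (IsTriple.Pc tp)) in reduce₆ st tp tq sw′ (rec ≤-refl)

    by-C₆ : ∀ {p} → State₂ U p₁ p₂ p p H → Sweep G k U → (∀ {i} → i < k → Goal₂ i) → Goal H
    by-C₆ {U = U} {p₁} {p₂} {p = p} st sw rec = case advancing G cubic sw (p₁∉ , p , s₁∈ , e₁) of λ
      { (advance v∈ x∉ x~v _ sw′) → case crosses x∉ v∈ x~v of λ
        { (here refl) → after-p st tp q∈ sw′ (rec ∘ m<n⇒m<1+n)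
        ; (at₁ refl) → after-p st tp q∈ sw′ (rec ∘ m<n⇒m<1+n) } }
      where
      open State₂ st
      q = proj₁ (neighbours₂ (~-sym e₁) (~-sym e₂) (λ eq → distinct (eq , refl)))
      tp : IsTriple (p ~_) p₁ p₂ q
      tp = proj₂ (neighbours₂ (~-sym e₁) (~-sym e₂) (λ eq → distinct (eq , refl)))
      module P = IsTriple tp
      q∈ : q ∈ U
      q∈ = decidable-stable (q ∈? U) λ q∉ → case crosses q∉ s₁∈ (~-sym P.Pc) of λ
        { (here eq) → P.a≢c (sym (cong proj₁ eq)) ; (at₁ eq) → P.b≢c (sym (cong proj₁ eq)) }

    module _ {U p₁ p₂ s t H} (st : State₂ U p₁ p₂ s t H) (s≢t : s ≢ t) where
      open State₂ st

      outer₁ : ∀ {b r} → IsTriple (s ~_) p₁ b r → r ∈ U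
      outer₁ {r = r} tr = decidable-stable (r ∈? U) λ r∉ →
        IsTriple.a≢c tr (sym (parent₁ s≢t (IsTriple.Pc tr) r∉))

      outer₂ : ∀ {b r} → IsTriple (t ~_) p₂ b r → r ∈ U
      outer₂ {r = r} tr = decidable-stable (r ∈? U) λ r∉ →
        IsTriple.a≢c tr (sym (parent₂ s≢t (IsTriple.Pc tr) r∉))

      t∈-s : t ∈ U - s
      t∈-s = s₂∈ ∈- (s≢t ∘ sym)

      reduce₅ : ∀ {r₁ r₂} → s ~ t → IsTriple (s ~_) p₁ t r₁ → IsTriple (t ~_) p₂ s r₂ →
                Sweep G j (U - s - t) → Goal₂ j → Goal H
      reduce₅ {r₁ = r₁} {r₂} s~t ts tt sw rec =
        extend {Step = R} (C₅⇒R (step₅ (Cut₂.frontier cut′) (lookup₂-injective r₁≢r₂) H-cubic real′))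
          (rec (Grafted₂.state₂ cut′ r₁≢r₂) sw)
        where
        module S = IsTriple ts
        module T = IsTriple tt
        r₁≢r₂ : r₁ ≢ r₂
        -- A common further neighbour of the adjacent s and t would close a triangle; the graft at
        -- the new cut needs different far ends.
        r₁≢r₂ refl = triangle-free s~t T.Pc (~-sym S.Pc)
        U′ = U - s - t
        s∉ : s ∉ U′
        s∉ = ∉⇒∉- x∉p-x
        t∉ : t ∉ U′
        t∉ = x∉p-x
        r₁∈ = outer₁ ts
        r₂∈ = outer₂ tt
        cut′ : Cut₂ U′ s t r₁ r₂
        cut′ = record
          { p₁∉ = s∉ ; p₂∉ = t∉
          ; s₁∈ = r₁∈ ∈- (λ { refl → ~-irrefl S.Pc }) ∈- (S.b≢c ∘ sym)
          ; s₂∈ = r₂∈ ∈- (T.b≢c ∘ sym) ∈- (λ { refl → ~-irrefl T.Pc })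
          ; e₁ = S.Pc ; e₂ = T.Pc ; distinct = s≢t ∘ proj₁
          ; crosses = prune (crosses-visit (crosses-visit crosses ts) tt)
              ( gone (∉⇒∉- (∉⇒∉- p₂∉)) ∷ gone s∉ ∷ (λ _ → at₁ refl)
              ∷ gone (∉⇒∉- (∉⇒∉- p₁∉)) ∷ gone t∉ ∷ (λ _ → here refl) ∷ gone s∉ ∷ gone t∉ ∷ [])
          }
        real′ : Realises G (Layout.E layout₅) (lookup (r₁ ∷ r₂ ∷ [])) U′ H
        real′ = record
          { cov = absorb t∈-s (absorb s₁∈ cov)
          ; joined = case joined of λ { (ux₁ ∷ ux₂ ∷ ux₃ ∷ vx₁ ∷ vx₂ ∷ vx₃ ∷ x₂y ∷ x₃y ∷ f₁ ∷ f₂ ∷ []) →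
              ux₁ ∷ ux₂ ∷ ux₃ ∷ vx₁ ∷ vx₂ ∷ vx₃ ∷ x₂y ∷ x₃y ∷ f₁ ∷ f₂ ∷ tail⁺ s₁∈ s₂∈ s~t
              ∷ tail⁺ s₁∈ r₁∈ S.Pc ∷ tail⁺ s₂∈ r₂∈ T.Pc ∷ [] }
          ; tail⁺ = λ r∈ r′∈ → tail⁺ (un r∈) (un r′∈)
          ; tail⁻ = λ r∈ r′∈ → tail⁻ (un r∈) (un r′∈)
          }
          where
          un : x ∈ U′ → x ∈ U
          un = proj₁ ∘ ∈-removals⁻ (s ∷ t ∷ [])

      by-C₅ : s ~ t → Sweep G j (U - s - t) → Goal₂ j → Goal H
      by-C₅ s~t sw rec =
        let _ , ts = neighbours₂ (~-sym e₁) s~t (λ { refl → p₁∉ s₂∈ })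
            _ , tt = neighbours₂ (~-sym e₂) (~-sym s~t) (λ { refl → p₂∉ s₁∈ })
        in reduce₅ s~t ts tt sw rec

      -- The other neighbour r of s may have been visited before t.
      after-r : ∀ {r} → s ~ t → IsTriple (s ~_) p₁ t r → Sweep G j (U - s - r) →
                (∀ {i} → i ≤ j → Goal₂ i) → Goal H
      after-r {r = r} s~t ts sw rec
        with advancing G cubic sw (∉-removals⁺ (s ∷ r ∷ []) (inj₁ p₂∉) , t , t∈-s ∈- IsTriple.b≢c ts , e₂)
      ... | advance {v = v} v∈ _ _ narrow sw′ with v ≟ t
      ...   | yes refl = by-C₅ s~t
                (visit (outer₁ ts ∈- (λ { refl → ~-irrefl S.Pc }) ∈- (S.b≢c ∘ sym))
                  (subst (Narrow G) reorder narrow) (subst (Sweep G _) reorder sw′)) (rec ≤-refl)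
        where
        module S = IsTriple ts
        reorder : U - s - r - t ≡ U - s - t - r
        reorder = p─x─y≡p─y─x (U - s) r t
      ...   | no v≢t = ⊥-elim (narrow
        ( ((λ { refl → p₂∉ s₁∈ }) ∷ (λ { refl → p₂∉ r∈ }) ∷ (λ { refl → p₂∉ v∈U }) ∷ [])
        ∷ ((λ { refl → ~-irrefl S.Pc }) ∷ (v≢s ∘ sym) ∷ []) ∷ ((v≢r ∘ sym) ∷ []) ∷ [] ∷ [])
        ( (∉-removals⁺ vs (inj₁ p₂∉) , t , t∈′ , e₂)
        ∷ (∉-removals⁺ vs (inj₂ (here refl)) , t , t∈′ , s~t)
        ∷ few-visited G cubic (∉-removals⁺ vs (inj₂ (at₁ refl))) seen-r
        ∷ few-visited G cubic {e₂ = r} (∉-removals⁺ vs (inj₂ (at₂ refl))) seen-v ∷ []))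
        where
        module S = IsTriple ts
        vs = s ∷ r ∷ v ∷ []
        r∈ = outer₁ ts
        v∈U = proj₁ (∈-removals⁻ (s ∷ r ∷ []) v∈)
        v≢s : v ≢ s
        v≢s = All.head (proj₂ (∈-removals⁻ (s ∷ r ∷ []) v∈))
        v≢r : v ≢ r
        v≢r = All.head (All.tail (proj₂ (∈-removals⁻ (s ∷ r ∷ []) v∈)))
        t∈′ : t ∈ U - s - r - v
        t∈′ = t∈-s ∈- S.b≢c ∈- (v≢t ∘ sym)
        seen-r : r ~ y → y ∉ U - s - r - v → y ≡ s ⊎ y ≡ v
        seen-r e y∉ with ∉-removals⁻ vs y∉
        ... | inj₁ y∉U = contradiction (inner r∈ (λ { refl → ~-irrefl S.Pc }) (S.b≢c ∘ sym) e) y∉U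
        ... | inj₂ (here y≡s) = inj₁ y≡s
        ... | inj₂ (at₁ refl) = contradiction e ~-irrefl
        ... | inj₂ (at₂ y≡v) = inj₂ y≡v
        seen-v : v ~ y → y ∉ U - s - r - v → y ≡ r ⊎ y ≡ r
        seen-v e y∉ with ∉-removals⁻ vs y∉
        ... | inj₁ y∉U = contradiction (inner v∈U v≢s v≢t e) y∉U
        ... | inj₂ (at₁ y≡r) = inj₁ y≡r
        ... | inj₂ (at₂ refl) = contradiction e ~-irrefl
        ... | inj₂ (here refl) with S.only (~-sym e)
        ...   | inj₁ refl = contradiction v∈U p₁∉
        ...   | inj₂ (inj₁ v≡t) = contradiction v≡t v≢t
        ...   | inj₂ (inj₂ v≡r) = contradiction v≡r v≢r

      adjacent-after-s : s ~ t → Sweep G k (U - s) → (∀ {i} → i < k → Goal₂ i) → Goal H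
      adjacent-after-s s~t sw rec = go (neighbours₂ (~-sym e₁) s~t (λ { refl → p₁∉ s₂∈ }))
        (advancing G cubic sw (∉⇒∉- p₂∉ , t , t∈-s , e₂)) rec
        where
        go : ∀ {k} → ∃[ r ] IsTriple (s ~_) p₁ t r → Advance G cubic k (U - s) →
             (∀ {i} → i < k → Goal₂ i) → Goal H
        go (r , ts) (advance v∈ x∉ x~v narrow sw′) rec with ∉-remove⁻ x∉ | ∈-remove⁻ v∈
        ... | inj₁ x∉U | v∈U , v≢s = case crosses x∉U v∈U x~v of λ
          { (here eq) → contradiction (cong proj₂ eq) v≢s
          ; (at₁ refl) → by-C₅ s~t sw′ (rec ≤-refl) }
        ... | inj₂ refl | v∈U , v≢s with IsTriple.only ts x~v
        ...   | inj₁ refl = contradiction v∈U p₁∉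
        ...   | inj₂ (inj₁ refl) = by-C₅ s~t sw′ (rec ≤-refl)
        ...   | inj₂ (inj₂ refl) = after-r s~t ts sw′ (rec ∘ s≤s)

    first-visit : ∀ {s t} → State₂ U p₁ p₂ s t H → Sweep G k U →
      (∀ {j} → j < k → Sweep G j (U - s) → Goal H) → (∀ {j} → j < k → Sweep G j (U - t) → Goal H) → Goal H
    first-visit st sw to-s to-t with advancing G cubic sw (State₂.p₁∉ st , _ , State₂.s₁∈ st , State₂.e₁ st)
    ... | advance v∈ x∉ x~v _ sw′ with State₂.crosses st x∉ v∈ x~v
    ...   | here refl = to-s ≤-refl sw′
    ...   | at₁ refl = to-t ≤-refl sw′

    adjacent : ∀ {s t} → State₂ U p₁ p₂ s t H → s ≢ t → s ~ t → Sweep G k U → (∀ {i} → i < k → Goal₂ i) → Goal H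
    adjacent st s≢t s~t sw rec = first-visit st sw
      (λ j<k sw′ → adjacent-after-s st s≢t s~t sw′ (λ i<j → rec (<-trans i<j j<k)))
      (λ j<k sw′ → adjacent-after-s (swap₂ st) (s≢t ∘ sym) (~-sym s~t) sw′ (λ i<j → rec (<-trans i<j j<k)))

    module _ {U p₁ p₂ s t H} (st : State₂ U p₁ p₂ s t H) (s≢t : s ≢ t) (s≁t : ¬ s ~ t) where
      open State₂ st

      private
        s≢ : s ~ x → x ≢ t
        s≢ s~x refl = s≁t s~x

        irr : x ~ y → y ≢ x
        irr e refl = ~-irrefl e

        avoids : x ~ y → ¬ x ~ v → y ≢ v
        avoids x~y x≁v refl = x≁v x~y

        t∈s : t ∈ U - s
        t∈s = t∈-s st s≢t

      -- With a common neighbour w of s and t visited, three edges with different sources s, w, t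
      -- remain. So the smaller graph carries a K₂,₃, and C₄ itself rebuilds K₃,₃ minus an edge.
      reduce₄ : ∀ {w a b c} → w ∈ U → IsTriple (s ~_) p₁ w a → IsTriple (t ~_) p₂ w b → IsTriple (w ~_) s t c →
                Sweep G j (U - s - t - w) → Goal₃ j → Goal H
      reduce₄ {w = w} {a} {b} {c} w∈ ts tt tw sw rec =
        extend {Step = R} (C₄⇒R (step₄ (Cut₃.frontier cut′) H-cubic real′)) (rec (Grafted₃.state₃ cut′) sw)
        where
        module S = IsTriple ts
        module T = IsTriple tt
        module W = IsTriple tw
        vs = s ∷ t ∷ w ∷ []
        U′ = U - s - t - w
        s∉ : s ∉ U′
        s∉ = ∉-removals⁺ vs (inj₂ (here refl))
        t∉ : t ∉ U′
        t∉ = ∉-removals⁺ vs (inj₂ (at₁ refl))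
        w∉ : w ∉ U′
        w∉ = ∉-removals⁺ vs (inj₂ (at₂ refl))
        a∈ = outer₁ st s≢t ts
        b∈ = outer₂ st s≢t tt
        c∈ = inner w∈ (irr S.Pb) (irr T.Pb) W.Pc
        cut′ : Cut₃ U′ s w t a c b
        cut′ = record
          { p₁∉ = s∉ ; p₂∉ = w∉ ; p₃∉ = t∉
          ; s₁∈ = a∈ ∈- irr S.Pc ∈- s≢ S.Pc ∈- (S.b≢c ∘ sym)
          ; s₂∈ = c∈ ∈- (W.a≢c ∘ sym) ∈- (W.b≢c ∘ sym) ∈- irr W.Pc
          ; s₃∈ = b∈ ∈- avoids T.Pc (s≁t ∘ ~-sym) ∈- irr T.Pc ∈- (T.b≢c ∘ sym)
          ; e₁ = S.Pc ; e₂ = W.Pc ; e₃ = T.Pc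
          ; p₁≢p₂ = irr S.Pb ∘ sym ; p₁≢p₃ = s≢t ; p₂≢p₃ = irr T.Pb
          ; crosses = prune (crosses-visit (crosses-visit (crosses-visit crosses ts) tt) tw)
              ( gone s∉ ∷ gone t∉ ∷ (λ _ → at₁ refl)
              ∷ gone (∉-removals⁺ vs (inj₁ p₂∉)) ∷ gone w∉ ∷ (λ _ → at₂ refl)
              ∷ gone (∉-removals⁺ vs (inj₁ p₁∉)) ∷ gone w∉ ∷ (λ _ → here refl)
              ∷ gone s∉ ∷ gone t∉ ∷ [])
          }
        real′ : Realises G (Layout.E layout₄) (lookup (a ∷ c ∷ b ∷ [])) U′ H
        real′ = record
          { cov = absorb (w∈ ∈- irr S.Pb ∈- irr T.Pb) (absorb t∈s (absorb s₁∈ cov))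
          ; joined = case joined of λ { (ux₁ ∷ ux₂ ∷ ux₃ ∷ vx₁ ∷ vx₂ ∷ vx₃ ∷ x₂y ∷ x₃y ∷ f₁ ∷ f₂ ∷ []) →
              ux₁ ∷ ux₂ ∷ ux₃ ∷ vx₁ ∷ vx₂ ∷ vx₃ ∷ x₂y ∷ x₃y ∷ f₁ ∷ f₂
              ∷ tail⁺ s₁∈ w∈ S.Pb ∷ tail⁺ s₂∈ w∈ T.Pb
              ∷ tail⁺ s₁∈ a∈ S.Pc ∷ tail⁺ w∈ c∈ W.Pc ∷ tail⁺ s₂∈ b∈ T.Pc ∷ [] }
          ; tail⁺ = λ r∈ r′∈ → tail⁺ (un r∈) (un r′∈)
          ; tail⁻ = λ r∈ r′∈ → tail⁻ (un r∈) (un r′∈)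
          }
          where
          un : x ∈ U′ → x ∈ U
          un = proj₁ ∘ ∈-removals⁻ vs

      by-C₄ : ∀ {w} → w ∈ U → s ~ w → t ~ w → Sweep G j (U - s - t - w) → Goal₃ j → Goal H
      by-C₄ w∈ s~w t~w sw rec =
        let _ , ts = neighbours₂ (~-sym e₁) s~w (λ { refl → p₁∉ w∈ })
            _ , tt = neighbours₂ (~-sym e₂) t~w (λ { refl → p₂∉ w∈ })
            _ , tw = neighbours₂ (~-sym s~w) (~-sym t~w) s≢t
        in reduce₄ w∈ ts tt tw sw rec

      -- Again three edges remain, now from w₁, w₂ and t, and the smaller graph carries a K₂,₃. The
      -- step C₃ inserts y, s, w₁, w₂, t and z at once, y being the last vertex of `K₃,₃⁻`.
      reduce₃ : ∀ {w₁ w₂ z a₁ a₂ a₃} → ¬ w₁ ~ t → ¬ w₂ ~ t → z ∈ U - s - t - w₁ - w₂ → IsTriple (s ~_) p₁ w₁ w₂ →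
                IsTriple (t ~_) p₂ z a₃ → IsTriple (w₁ ~_) s z a₁ → IsTriple (w₂ ~_) s z a₂ →
                IsTriple (z ~_) w₁ w₂ t → Sweep G j (U - s - t - w₁ - w₂ - z) → Goal₃ j → Goal H
      reduce₃ {w₁ = w₁} {w₂} {z} {a₁} {a₂} {a₃} w₁≁t w₂≁t z∈′ ts tt tw₁ tw₂ tz sw rec =
        extend {Step = R} (C₃⇒R (step₃ (Cut₃.frontier cut′) H-cubic real′)) (rec (Grafted₃.state₃ cut′) sw)
        where
        module S = IsTriple ts
        module T = IsTriple tt
        module W₁ = IsTriple tw₁
        module W₂ = IsTriple tw₂
        vs = s ∷ t ∷ w₁ ∷ w₂ ∷ z ∷ []
        U′ = U - s - t - w₁ - w₂ - z
        s∉ : s ∉ U′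
        s∉ = ∉-removals⁺ vs (inj₂ (here refl))
        t∉ : t ∉ U′
        t∉ = ∉-removals⁺ vs (inj₂ (at₁ refl))
        w₁∉ : w₁ ∉ U′
        w₁∉ = ∉-removals⁺ vs (inj₂ (at₂ refl))
        w₂∉ : w₂ ∉ U′
        w₂∉ = ∉-removals⁺ vs (inj₂ (at₃ refl))
        z∉ : z ∉ U′
        z∉ = x∉p-x
        z∈ : z ∈ U
        z∈ = proj₁ (∈-removals⁻ (s ∷ t ∷ w₁ ∷ w₂ ∷ []) z∈′)
        w₁≁w₂ : ¬ w₁ ~ w₂
        w₁≁w₂ e = triangle-free S.Pb e (~-sym S.Pc)
        w₁∈ : w₁ ∈ U
        w₁∈ = outer₁ st s≢t (swap₂₃ ts)
        w₂∈ : w₂ ∈ U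
        w₂∈ = outer₁ st s≢t ts
        a₁∈ = inner w₁∈ (irr S.Pb) (s≢ S.Pb) W₁.Pc
        a₂∈ = inner w₂∈ (irr S.Pc) (s≢ S.Pc) W₂.Pc
        a₃∈ = outer₂ st s≢t tt
        cut′ : Cut₃ U′ w₁ w₂ t a₁ a₂ a₃
        cut′ = record
          { p₁∉ = w₁∉ ; p₂∉ = w₂∉ ; p₃∉ = t∉
          ; s₁∈ = ∈-removals⁺ a₁∈
              ((W₁.a≢c ∘ sym) ∷ avoids W₁.Pc w₁≁t ∷ irr W₁.Pc ∷ avoids W₁.Pc w₁≁w₂ ∷ (W₁.b≢c ∘ sym) ∷ [])
          ; s₂∈ = ∈-removals⁺ a₂∈
              ((W₂.a≢c ∘ sym) ∷ avoids W₂.Pc w₂≁t ∷ avoids W₂.Pc (w₁≁w₂ ∘ ~-sym) ∷ irr W₂.Pc ∷ (W₂.b≢c ∘ sym) ∷ [])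
          ; s₃∈ = ∈-removals⁺ a₃∈
              (avoids T.Pc (s≁t ∘ ~-sym) ∷ irr T.Pc ∷ avoids T.Pc (w₁≁t ∘ ~-sym)
              ∷ avoids T.Pc (w₂≁t ∘ ~-sym) ∷ (T.b≢c ∘ sym) ∷ [])
          ; e₁ = W₁.Pc ; e₂ = W₂.Pc ; e₃ = T.Pc
          ; p₁≢p₂ = S.b≢c ; p₁≢p₃ = s≢ S.Pb ; p₂≢p₃ = s≢ S.Pc
          ; crosses = prune
              (crosses-visit (crosses-visit (crosses-visit (crosses-visit (crosses-visit crosses ts) tt) tw₁) tw₂) tz)
              ( gone w₁∉ ∷ gone w₂∉ ∷ gone t∉
              ∷ gone s∉ ∷ gone z∉ ∷ (λ _ → at₁ refl)
              ∷ gone s∉ ∷ gone z∉ ∷ (λ _ → here refl)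
              ∷ gone (∉-removals⁺ vs (inj₁ p₂∉)) ∷ gone z∉ ∷ (λ _ → at₂ refl)
              ∷ gone (∉-removals⁺ vs (inj₁ p₁∉)) ∷ gone w₁∉ ∷ gone w₂∉
              ∷ gone s∉ ∷ gone t∉ ∷ [])
          }
        real′ : Realises G (Layout.E layout₃) (lookup (a₁ ∷ a₂ ∷ a₃ ∷ [])) U′ H
        real′ = record
          { cov = absorb z∈′ (absorb (∈-removals⁺ w₂∈ (irr S.Pc ∷ s≢ S.Pc ∷ (S.b≢c ∘ sym) ∷ []))
                    (absorb (∈-removals⁺ w₁∈ (irr S.Pb ∷ s≢ S.Pb ∷ [])) (absorb t∈s (absorb s₁∈ cov))))
          ; joined = case joined of λ { (ux₁ ∷ ux₂ ∷ ux₃ ∷ vx₁ ∷ vx₂ ∷ vx₃ ∷ x₂y ∷ x₃y ∷ f₁ ∷ f₂ ∷ []) →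
              ux₁ ∷ ux₂ ∷ ux₃ ∷ vx₁ ∷ vx₂ ∷ vx₃ ∷ x₂y ∷ x₃y ∷ f₁ ∷ f₂
              ∷ tail⁺ s₁∈ w₁∈ S.Pb ∷ tail⁺ s₁∈ w₂∈ S.Pc
              ∷ tail⁺ w₁∈ z∈ W₁.Pb ∷ tail⁺ w₂∈ z∈ W₂.Pb ∷ tail⁺ s₂∈ z∈ T.Pb
              ∷ tail⁺ w₁∈ a₁∈ W₁.Pc ∷ tail⁺ w₂∈ a₂∈ W₂.Pc ∷ tail⁺ s₂∈ a₃∈ T.Pc ∷ [] }
          ; tail⁺ = λ r∈ r′∈ → tail⁺ (un r∈) (un r′∈)
          ; tail⁻ = λ r∈ r′∈ → tail⁻ (un r∈) (un r′∈)
          }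
          where
          un : x ∈ U′ → x ∈ U
          un = proj₁ ∘ ∈-removals⁻ vs

      by-C₃ : ∀ {w₁ w₂ z} → ¬ w₁ ~ t → ¬ w₂ ~ t → z ∈ U - s - t - w₁ - w₂ → IsTriple (s ~_) p₁ w₁ w₂ →
              z ~ w₁ → z ~ w₂ → z ~ t → Sweep G j (U - s - t - w₁ - w₂ - z) → Goal₃ j → Goal H
      by-C₃ {w₁ = w₁} {w₂} w₁≁t w₂≁t z∈′ ts z~w₁ z~w₂ z~t sw rec =
        let z∈ , z≢ = ∈-removals⁻ (s ∷ t ∷ w₁ ∷ w₂ ∷ []) z∈′
            z≢s = All.head z≢
            _ , tt = neighbours₂ (~-sym e₂) (~-sym z~t) (λ { refl → p₂∉ z∈ })
            _ , tw₁ = neighbours₂ (~-sym S.Pb) (~-sym z~w₁) (z≢s ∘ sym)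
            _ , tw₂ = neighbours₂ (~-sym S.Pc) (~-sym z~w₂) (z≢s ∘ sym)
            tz = neighbours₃-are z~w₁ z~w₂ z~t S.b≢c (s≢ S.Pb) (s≢ S.Pc)
        in reduce₃ w₁≁t w₂≁t z∈′ ts tt tw₁ tw₂ tz sw rec
        where module S = IsTriple ts

      module _ {w₁ w₂} (ts : IsTriple (s ~_) p₁ w₁ w₂) where
        private
          module S = IsTriple ts
          w₁∈ : w₁ ∈ U
          w₁∈ = outer₁ st s≢t (swap₂₃ ts)
          w₂∈ : w₂ ∈ U
          w₂∈ = outer₁ st s≢t ts
          w₁≁w₂ : ¬ w₁ ~ w₂
          w₁≁w₂ e = triangle-free S.Pb e (~-sym S.Pc)
          w₂∈′ : w₂ ∈ U - s - t - w₁
          w₂∈′ = ∈-removals⁺ w₂∈ (irr S.Pc ∷ s≢ S.Pc ∷ (S.b≢c ∘ sym) ∷ [])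
          inner₁ : w₁ ~ y → y ∈ U
          inner₁ = inner w₁∈ (irr S.Pb) (s≢ S.Pb)
          inner₂ : w₂ ~ y → y ∈ U
          inner₂ = inner w₂∈ (irr S.Pc) (s≢ S.Pc)
          only-s : ∀ {v} → v ∈ U → v ≢ w₁ → v ≢ w₂ → ¬ s ~ v
          only-s v∈ v≢w₁ v≢w₂ e with S.only e
          ... | inj₁ refl = p₁∉ v∈
          ... | inj₂ (inj₁ v≡w₁) = v≢w₁ v≡w₁
          ... | inj₂ (inj₂ v≡w₂) = v≢w₂ v≡w₂

        -- The visited neighbours of w₁ and w₂ are among s and z, those of t among p₂ and z; so
        -- these three are on the boundary and the new vertex z is not. Since s already has the
        -- neighbours p₁, w₁, w₂, the neighbours of z are w₁, w₂ and t.
        all-independent : ¬ w₁ ~ t → ¬ w₂ ~ t → Sweep G j (U - s - t - w₁ - w₂) →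
                          (∀ {i} → i < j → Goal₃ i) → Goal H
        all-independent w₁≁t w₂≁t sw rec
          with advancing G cubic sw (few-visited G cubic {e₂ = s}
            (∉-removals⁺ (s ∷ t ∷ w₁ ∷ w₂ ∷ []) (inj₂ (at₂ refl)))
            λ e y∉ → case ∉-removals⁻ (s ∷ t ∷ w₁ ∷ w₂ ∷ []) y∉ of λ
              { (inj₁ y∉U) → contradiction (inner₁ e) y∉U
              ; (inj₂ (here y≡s)) → inj₁ y≡s
              ; (inj₂ (at₁ refl)) → contradiction e w₁≁t
              ; (inj₂ (at₂ refl)) → contradiction e ~-irrefl
              ; (inj₂ (at₃ refl)) → contradiction e w₁≁w₂ })
        ... | advance {v = z} z∈′ _ _ narrow sw′ =
          by-C₃ w₁≁t w₂≁t z∈′ ts (proj₁ z~) (proj₁ (proj₂ z~)) (proj₂ (proj₂ z~)) sw′ (rec ≤-refl)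
          where
          vs = s ∷ t ∷ w₁ ∷ w₂ ∷ z ∷ []
          U′ = U - s - t - w₁ - w₂ - z
          z∈ : z ∈ U
          z∈ = proj₁ (∈-removals⁻ (s ∷ t ∷ w₁ ∷ w₂ ∷ []) z∈′)
          z≢ : All (z ≢_) (s ∷ t ∷ w₁ ∷ w₂ ∷ [])
          z≢ = proj₂ (∈-removals⁻ (s ∷ t ∷ w₁ ∷ w₂ ∷ []) z∈′)
          z≢s = All.lookup z≢ (here refl)
          z≢t = All.lookup z≢ (at₁ refl)
          z≢w₁ = All.lookup z≢ (at₂ refl)
          z≢w₂ = All.lookup z≢ (at₃ refl)
          seen-z : z ~ y → y ∉ U′ → y ≡ w₁ ⊎ y ≡ w₂ ⊎ y ≡ t
          seen-z e y∉ with ∉-removals⁻ vs y∉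
          ... | inj₁ y∉U = contradiction (inner z∈ z≢s z≢t e) y∉U
          ... | inj₂ (here refl) = contradiction (~-sym e) (only-s z∈ z≢w₁ z≢w₂)
          ... | inj₂ (at₁ y≡t) = inj₂ (inj₂ y≡t)
          ... | inj₂ (at₂ y≡w₁) = inj₁ y≡w₁
          ... | inj₂ (at₃ y≡w₂) = inj₂ (inj₁ y≡w₂)
          ... | inj₂ (at₄ refl) = contradiction e ~-irrefl
          ¬boundary-z : ¬ Boundary G U′ z
          ¬boundary-z bz = narrow
            ( (S.b≢c ∷ s≢ S.Pb ∷ (z≢w₁ ∘ sym) ∷ [])
            ∷ (s≢ S.Pc ∷ (z≢w₂ ∘ sym) ∷ []) ∷ ((z≢t ∘ sym) ∷ []) ∷ [] ∷ [])
            ( few-visited G cubic (∉-removals⁺ vs (inj₂ (at₂ refl))) (λ e y∉ → case ∉-removals⁻ vs y∉ of λ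
              { (inj₁ y∉U) → contradiction (inner₁ e) y∉U
              ; (inj₂ (here y≡s)) → inj₁ y≡s
              ; (inj₂ (at₁ refl)) → contradiction e w₁≁t
              ; (inj₂ (at₂ refl)) → contradiction e ~-irrefl
              ; (inj₂ (at₃ refl)) → contradiction e w₁≁w₂
              ; (inj₂ (at₄ y≡z)) → inj₂ y≡z })
            ∷ few-visited G cubic (∉-removals⁺ vs (inj₂ (at₃ refl))) (λ e y∉ → case ∉-removals⁻ vs y∉ of λ
              { (inj₁ y∉U) → contradiction (inner₂ e) y∉U
              ; (inj₂ (here y≡s)) → inj₁ y≡s
              ; (inj₂ (at₁ refl)) → contradiction e w₂≁t
              ; (inj₂ (at₂ refl)) → contradiction (~-sym e) w₁≁w₂
              ; (inj₂ (at₃ refl)) → contradiction e ~-irrefl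
              ; (inj₂ (at₄ y≡z)) → inj₂ y≡z })
            ∷ few-visited G cubic (∉-removals⁺ vs (inj₂ (at₁ refl))) (λ e y∉ → case ∉-removals⁻ vs y∉ of λ
              { (inj₁ y∉U) → inj₁ (parent₂ s≢t e y∉U)
              ; (inj₂ (here refl)) → contradiction (~-sym e) s≁t
              ; (inj₂ (at₁ refl)) → contradiction e ~-irrefl
              ; (inj₂ (at₂ refl)) → contradiction (~-sym e) w₁≁t
              ; (inj₂ (at₃ refl)) → contradiction (~-sym e) w₂≁t
              ; (inj₂ (at₄ y≡z)) → inj₂ y≡z })
            ∷ bz ∷ [])
          z~ : z ~ w₁ × z ~ w₂ × z ~ t
          z~ = saturates G cubic x∉p-x ¬boundary-z seen-z

        after-stww : Narrow G (U - s - t - w₁ - w₂) → Sweep G j (U - s - t - w₁ - w₂) →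
                     (∀ {i} → i ≤ suc j → Goal₃ i) → Goal H
        after-stww narrow sw rec with adj? w₁ t | adj? w₂ t
        ... | yes w₁~t | _ = by-C₄ w₁∈ S.Pb (~-sym w₁~t) (visit w₂∈′ narrow sw) (rec ≤-refl)
        ... | no _ | yes w₂~t = by-C₄ w₂∈ S.Pc (~-sym w₂~t)
                (visit (∈-removals⁺ w₁∈ (irr S.Pb ∷ s≢ S.Pb ∷ S.b≢c ∷ []))
                  (subst (Narrow G) reorder narrow) (subst (Sweep G _) reorder sw)) (rec ≤-refl)
          where
          reorder : U - s - t - w₁ - w₂ ≡ U - s - t - w₂ - w₁
          reorder = p─x─y≡p─y─x (U - s - t) w₁ w₂
        ... | no w₁≁t | no w₂≁t = all-independent w₁≁t w₂≁t sw (λ i<j → rec (<⇒≤ (m<n⇒m<1+n i<j)))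

        -- If w₁ is not adjacent to t, the next attached visit v is w₂: otherwise s, w₁, t and v are
        -- on the boundary.
        after-stw : Sweep G j (U - s - t - w₁) → (∀ {i} → i ≤ j → Goal₃ i) → Goal H
        after-stw sw rec with adj? w₁ t
        ... | yes w₁~t = by-C₄ w₁∈ S.Pb (~-sym w₁~t) sw (rec ≤-refl)
        ... | no w₁≁t
          with advancing G cubic sw (∉-removals⁺ (s ∷ t ∷ w₁ ∷ []) (inj₂ (here refl)) , w₂ , w₂∈′ , S.Pc)
        ...   | advance {v = v} v∈ _ _ narrow sw′ with v ≟ w₂
        ...     | yes refl = after-stww narrow sw′ rec
        ...     | no v≢w₂ = ⊥-elim (narrow
          ( ((irr S.Pb ∘ sym) ∷ s≢t ∷ (v≢s ∘ sym) ∷ [])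
          ∷ (s≢ S.Pb ∷ (v≢w₁ ∘ sym) ∷ []) ∷ ((v≢t ∘ sym) ∷ []) ∷ [] ∷ [])
          ( (∉-removals⁺ vs (inj₂ (here refl)) , w₂ , w₂∈′ ∈- (v≢w₂ ∘ sym) , S.Pc)
          ∷ few-visited G cubic (∉-removals⁺ vs (inj₂ (at₂ refl))) (λ e y∉ → case ∉-removals⁻ vs y∉ of λ
            { (inj₁ y∉U) → contradiction (inner₁ e) y∉U
            ; (inj₂ (here y≡s)) → inj₁ y≡s
            ; (inj₂ (at₁ refl)) → contradiction e w₁≁t
            ; (inj₂ (at₂ refl)) → contradiction e ~-irrefl
            ; (inj₂ (at₃ y≡v)) → inj₂ y≡v })
          ∷ few-visited G cubic (∉-removals⁺ vs (inj₂ (at₁ refl))) (λ e y∉ → case ∉-removals⁻ vs y∉ of λ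
            { (inj₁ y∉U) → inj₁ (parent₂ s≢t e y∉U)
            ; (inj₂ (here refl)) → contradiction (~-sym e) s≁t
            ; (inj₂ (at₁ refl)) → contradiction e ~-irrefl
            ; (inj₂ (at₂ refl)) → contradiction (~-sym e) w₁≁t
            ; (inj₂ (at₃ y≡v)) → inj₂ y≡v })
          ∷ few-visited G cubic (∉-removals⁺ vs (inj₂ (at₃ refl))) (λ e y∉ → case ∉-removals⁻ vs y∉ of λ
            { (inj₁ y∉U) → contradiction (inner v∈U v≢s v≢t e) y∉U
            ; (inj₂ (here refl)) → contradiction (~-sym e) (only-s v∈U v≢w₁ v≢w₂)
            ; (inj₂ (at₁ y≡t)) → inj₁ y≡t
            ; (inj₂ (at₂ y≡w₁)) → inj₂ y≡w₁
            ; (inj₂ (at₃ refl)) → contradiction e ~-irrefl })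
          ∷ []))
          where
          vs = s ∷ t ∷ w₁ ∷ v ∷ []
          v∈U = proj₁ (∈-removals⁻ (s ∷ t ∷ w₁ ∷ []) v∈)
          v≢ : All (v ≢_) (s ∷ t ∷ w₁ ∷ [])
          v≢ = proj₂ (∈-removals⁻ (s ∷ t ∷ w₁ ∷ []) v∈)
          v≢s = All.lookup v≢ (here refl)
          v≢t = All.lookup v≢ (at₁ refl)
          v≢w₁ = All.lookup v≢ (at₂ refl)

        -- Here both neighbours of s precede t. The next attached visit v is t, because otherwise
        -- p₂, w₁, w₂ and v are on the boundary; reordering then gives the case in which t comes
        -- second.
        after-sww : Sweep G j (U - s - w₁ - w₂) → (∀ {i} → i ≤ j → Goal₃ i) → Goal H
        after-sww sw rec
          with advancing G cubic sw
            (∉-removals⁺ (s ∷ w₁ ∷ w₂ ∷ []) (inj₁ p₂∉) , t , t∈s ∈- (s≢ S.Pb ∘ sym) ∈- (s≢ S.Pc ∘ sym) , e₂)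
        ... | advance {v = v} v∈ _ _ narrow sw′ with v ≟ t
        ...   | yes refl = after-stww (subst (Narrow G) reorder narrow) (subst (Sweep G _) reorder sw′) rec
          where
          reorder : U - s - w₁ - w₂ - t ≡ U - s - t - w₁ - w₂
          reorder = trans (p─x─y≡p─y─x (U - s - w₁) w₂ t) (cong (_- w₂) (p─x─y≡p─y─x (U - s) w₁ t))
        ...   | no v≢t = ⊥-elim (narrow
          ( ((λ { refl → p₂∉ w₁∈ }) ∷ (λ { refl → p₂∉ w₂∈ }) ∷ (λ { refl → p₂∉ v∈U }) ∷ [])
          ∷ (S.b≢c ∷ (v≢w₁ ∘ sym) ∷ []) ∷ ((v≢w₂ ∘ sym) ∷ []) ∷ [] ∷ [])
          ( (∉-removals⁺ vs (inj₁ p₂∉) , t , t∈s ∈- (s≢ S.Pb ∘ sym) ∈- (s≢ S.Pc ∘ sym) ∈- (v≢t ∘ sym) , e₂)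
          ∷ few-visited G cubic (∉-removals⁺ vs (inj₂ (at₁ refl))) (λ e y∉ → case ∉-removals⁻ vs y∉ of λ
            { (inj₁ y∉U) → contradiction (inner₁ e) y∉U
            ; (inj₂ (here y≡s)) → inj₁ y≡s
            ; (inj₂ (at₁ refl)) → contradiction e ~-irrefl
            ; (inj₂ (at₂ refl)) → contradiction e w₁≁w₂
            ; (inj₂ (at₃ y≡v)) → inj₂ y≡v })
          ∷ few-visited G cubic (∉-removals⁺ vs (inj₂ (at₂ refl))) (λ e y∉ → case ∉-removals⁻ vs y∉ of λ
            { (inj₁ y∉U) → contradiction (inner₂ e) y∉U
            ; (inj₂ (here y≡s)) → inj₁ y≡s
            ; (inj₂ (at₁ refl)) → contradiction (~-sym e) w₁≁w₂
            ; (inj₂ (at₂ refl)) → contradiction e ~-irrefl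
            ; (inj₂ (at₃ y≡v)) → inj₂ y≡v })
          ∷ few-visited G cubic (∉-removals⁺ vs (inj₂ (at₃ refl))) (λ e y∉ → case ∉-removals⁻ vs y∉ of λ
            { (inj₁ y∉U) → contradiction (inner v∈U v≢s v≢t e) y∉U
            ; (inj₂ (here refl)) → contradiction (~-sym e) (only-s v∈U v≢w₁ v≢w₂)
            ; (inj₂ (at₁ y≡w₁)) → inj₁ y≡w₁
            ; (inj₂ (at₂ y≡w₂)) → inj₂ y≡w₂
            ; (inj₂ (at₃ refl)) → contradiction e ~-irrefl })
          ∷ []))
          where
          vs = s ∷ w₁ ∷ w₂ ∷ v ∷ []
          v∈U = proj₁ (∈-removals⁻ (s ∷ w₁ ∷ w₂ ∷ []) v∈)
          v≢ : All (v ≢_) (s ∷ w₁ ∷ w₂ ∷ [])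
          v≢ = proj₂ (∈-removals⁻ (s ∷ w₁ ∷ w₂ ∷ []) v∈)
          v≢s = All.lookup v≢ (here refl)
          v≢w₁ = All.lookup v≢ (at₁ refl)
          v≢w₂ = All.lookup v≢ (at₂ refl)

        -- The next attached visit v is t or w₂: otherwise p₂, s, w₁ and v are on the boundary.
        after-sw : Sweep G j (U - s - w₁) → (∀ {i} → i ≤ j → Goal₃ i) → Goal H
        after-sw sw rec
          with advancing G cubic sw (∉-removals⁺ (s ∷ w₁ ∷ []) (inj₁ p₂∉) , t , t∈s ∈- (s≢ S.Pb ∘ sym) , e₂)
        ... | advance {v = v} v∈ _ _ narrow sw′ with v ≟ t | v ≟ w₂
        ...   | yes refl | _ =
          after-stw (subst (Sweep G _) (p─x─y≡p─y─x (U - s) w₁ t) sw′) (λ i≤j → rec (≤-trans i≤j (n≤1+n _)))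
        ...   | no _ | yes refl = after-sww sw′ (λ i≤j → rec (≤-trans i≤j (n≤1+n _)))
        ...   | no v≢t | no v≢w₂ = ⊥-elim (narrow
          ( ((λ { refl → p₂∉ s₁∈ }) ∷ (λ { refl → p₂∉ w₁∈ }) ∷ (λ { refl → p₂∉ v∈U }) ∷ [])
          ∷ ((irr S.Pb ∘ sym) ∷ (v≢s ∘ sym) ∷ []) ∷ ((v≢w₁ ∘ sym) ∷ []) ∷ [] ∷ [])
          ( (∉-removals⁺ vs (inj₁ p₂∉) , t , t∈s ∈- (s≢ S.Pb ∘ sym) ∈- (v≢t ∘ sym) , e₂)
          ∷ (∉-removals⁺ vs (inj₂ (here refl)) , w₂ , w₂∈ ∈- irr S.Pc ∈- (S.b≢c ∘ sym) ∈- (v≢w₂ ∘ sym) , S.Pc)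
          ∷ few-visited G cubic (∉-removals⁺ vs (inj₂ (at₁ refl))) (λ e y∉ → case ∉-removals⁻ vs y∉ of λ
            { (inj₁ y∉U) → contradiction (inner₁ e) y∉U
            ; (inj₂ (here y≡s)) → inj₁ y≡s
            ; (inj₂ (at₁ refl)) → contradiction e ~-irrefl
            ; (inj₂ (at₂ y≡v)) → inj₂ y≡v })
          ∷ few-visited G cubic {e₂ = w₁} (∉-removals⁺ vs (inj₂ (at₂ refl))) (λ e y∉ → case ∉-removals⁻ vs y∉ of λ
            { (inj₁ y∉U) → contradiction (inner v∈U v≢s v≢t e) y∉U
            ; (inj₂ (here refl)) → contradiction (~-sym e) (only-s v∈U v≢w₁ v≢w₂)
            ; (inj₂ (at₁ y≡w₁)) → inj₁ y≡w₁
            ; (inj₂ (at₂ refl)) → contradiction e ~-irrefl })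
          ∷ []))
          where
          vs = s ∷ w₁ ∷ v ∷ []
          v∈U = proj₁ (∈-removals⁻ (s ∷ w₁ ∷ []) v∈)
          v≢ : All (v ≢_) (s ∷ w₁ ∷ [])
          v≢ = proj₂ (∈-removals⁻ (s ∷ w₁ ∷ []) v∈)
          v≢s = All.lookup v≢ (here refl)
          v≢w₁ = All.lookup v≢ (at₁ refl)

      after-stv : ∀ {v} → v ∈ U → s ~ v → Sweep G j (U - s - t - v) → (∀ {i} → i ≤ j → Goal₃ i) → Goal H
      after-stv v∈ s~v sw rec =
        let _ , ts = neighbours₂ (~-sym e₁) s~v (λ { refl → p₁∉ v∈ }) in after-stw ts sw rec

    module _ {U p₁ p₂ s t H} (st : State₂ U p₁ p₂ s t H) (s≢t : s ≢ t) (s≁t : ¬ s ~ t) where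
      open State₂ st

      after-st : Sweep G k (U - s - t) → (∀ {i} → i < k → Goal₃ i) → Goal H
      after-st sw rec
        with advancing G cubic sw (few-visited G cubic {e₂ = p₁} (∉-removals⁺ (s ∷ t ∷ []) (inj₂ (here refl)))
          λ e y∉ → case ∉-removals⁻ (s ∷ t ∷ []) y∉ of λ
            { (inj₁ y∉U) → inj₁ (parent₁ s≢t e y∉U)
            ; (inj₂ (here refl)) → contradiction e ~-irrefl
            ; (inj₂ (at₁ refl)) → contradiction e s≁t })
      ... | advance v∈ x∉ x~v _ sw′ with ∈-removals⁻ (s ∷ t ∷ []) v∈ | ∉-removals⁻ (s ∷ t ∷ []) x∉
      ...   | v∈U , v≢s ∷ v≢t ∷ [] | inj₁ x∉U = contradiction (inner v∈U v≢s v≢t (~-sym x~v)) x∉U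
      ...   | v∈U , _ | inj₂ (here refl) = after-stv st s≢t s≁t v∈U x~v sw′ (rec ∘ s≤s)
      ...   | v∈U , _ | inj₂ (at₁ refl) =
        after-stv (swap₂ st) (s≢t ∘ sym) (s≁t ∘ ~-sym) v∈U x~v
          (subst (λ U → Sweep G _ (U - _)) (p─x─y≡p─y─x U s t) sw′) (rec ∘ s≤s)

      apart-after-s : Sweep G k (U - s) → (∀ {i} → i < k → Goal₃ i) → Goal H
      apart-after-s sw rec with advancing G cubic sw (∉⇒∉- p₂∉ , t , t∈-s st s≢t , e₂)
      ... | advance {v = v} v∈ x∉ x~v _ sw′ with ∈-remove⁻ v∈ | ∉-remove⁻ x∉
      ...   | v∈U , v≢s | inj₁ x∉U = case crosses x∉U v∈U x~v of λ
        { (here eq) → contradiction (cong proj₂ eq) v≢s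
        ; (at₁ refl) → after-st sw′ (rec ∘ m<n⇒m<1+n) }
      ...   | v∈U , v≢s | inj₂ refl =
        let _ , ts = neighbours₂ (~-sym e₁) x~v (λ { refl → p₁∉ v∈U })
        in after-sw st s≢t s≁t ts sw′ (rec ∘ s≤s)

    apart : ∀ {s t} → State₂ U p₁ p₂ s t H → s ≢ t → ¬ s ~ t → Sweep G k U → (∀ {i} → i < k → Goal₃ i) → Goal H
    apart st s≢t s≁t sw rec = first-visit st sw
      (λ j<k sw′ → apart-after-s st s≢t s≁t sw′ (λ i<j → rec (<-trans i<j j<k)))
      (λ j<k sw′ → apart-after-s (swap₂ st) (s≢t ∘ sym) (s≁t ∘ ~-sym) sw′ (λ i<j → rec (<-trans i<j j<k)))

    reduce-State₂ : State₂ U p₁ p₂ s₁ s₂ H → Sweep G k U →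
                    (∀ {i} → i < k → Goal₂ i) → (∀ {i} → i < k → Goal₃ i) → Goal H
    reduce-State₂ {s₁ = s} {s₂ = t} st sw rec₂ rec₃ with s ≟ t | adj? s t
    ... | yes refl | _       = by-C₆ st sw rec₂
    ... | no s≢t   | yes s~t = adjacent st s≢t s~t sw rec₂
    ... | no s≢t   | no s≁t  = apart st s≢t s≁t sw rec₃

-- Consequences of girth and connectivity

no-triangles : ∀ {G} → HasGirth G 4 → ∀ {a b c} → Adj G a b → Adj G b c → Adj G c a → ⊥
no-triangles {G} (_ , minimal) {a} {b} {c} ab bc ca = case minimal 3 abc of λ { (s≤s (s≤s (s≤s ()))) }
  where
  apart : ∀ {x y} → Adj G x y → x ≢ y
  apart e eq = Graph.irrefl G eq e
  abc : Cycle G 3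
  abc = record
    { start    = a
    ; rest     = b ∷ c ∷ []
    ; distinct = (apart ab ∷ (apart ca ∘ sym) ∷ []) ∷ (apart bc ∷ []) ∷ [] ∷ []
    ; closed   = ab ∷ bc ∷ ca ∷ [-]
    ; length≡ℓ = refl
    ; 3≤ℓ      = ≤-refl
    }

3-connected⇒connected : ∀ {G} → (3 -Connected) G → Connected G
3-connected⇒connected {G} (_ , walk) x y =
  Star.map proj₁ (walk Subset.⊥ (≤-trans (≤-reflexive (cong suc (∣⊥∣≡0 (Graph.order G)))) (s≤s z≤n)) x y ∉⊥ ∉⊥)

∣pair∣≡2 : ∀ {n} {x y : Fin n} → x ≢ y → ∣ ⁅ x ⁆ ∪ˢ ⁅ y ⁆ ∣ ≡ 2
∣pair∣≡2 {x = x} {y} x≢y = begin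
  ∣ S ∣              ≡⟨ ∣p∣≡1+∣p-x∣ {p = S} (x∈p∪q⁺ (inj₁ (x∈⁅x⁆ x))) ⟩
  suc ∣ S - x ∣      ≡⟨ cong suc (∣p∣≡1+∣p-x∣ {p = S - x} y∈) ⟩
  2 + ∣ S - x - y ∣  ≡⟨ cong (2 +_) (empty⇒∣p∣≡0 none) ⟩
  2                  ∎
  where
  open ≡-Reasoning
  S = ⁅ x ⁆ ∪ˢ ⁅ y ⁆
  y∈ : y ∈ S - x
  y∈ = x∈p∧x≢y⇒x∈p-y (x∈p∪q⁺ (inj₂ (x∈⁅x⁆ y))) (x≢y ∘ sym)
  none : ∀ z → z ∉ S - x - y
  none z z∈ with z∈S , z≢x ∷ z≢y ∷ [] ← ∈-removals⁻ (x ∷ y ∷ []) z∈ =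
    [ z≢x ∘ x∈⁅y⁆⇒x≡y x , z≢y ∘ x∈⁅y⁆⇒x≡y y ]′ (x∈p∪q⁻ ⁅ x ⁆ ⁅ y ⁆ z∈S)

-- Coinciding far ends, and K₃,₃ as the base case

module Conclusion (G : Graph) (cubic : Cubic G)
                  (triangle-free : ∀ {a b c} → Adj G a b → Adj G b c → Adj G c a → ⊥) where
  open Graph G using (order; adj?) renaming (Vertex to V; Adj to _~_; sym to ~-sym)
  open ThreePorts G cubic triangle-free
  open TwoPorts G cubic triangle-free

  private variable
    k j : ℕ
    U : Subset order
    p₁ p₂ p₃ s₁ s₂ s₃ a b c d v w x y : V
    H : Graph

  module _ {U p₁ p₂ p₃ s y H} (st : State₃ U p₁ p₂ p₃ s y y H) (s≢y : s ≢ y) where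
    open State₃ st

    -- p₁ and y separate the rest of U from the other visited vertices.
    ¬3-connected : ¬ (3 -Connected) G
    ¬3-connected (_ , walk) = stuck p₂∉ (walk S (≤-reflexive (cong suc (∣pair∣≡2 p₁≢y))) p₂ s p₂∉S s∉S)
      where
      S = ⁅ p₁ ⁆ ∪ˢ ⁅ y ⁆
      p₁≢y : p₁ ≢ y
      p₁≢y refl = p₁∉ s₂∈
      p₁∈S : p₁ ∈ S
      p₁∈S = x∈p∪q⁺ (inj₁ (x∈⁅x⁆ p₁))
      y∈S : y ∈ S
      y∈S = x∈p∪q⁺ (inj₂ (x∈⁅x⁆ y))
      ∉S : ∀ {x} → x ≢ p₁ → x ≢ y → x ∉ S
      ∉S x≢p₁ x≢y x∈ = [ x≢p₁ ∘ x∈⁅y⁆⇒x≡y p₁ , x≢y ∘ x∈⁅y⁆⇒x≡y y ]′ (x∈p∪q⁻ ⁅ p₁ ⁆ ⁅ y ⁆ x∈)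
      p₂∉S : p₂ ∉ S
      p₂∉S = ∉S (p₁≢p₂ ∘ sym) λ { refl → p₂∉ s₂∈ }
      s∉S : s ∉ S
      s∉S = ∉S (λ { refl → p₁∉ s₁∈ }) s≢y
      stuck : ∀ {x} → x ∉ U → ¬ (G ∖ S ⊢ x ⇝ s)
      stuck x∉ ε = x∉ s₁∈
      stuck x∉ (_◅_ {j = z} (x~z , x∉S , z∉S) walk) with z ∈? U
      ... | no z∉ = stuck z∉ walk
      ... | yes z∈ with crosses x∉ z∈ x~z
      ...   | here refl = x∉S p₁∈S
      ...   | at₁ refl = z∉S y∈S
      ...   | at₂ refl = z∉S y∈S

    -- `H` stays the same: y, joined to x₂ and x₃, completes K₂,₃ to K₃,₃ minus an edge. The cyclic
    -- permutation moves y from label 0F, assigned by `absorb`, to 5F.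
    fork-at : ∀ {t} → IsTriple (y ~_) p₂ p₃ t → State₂ (U - y) p₁ y s t H
    fork-at {t} ty = record
      { cut = record
        { p₁∉ = ∉⇒∉- p₁∉ ; p₂∉ = x∉p-x ; s₁∈ = s₁∈ ∈- s≢y ; s₂∈ = t∈ ∈- (~⇒≢ G cubic Y.Pc ∘ sym)
        ; e₁ = e₁ ; e₂ = Y.Pc ; distinct = λ { (refl , _) → p₁∉ s₂∈ }
        ; crosses = prune (crosses-visit crosses ty)
            ( gone (∉⇒∉- p₂∉) ∷ gone (∉⇒∉- p₃∉) ∷ (λ _ → at₁ refl) ∷ (λ _ → here refl)
            ∷ gone x∉p-x ∷ gone x∉p-x ∷ [])
        }
      ; H-cubic = H-cubic
      ; real = record
        { cov = permute (1F ∷ 2F ∷ 3F ∷ 4F ∷ 5F ∷ 0F ∷ []) (5F ∷ 0F ∷ 1F ∷ 2F ∷ 3F ∷ 4F ∷ [])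
                  (λ { 0F → refl ; 1F → refl ; 2F → refl ; 3F → refl ; 4F → refl ; 5F → refl })
                  (λ { 0F → refl ; 1F → refl ; 2F → refl ; 3F → refl ; 4F → refl ; 5F → refl }) (absorb s₂∈ cov)
        ; joined = case joined of λ { (ux₁ ∷ ux₂ ∷ ux₃ ∷ vx₁ ∷ vx₂ ∷ vx₃ ∷ f₁ ∷ f₂ ∷ f₃ ∷ []) →
            ux₁ ∷ ux₂ ∷ ux₃ ∷ vx₁ ∷ vx₂ ∷ vx₃ ∷ f₂ ∷ f₃ ∷ f₁ ∷ tail⁺ s₂∈ t∈ Y.Pc ∷ [] }
        ; tail⁺ = λ r∈ r′∈ → tail⁺ (un r∈) (un r′∈)
        ; tail⁻ = λ r∈ r′∈ → tail⁻ (un r∈) (un r′∈)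
        }
      }
      where
      module Y = IsTriple ty
      un : x ∈ U - y → x ∈ U
      un = proj₁ ∘ ∈-remove⁻
      t∈ : t ∈ U
      t∈ = decidable-stable (t ∈? U) λ t∉ → case crosses t∉ s₂∈ (~-sym Y.Pc) of λ
        { (here eq) → s≢y (sym (cong proj₂ eq))
        ; (at₁ eq) → Y.a≢c (sym (cong proj₁ eq))
        ; (at₂ eq) → Y.b≢c (sym (cong proj₁ eq)) }

    fork : ∃[ t ] State₂ (U - y) p₁ y s t H
    fork = let _ , ty = neighbours₂ (~-sym e₂) (~-sym e₃) p₂≢p₃ in _ , fork-at ty

    -- The sweep may visit s before y. Then y comes next, since otherwise p₂, p₃, s and the next
    -- vertex v are on the boundary, and the two visits can be exchanged.
    sweep-fork : Sweep G k U → ∃[ j ] (j < k × Sweep G j (U - y))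
    sweep-fork sw with advancing G cubic sw (p₁∉ , s , s₁∈ , e₁)
    ... | advance v∈ x∉ x~v _ sw₁ with crosses x∉ v∈ x~v
    ...   | at₁ refl = _ , ≤-refl , sw₁
    ...   | at₂ refl = _ , ≤-refl , sw₁
    ...   | here refl with advancing G cubic sw₁ (∉⇒∉- p₂∉ , y , s₂∈ ∈- (s≢y ∘ sym) , e₂)
    ...     | advance {v = v} v∈′ _ _ narrow sw₂ with v ≟ y
    ...       | yes refl = _ , ≤-refl , visit (s₁∈ ∈- s≢y) (subst (Narrow G) (p─x─y≡p─y─x U s y) narrow)
                             (subst (Sweep G _) (p─x─y≡p─y─x U s y) sw₂)
    ...       | no v≢y = ⊥-elim (narrow
      ( (p₂≢p₃ ∷ (λ { refl → p₂∉ s₁∈ }) ∷ (λ { refl → p₂∉ v∈U }) ∷ [])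
      ∷ ((λ { refl → p₃∉ s₁∈ }) ∷ (λ { refl → p₃∉ v∈U }) ∷ []) ∷ ((v≢s ∘ sym) ∷ []) ∷ [] ∷ [])
      ( (∉⇒∉- (∉⇒∉- p₂∉) , y , s₂∈ ∈- (s≢y ∘ sym) ∈- (v≢y ∘ sym) , e₂)
      ∷ (∉⇒∉- (∉⇒∉- p₃∉) , y , s₂∈ ∈- (s≢y ∘ sym) ∈- (v≢y ∘ sym) , e₃)
      ∷ few-visited G cubic (∉⇒∉- x∉p-x) (λ e y∉ → case ∉-removals⁻ (s ∷ v ∷ []) y∉ of λ
        { (inj₁ y∉U) → case crosses y∉U s₁∈ (~-sym e) of λ
          { (here eq) → inj₁ (cong proj₁ eq)
          ; (at₁ eq) → contradiction (cong proj₂ eq) s≢y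
          ; (at₂ eq) → contradiction (cong proj₂ eq) s≢y }
        ; (inj₂ (here refl)) → contradiction e ~-irrefl
        ; (inj₂ (at₁ eq)) → inj₂ eq })
      ∷ few-visited G cubic {e₂ = s} x∉p-x (λ e y∉ → case ∉-removals⁻ (s ∷ v ∷ []) y∉ of λ
        { (inj₁ y∉U) → case crosses y∉U v∈U (~-sym e) of λ
          { (here eq) → contradiction (cong proj₂ eq) v≢s
          ; (at₁ eq) → contradiction (cong proj₂ eq) v≢y
          ; (at₂ eq) → contradiction (cong proj₂ eq) v≢y }
        ; (inj₂ (here eq)) → inj₁ eq
        ; (inj₂ (at₁ refl)) → contradiction e ~-irrefl })
      ∷ []))
      where
      v∈U = proj₁ (∈-remove⁻ v∈′)
      v≢s = proj₂ (∈-remove⁻ v∈′)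

  module _ (connected : Connected G) {U p₁ p₂ p₃ s H} (st : State₃ U p₁ p₂ p₃ s s s H) where
    open State₃ st
    private
      -- A walk from an unvisited vertex to p₁ would have to enter the visited part through s, but
      -- the neighbours of s are p₁, p₂, p₃, all visited.
      nothing-left : ∀ {y} → Star _~_ y p₁ → y ∉ U - s
      nothing-left ε y∈ = p₁∉ (proj₁ (∈-remove⁻ y∈))
      nothing-left (_◅_ {j = z} y~z walk) y∈ with z ∈? (U - s)
      ... | yes z∈ = nothing-left walk z∈
      ... | no z∉ with ∈-remove⁻ y∈ | ∉-remove⁻ z∉
      ...   | y∈U , y≢s | inj₁ z∉U = case crosses z∉U y∈U (~-sym y~z) of λ
        { (here eq) → y≢s (cong proj₂ eq)
        ; (at₁ eq) → y≢s (cong proj₂ eq)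
        ; (at₂ eq) → y≢s (cong proj₂ eq) }
      ...   | y∈U , y≢s | inj₂ refl
        with IsTriple.only (neighbours₃-are (~-sym e₁) (~-sym e₂) (~-sym e₃) p₁≢p₂ p₁≢p₃ p₂≢p₃) (~-sym y~z)
      ...     | inj₁ refl = p₁∉ y∈U
      ...     | inj₂ (inj₁ refl) = p₂∉ y∈U
      ...     | inj₂ (inj₂ refl) = p₃∉ y∈U

      empty : ∀ {y} → y ∉ U - s
      empty {y} = nothing-left (connected y p₁)

      Parts : Set
      Parts = Fin 3 ⊎ Fin 3

      parts : Cover Parts Parts (U - s)
      parts = record
        { φ = id ; ψ = λ _ → inj₁ 0F ; φ-inj = id
        ; ψ-inj = λ r∈ → gone empty r∈ ; disjoint = λ r∈ → gone empty r∈ ; cover = λ x → inj₁ (x , refl) }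

      cov′ : Cover (Graph.Vertex H) Parts (U - s)
      -- After absorbing s the labels are s, u, v, x₁, x₂, x₃ in this order, so splitting in the
      -- middle gives the two parts of K₃,₃.
      cov′ = relabel (join 3 3)
        (λ {x} {y} eq → trans (sym (splitAt-join 3 3 x)) (trans (cong (splitAt 3) eq) (splitAt-join 3 3 y)))
        (λ i → splitAt 3 i , join-splitAt 3 3 i) (absorb s₁∈ cov)

      module C = Cover cov′

      left~right : ∀ i j → Adj H (C.φ (inj₁ i)) (C.φ (inj₂ j))
      left~right i j with joined
      left~right 0F 0F | _ ∷ _ ∷ _ ∷ _ ∷ _ ∷ _ ∷ f₁ ∷ f₂ ∷ f₃ ∷ [] = Graph.sym H f₁
      left~right 0F 1F | _ ∷ _ ∷ _ ∷ _ ∷ _ ∷ _ ∷ f₁ ∷ f₂ ∷ f₃ ∷ [] = Graph.sym H f₂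
      left~right 0F 2F | _ ∷ _ ∷ _ ∷ _ ∷ _ ∷ _ ∷ f₁ ∷ f₂ ∷ f₃ ∷ [] = Graph.sym H f₃
      left~right 1F 0F | ux₁ ∷ ux₂ ∷ ux₃ ∷ _ = ux₁
      left~right 1F 1F | ux₁ ∷ ux₂ ∷ ux₃ ∷ _ = ux₂
      left~right 1F 2F | ux₁ ∷ ux₂ ∷ ux₃ ∷ _ = ux₃
      left~right 2F 0F | _ ∷ _ ∷ _ ∷ vx₁ ∷ vx₂ ∷ vx₃ ∷ _ = vx₁
      left~right 2F 1F | _ ∷ _ ∷ _ ∷ vx₁ ∷ vx₂ ∷ vx₃ ∷ _ = vx₂
      left~right 2F 2F | _ ∷ _ ∷ _ ∷ vx₁ ∷ vx₂ ∷ vx₃ ∷ _ = vx₃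

      all₃ : List (Fin 3)
      all₃ = 0F ∷ 1F ∷ 2F ∷ []

      distinct₃-by : ∀ {f : Fin 3 → Graph.Vertex H} → (∀ {i j} → f i ≡ f j → i ≡ j) → Distinct₃ f all₃
      distinct₃-by inj =
        distinct₃ (λ eq → case inj eq of λ ()) (λ eq → case inj eq of λ ()) (λ eq → case inj eq of λ ())

      only-right : ∀ i {y} → Adj H (C.φ (inj₁ i)) y → ∃[ j ] C.φ (inj₂ j) ≡ y
      only-right i e = let _ , _ , _ , t = neighbours₃ H H-cubic (C.φ (inj₁ i))
                           j , _ , eq = triple-exhausted t (distinct₃-by (inj₂-injective ∘ C.φ-inj))
                             (λ {j} _ → left~right i j) e
                       in j , eq

      only-left : ∀ j {y} → Adj H (C.φ (inj₂ j)) y → ∃[ i ] C.φ (inj₁ i) ≡ y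
      only-left j e = let _ , _ , _ , t = neighbours₃ H H-cubic (C.φ (inj₂ j))
                          i , _ , eq = triple-exhausted t (distinct₃-by (inj₁-injective ∘ C.φ-inj))
                            (λ {i} _ → Graph.sym H (left~right i j)) e
                      in i , eq

      K⇒H : ∀ x y → K 3 3 x y → Adj H (C.φ x) (C.φ y)
      K⇒H _ _ (left-right {i} {j}) = left~right i j
      K⇒H _ _ (right-left {i} {j}) = Graph.sym H (left~right i j)

      H⇒K : ∀ x y → Adj H (C.φ x) (C.φ y) → K 3 3 x y
      H⇒K (inj₁ i) y e =
        let j , eq = only-right i e in subst (K 3 3 (inj₁ i)) (C.φ-inj {inj₂ j} {y} eq) left-right
      H⇒K (inj₂ j) y e =
        let i , eq = only-left j e in subst (K 3 3 (inj₂ j)) (C.φ-inj {inj₁ i} {y} eq) right-left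

    is-K₃,₃ : K 3 3 ≅ Adj H
    is-K₃,₃ = match-↔ parts cov′ , λ x y → mk⇔
      (subst₂ (Adj H) (sym (match-φ parts cov′ x)) (sym (match-φ parts cov′ y)) ∘ K⇒H x y)
      (H⇒K x y ∘ subst₂ (Adj H) (match-φ parts cov′ x) (match-φ parts cov′ y))

  module _ (R : Rel Graph 0ℓ) (C₁⇒R : ∀ {G H} → C₁ G H → R G H) (C₂⇒R : ∀ {G H} → C₂ G H → R G H)
           (connected : Connected G) where
    open Reduction₃ R C₁⇒R C₂⇒R

    -- The case of exactly two equal far ends is left to the argument `forked`, because the two
    -- claims treat it differently: one refutes it by 3-connectedness, the other goes on with two
    -- edges.
    reduce-State₃ : State₃ U p₁ p₂ p₃ s₁ s₂ s₃ H → Sweep G k U → (∀ {i} → i < k → Goal₃ i) →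
      (∀ {p₁ p₂ p₃ s y} → State₃ U p₁ p₂ p₃ s y y H → s ≢ y → Goal H) → Goal H
    reduce-State₃ {s₁ = s₁} {s₂} {s₃} {H = H} st sw rec forked with s₁ ≟ s₂ | s₁ ≟ s₃ | s₂ ≟ s₃
    ... | yes refl | yes refl | _      = H , is-K₃,₃ connected st , ε
    ... | yes refl | no s₁≢s₃ | _      = forked (swap-first (swap-last st)) (s₁≢s₃ ∘ sym)
    ... | no s₁≢s₂ | yes refl | _      = forked (swap-first st) (s₁≢s₂ ∘ sym)
    ... | no s₁≢s₂ | no _ | yes refl   = forked st s₁≢s₂
    ... | no s₁≢s₂ | no s₁≢s₃ | no s₂≢s₃ = distinct-ports st s₁≢s₂ s₁≢s₃ s₂≢s₃ sw rec

  -- The first five visits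

  data Start : ℕ → Set where
    start : State₃ U p₁ p₂ p₃ s₁ s₂ s₃ G → Sweep G k U → Start k

  module _ {c a b d v : V} (d≢b : d ≢ b) (d≢a : d ≢ a) (d≢c : d ≢ c) (b≢a : b ≢ a) (b≢c : b ≢ c) (a≢c : a ≢ c)
           (¬bc : ¬ Boundary G (⊤ - d - b - a - c) c) (v∈ : v ∈ ⊤ - d - b - a - c)
           (narrow : Narrow G (⊤ - d - b - a - c - v)) where
    private
      W = ⊤ - d - b - a - c
      vs vs′ : List V
      vs = d ∷ b ∷ a ∷ c ∷ []
      vs′ = d ∷ b ∷ a ∷ c ∷ v ∷ []
      U₀ = ⊤ - d - b - a - c - v

      seen-c : c ~ y → y ∉ W → y ≡ d ⊎ y ≡ b ⊎ y ≡ a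
      seen-c e y∉ with ∉-removals⁻ vs y∉
      ... | inj₁ y∉⊤ = contradiction ∈⊤ y∉⊤
      ... | inj₂ (here eq) = inj₁ eq
      ... | inj₂ (at₁ eq) = inj₂ (inj₁ eq)
      ... | inj₂ (at₂ eq) = inj₂ (inj₂ eq)
      ... | inj₂ (at₃ refl) = contradiction e ~-irrefl

      c~ : c ~ d × c ~ b × c ~ a
      c~ = saturates G cubic x∉p-x ¬bc seen-c

      c~d : c ~ d
      c~d = proj₁ c~
      c~b : c ~ b
      c~b = proj₁ (proj₂ c~)
      c~a : c ~ a
      c~a = proj₂ (proj₂ c~)

      leaf≁ : ∀ {x y} → c ~ x → c ~ y → ¬ x ~ y
      leaf≁ c~x c~y x~y = triangle-free c~x x~y (~-sym c~y)

      tc : IsTriple (c ~_) a b d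
      tc = neighbours₃-are c~a c~b c~d (b≢a ∘ sym) (d≢a ∘ sym) (d≢b ∘ sym)

      v≢ : All (v ≢_) vs
      v≢ = proj₂ (∈-removals⁻ vs v∈)
      v≢d = All.lookup v≢ (here refl)
      v≢b = All.lookup v≢ (at₁ refl)
      v≢a = All.lookup v≢ (at₂ refl)
      v≢c = All.lookup v≢ (at₃ refl)

      seen-leaf : ∀ {x} → c ~ x → x ~ y → y ∉ U₀ → y ≡ c ⊎ y ≡ v
      seen-leaf c~x e y∉ with ∉-removals⁻ vs′ y∉
      ... | inj₁ y∉⊤ = contradiction ∈⊤ y∉⊤
      ... | inj₂ (here refl) = contradiction e (leaf≁ c~x c~d)
      ... | inj₂ (at₁ refl) = contradiction e (leaf≁ c~x c~b)
      ... | inj₂ (at₂ refl) = contradiction e (leaf≁ c~x c~a)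
      ... | inj₂ (at₃ eq) = inj₁ eq
      ... | inj₂ (at₄ eq) = inj₂ eq

      a∉ : a ∉ U₀
      a∉ = ∉-removals⁺ vs′ (inj₂ (at₂ refl))
      b∉ : b ∉ U₀
      b∉ = ∉-removals⁺ vs′ (inj₂ (at₁ refl))
      d∉ : d ∉ U₀
      d∉ = ∉-removals⁺ vs′ (inj₂ (here refl))
      c∉ : c ∉ U₀
      c∉ = ∉-removals⁺ vs′ (inj₂ (at₃ refl))
      v∉ : v ∉ U₀
      v∉ = x∉p-x

      ¬bv : ¬ Boundary G U₀ v
      ¬bv bv = narrow ((b≢a ∘ sym ∷ d≢a ∘ sym ∷ v≢a ∘ sym ∷ [])
               ∷ (d≢b ∘ sym ∷ v≢b ∘ sym ∷ []) ∷ (v≢d ∘ sym ∷ []) ∷ [] ∷ [])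
        ( few-visited G cubic a∉ (seen-leaf c~a) ∷ few-visited G cubic b∉ (seen-leaf c~b)
        ∷ few-visited G cubic d∉ (seen-leaf c~d) ∷ bv ∷ [])

      seen-v : v ~ y → y ∉ U₀ → y ≡ d ⊎ y ≡ b ⊎ y ≡ a
      seen-v e y∉ with ∉-removals⁻ vs′ y∉
      ... | inj₁ y∉⊤ = contradiction ∈⊤ y∉⊤
      ... | inj₂ (here eq) = inj₁ eq
      ... | inj₂ (at₁ eq) = inj₂ (inj₁ eq)
      ... | inj₂ (at₂ eq) = inj₂ (inj₂ eq)
      ... | inj₂ (at₄ refl) = contradiction e ~-irrefl
      ... | inj₂ (at₃ refl) with IsTriple.only tc (~-sym e)
      ...   | inj₁ v≡a = contradiction v≡a v≢a
      ...   | inj₂ (inj₁ v≡b) = contradiction v≡b v≢b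
      ...   | inj₂ (inj₂ v≡d) = contradiction v≡d v≢d

      v~ : v ~ d × v ~ b × v ~ a
      v~ = saturates G cubic v∉ ¬bv seen-v

      v~d : v ~ d
      v~d = proj₁ v~
      v~b : v ~ b
      v~b = proj₁ (proj₂ v~)
      v~a : v ~ a
      v~a = proj₂ (proj₂ v~)

      tv : IsTriple (v ~_) a b d
      tv = neighbours₃-are v~a v~b v~d (b≢a ∘ sym) (d≢a ∘ sym) (d≢b ∘ sym)

      third : ∀ {x} → c ~ x → v ~ x → ∃[ r ] (IsTriple (x ~_) c v r × r ∈ U₀)
      third {x} c~x v~x = let r , t = neighbours₂ (~-sym c~x) (~-sym v~x) (v≢c ∘ sym) in
        r , t , decidable-stable (r ∈? U₀) λ r∉ → case seen-leaf c~x (IsTriple.Pc t) r∉ of λ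
          { (inj₁ eq) → IsTriple.a≢c t (sym eq) ; (inj₂ eq) → IsTriple.b≢c t (sym eq) }

      everything : Cover V (Fin 0) ⊤
      everything = record
        { φ = λ () ; ψ = id ; φ-inj = λ { {()} } ; ψ-inj = λ _ _ → id ; disjoint = λ { {()} }
        ; cover = λ x → inj₂ (x , ∈⊤ , refl) }

    initial-state-at : IsTriple (a ~_) c v s₁ → IsTriple (b ~_) c v s₂ → IsTriple (d ~_) c v s₃ →
                       s₁ ∈ U₀ → s₂ ∈ U₀ → s₃ ∈ U₀ → State₃ U₀ a b d s₁ s₂ s₃ G
    initial-state-at ta tb td s₁∈ s₂∈ s₃∈ = record
        { cut = record
          { p₁∉ = a∉ ; p₂∉ = b∉ ; p₃∉ = d∉ ; s₁∈ = s₁∈ ; s₂∈ = s₂∈ ; s₃∈ = s₃∈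
          ; e₁ = e₁ ; e₂ = e₂ ; e₃ = e₃ ; p₁≢p₂ = b≢a ∘ sym ; p₁≢p₃ = d≢a ∘ sym ; p₂≢p₃ = d≢b ∘ sym
          ; crosses = prune
              (crosses-visit (crosses-visit (crosses-visit (crosses-visit (crosses-visit nothing-crosses td) tb) ta) tc) tv)
              ( gone a∉ ∷ gone b∉ ∷ gone d∉ ∷ gone a∉ ∷ gone b∉ ∷ gone d∉
              ∷ gone c∉ ∷ gone v∉ ∷ (λ _ → here refl)
              ∷ gone c∉ ∷ gone v∉ ∷ (λ _ → at₁ refl)
              ∷ gone c∉ ∷ gone v∉ ∷ (λ _ → at₂ refl) ∷ [])
          }
        ; H-cubic = cubic
        ; real = record
          -- Absorbing d, b, a, c, v in this order labels v, c as 0F, 1F and a, b, d as 2F, 3F, 4F,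
          -- which is the numbering of the blob `K₂,₃`.
          { cov = absorb v∈ (absorb (∈-removals⁺ ∈⊤ (d≢c ∘ sym ∷ b≢c ∘ sym ∷ a≢c ∘ sym ∷ []))
                    (absorb (∈-removals⁺ ∈⊤ (d≢a ∘ sym ∷ b≢a ∘ sym ∷ []))
                      (absorb (∈-removals⁺ ∈⊤ (d≢b ∘ sym ∷ [])) (absorb ∈⊤ everything))))
          ; joined = v~a ∷ v~b ∷ v~d ∷ c~a ∷ c~b ∷ c~d ∷ e₁ ∷ e₂ ∷ e₃ ∷ []
          ; tail⁺ = λ _ _ e → e
          ; tail⁻ = λ _ _ e → e
          }
        }
        where
        nothing-crosses : Crosses ⊤ []
        nothing-crosses x∉ = contradiction ∈⊤ x∉
        e₁ = IsTriple.Pc ta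
        e₂ = IsTriple.Pc tb
        e₃ = IsTriple.Pc td

    initial-state : ∃[ s₁ ] ∃[ s₂ ] ∃[ s₃ ] State₃ U₀ a b d s₁ s₂ s₃ G
    initial-state =
      let _ , ta , s₁∈ = third c~a v~a
          _ , tb , s₂∈ = third c~b v~b
          _ , td , s₃∈ = third c~d v~d
      in _ , _ , _ , initial-state-at ta tb td s₁∈ s₂∈ s₃∈

  -- Not all of the first four vertices are on the boundary, so one of them, c, is adjacent to the
  -- other three. Without triangles these are pairwise non-adjacent and have only c and the fifth
  -- vertex v as possible visited neighbours; they fill the boundary, so v is not on it. As c has no
  -- free neighbour, v is adjacent to the same three.
  starting : Sweep G (5 + k) ⊤ → Start k
  starting (visit {v = v₁} _ _ (visit {v = v₂} v₂∈ _ (visit {v = v₃} v₃∈ _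
             (visit {v = v₄} v₄∈ narrow (visit {v = v₅} v₅∈ narrow′ sw))))) =
    go (boundary? G W v₁) (boundary? G W v₂) (boundary? G W v₃) (boundary? G W v₄)
    where
    W = ⊤ - v₁ - v₂ - v₃ - v₄
    v₂≢v₁ = proj₂ (∈-remove⁻ v₂∈)
    v₃≢ : All (v₃ ≢_) (v₁ ∷ v₂ ∷ [])
    v₃≢ = proj₂ (∈-removals⁻ (v₁ ∷ v₂ ∷ []) v₃∈)
    v₄≢ : All (v₄ ≢_) (v₁ ∷ v₂ ∷ v₃ ∷ [])
    v₄≢ = proj₂ (∈-removals⁻ (v₁ ∷ v₂ ∷ v₃ ∷ []) v₄∈)
    d₁₂ : v₁ ≢ v₂
    d₁₂ = v₂≢v₁ ∘ sym
    d₁₃ : v₁ ≢ v₃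
    d₁₃ = All.lookup v₃≢ (here refl) ∘ sym
    d₂₃ : v₂ ≢ v₃
    d₂₃ = All.lookup v₃≢ (at₁ refl) ∘ sym
    d₁₄ : v₁ ≢ v₄
    d₁₄ = All.lookup v₄≢ (here refl) ∘ sym
    d₂₄ : v₂ ≢ v₄
    d₂₄ = All.lookup v₄≢ (at₁ refl) ∘ sym
    d₃₄ : v₃ ≢ v₄
    d₃₄ = All.lookup v₄≢ (at₂ refl) ∘ sym
    centred : ∀ {c a b d} → d ≢ b → d ≢ a → d ≢ c → b ≢ a → b ≢ c → a ≢ c →
              W ≡ ⊤ - d - b - a - c → ¬ Boundary G W c → Start _
    centred {c} d≢b d≢a d≢c b≢a b≢c a≢c eq ¬bc =
      let _ , _ , _ , st = initial-state d≢b d≢a d≢c b≢a b≢c a≢c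
            (subst (λ W → ¬ Boundary G W c) eq ¬bc) (subst (v₅ ∈_) eq v₅∈)
            (subst (λ W → Narrow G (W - v₅)) eq narrow′)
      in start st (subst (λ W → Sweep G _ (W - v₅)) eq sw)
    swap₃₄ : W ≡ ⊤ - v₁ - v₂ - v₄ - v₃
    swap₃₄ = p─x─y≡p─y─x (⊤ - v₁ - v₂) v₃ v₄
    swap₂₃₄ : W ≡ ⊤ - v₁ - v₃ - v₄ - v₂
    swap₂₃₄ = trans (cong (_- v₄) (p─x─y≡p─y─x (⊤ - v₁) v₂ v₃)) (p─x─y≡p─y─x (⊤ - v₁ - v₃) v₂ v₄)
    swap₁₂₃₄ : W ≡ ⊤ - v₂ - v₃ - v₄ - v₁
    swap₁₂₃₄ = trans (cong (λ U → U - v₃ - v₄) (p─x─y≡p─y─x ⊤ v₁ v₂))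
      (trans (cong (_- v₄) (p─x─y≡p─y─x (⊤ - v₂) v₁ v₃)) (p─x─y≡p─y─x (⊤ - v₂ - v₃) v₁ v₄))
    go : Dec (Boundary G W v₁) → Dec (Boundary G W v₂) → Dec (Boundary G W v₃) → Dec (Boundary G W v₄) → Start _
    go _ _ _ (no ¬b) = centred d₁₂ d₁₃ d₁₄ d₂₃ d₂₄ d₃₄ refl ¬b
    go _ _ (no ¬b) _ = centred d₁₂ d₁₄ d₁₃ d₂₄ d₂₃ (d₃₄ ∘ sym) swap₃₄ ¬b
    go _ (no ¬b) _ _ = centred d₁₃ d₁₄ d₁₂ d₃₄ (d₂₃ ∘ sym) (d₂₄ ∘ sym) swap₂₃₄ ¬b
    go (no ¬b) _ _ _ = centred d₂₃ d₂₄ (d₁₂ ∘ sym) d₃₄ (d₁₃ ∘ sym) (d₁₄ ∘ sym) swap₁₂₃₄ ¬b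
    go (yes b₁) (yes b₂) (yes b₃) (yes b₄) = contradiction (b₁ ∷ b₂ ∷ b₃ ∷ b₄ ∷ [])
      (narrow ((d₁₂ ∷ d₁₃ ∷ d₁₄ ∷ []) ∷ (d₂₃ ∷ d₂₄ ∷ []) ∷ (d₃₄ ∷ []) ∷ [] ∷ []))

  -- Guarantees five visits: x, its neighbours a, b, c, and another neighbour d of a, which differs
  -- from b and c because there is no triangle.
  5≤order : V → 5 ≤ order
  5≤order x with a , b , c , triple a≢b a≢c b≢c x~a x~b x~c _ ← neighbours₃ G cubic x
    with d , _ , triple x≢d _ _ _ a~d _ _ ← neighbours₁ (~-sym x~a) =
    subst (5 ≤_) (∣⊤∣≡n order) (unique⇒length≤ {xs = x ∷ a ∷ b ∷ c ∷ d ∷ []}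
      ( (~⇒≢ G cubic x~a ∷ ~⇒≢ G cubic x~b ∷ ~⇒≢ G cubic x~c ∷ x≢d ∷ [])
      ∷ (a≢b ∷ a≢c ∷ ~⇒≢ G cubic a~d ∷ [])
      ∷ (b≢c ∷ (λ { refl → triangle-free x~a a~d (~-sym x~b) }) ∷ [])
      ∷ ((λ { refl → triangle-free x~a a~d (~-sym x~c) }) ∷ []) ∷ [] ∷ [])
      (∈⊤ ∷ ∈⊤ ∷ ∈⊤ ∷ ∈⊤ ∷ ∈⊤ ∷ []))

  -- The two inductions

  start-sweep : V → (P : PathDecomposition G) → PathDecomposition.width P ≤ 3 → ∃[ k ] Start k
  start-sweep x P width≤3 = go (5≤order x) (sweep G P width≤3 order (∣⊤∣≡n order) (λ x∉ → contradiction ∈⊤ x∉))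
    where
    go : ∀ {m} → 5 ≤ m → Sweep G m ⊤ → ∃[ k ] Start k
    go (s≤s (s≤s (s≤s (s≤s (s≤s _))))) sw = _ , starting sw

  part₁ : (3 -Connected) G → V → (P : PathDecomposition G) → PathDecomposition.width P ≤ 3 →
          ConstructibleFromK₃,₃By (C₁ ∪ C₂) G
  part₁ 3-connected x P width≤3 with k , start st sw ← start-sweep x P width≤3 = all (suc k) ≤-refl st sw
    where
    R : Rel Graph 0ℓ
    R = C₁ ∪ C₂
    -- `k` only bounds the length of the sweep, which turns the strong induction into a structural
    -- one.
    all : ∀ k {i} → i < k → Reduction₃.Goal₃ R inj₁ inj₂ i
    all (suc k) (s≤s i≤k) st sw = reduce-State₃ R inj₁ inj₂ (3-connected⇒connected {G} 3-connected) st sw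
      (λ j<i → all k (≤-trans j<i i≤k))
      (λ st s≢y → contradiction 3-connected (¬3-connected st s≢y))

  part₂ : Connected G → V → (P : PathDecomposition G) → PathDecomposition.width P ≤ 3 →
          ConstructibleFromK₃,₃By (C₁ ∪ C₂ ∪ C₃ ∪ C₄ ∪ C₅ ∪ C₆) G
  part₂ connected x P width≤3 with k , start st sw ← start-sweep x P width≤3 = proj₁ (all (suc k) ≤-refl) st sw
    where
    R : Rel Graph 0ℓ
    R = C₁ ∪ C₂ ∪ C₃ ∪ C₄ ∪ C₅ ∪ C₆
    c₁⇒R : ∀ {G H} → C₁ G H → R G H
    c₁⇒R = inj₁
    c₂⇒R : ∀ {G H} → C₂ G H → R G H
    c₂⇒R = inj₂ ∘ inj₁
    module R₂ = Reduction₂ R (inj₂ ∘ inj₂ ∘ inj₁) (inj₂ ∘ inj₂ ∘ inj₂ ∘ inj₁)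
      (inj₂ ∘ inj₂ ∘ inj₂ ∘ inj₂ ∘ inj₁) (inj₂ ∘ inj₂ ∘ inj₂ ∘ inj₂ ∘ inj₂)
    -- Both statements are proved together: a fork leads from three edges to two, C₃ and C₄ lead
    -- back, and either way the sweep gets shorter.
    all : ∀ k {i} → i < k → R₂.Goal₃ i × R₂.Goal₂ i
    all (suc k) {i} (s≤s i≤k) = case₃ , case₂
      where
      rec : ∀ {j} → j < i → R₂.Goal₃ j × R₂.Goal₂ j
      rec j<i = all k (≤-trans j<i i≤k)
      case₃ : R₂.Goal₃ i
      case₃ st sw = reduce-State₃ R c₁⇒R c₂⇒R connected st sw (proj₁ ∘ rec)
        λ st s≢y → let _ , st₂ = fork st s≢y ; _ , j<i , sw′ = sweep-fork st s≢y sw in proj₂ (rec j<i) st₂ sw′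
      case₂ : R₂.Goal₂ i
      case₂ st sw = R₂.reduce-State₂ st sw (proj₂ ∘ rec) (proj₁ ∘ rec)

theorem4 : (∀ (G : Graph) → (3 -Connected) G → Cubic G → HasPathWidth G 3 → HasGirth G 4 →
    ConstructibleFromK₃,₃By (C₁ ∪ C₂) G) ×
    (∀ (G : Graph) → Connected G → Cubic G → HasPathWidth G 3 → HasGirth G 4 →
    ConstructibleFromK₃,₃By (C₁ ∪ C₂ ∪ C₃ ∪ C₄ ∪ C₅ ∪ C₆) G)
theorem4 =
  -- The starting vertex is taken from the cycle of length 4, as the field `nonEmpty` is irrelevant
  -- and yields no vertex directly.
  (λ { G 3-connected cubic ((P , width≡3) , _) girth@(cycle , _) →
    Conclusion.part₁ G cubic (no-triangles {G} girth) 3-connected (Cycle.start cycle) P (≤-reflexive width≡3) }) ,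
  (λ { G connected cubic ((P , width≡3) , _) girth@(cycle , _) →
    Conclusion.part₂ G cubic (no-triangles {G} girth) connected (Cycle.start cycle) P (≤-reflexive width≡3) })
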